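{- There exists an absolute constant $C>0$ such that the following holds. Let $G=(V,E)$ be a connected undirected multigraph with $m=|E|$ edges and edge connectivity $\lambda$, and let $T_1,T_2,\ldots,T_k$ be a greedy tree packing of $G$ with $k\ge C\lambda^5\log m$ trees. Then some tree $T_i$ ($1\le i\le k$) crosses some minimum cut of $G$ exactly once, i.e. there is a set $\varnothing\neq S\subsetneq V$ with $|\partial S|=\lambda$ and $|T_i\cap\partial S|=1$.
   Context: For $S\subseteq V$, $\partial S$ denotes the set of edges with exactly one endpoint in $S$; a minimum cut is a set $S$ with $|\partial S|=\lambda$. A greedy tree packing is a sequence of spanning trees $T_1,T_2,\ldots$ of $G$ such that, for each $j\ge1$, $T_j$ is a minimum-weight spanning tree of $G$ with respect to the edge weights $w_j(e)=|\{i<j : e\in T_i\}|$ (ties broken arbitrarily). A tree $T$ crosses the cut $\partial S$ exactly $|T\cap\partial S|$ times. $\log$ is the natural logarithm. -}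

module Defs where

open import Data.Nat using (ℕ; zero; suc; _+_; _≤_; _<_)
open import Data.Bool using (Bool; true; false; if_then_else_; _xor_; _∧_)
open import Data.Fin using (Fin; toℕ)
import Data.Fin as F
open import Data.Product using (Σ; ∃; _×_; _,_; proj₁; proj₂)
open import Relation.Binary.PropositionalEquality using (_≡_)
open import Relation.Nullary.Decidable using (⌊_⌋)
open import Data.Nat using (_<?_)

-- A finite undirected multigraph on vertex set Fin n with m edges (loops allowed):
-- edge i has endpoints (proj₁ (ends i), proj₂ (ends i)).
record Multigraph : Set where
  constructor mkGraph
  field
    n    : ℕ
    m    : ℕ
    ends : Fin m → Fin n × Fin n
open Multigraph public

sumFin : ∀ {k} → (Fin k → ℕ) → ℕ
sumFin {zero}  f = 0
sumFin {suc k} f = f F.zero + sumFin (λ i → f (F.suc i))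

countFin : ∀ {k} → (Fin k → Bool) → ℕ
countFin p = sumFin (λ i → if p i then 1 else 0)

EdgeSet : Multigraph → Set
EdgeSet G = Fin (m G) → Bool

VertexSet : Multigraph → Set
VertexSet G = Fin (n G) → Bool

data Reach (G : Multigraph) (T : EdgeSet G) : Fin (n G) → Fin (n G) → Set where
  here  : ∀ {u} → Reach G T u u
  fwd   : ∀ {u v} (i : Fin (m G)) → T i ≡ true → proj₁ (ends G i) ≡ u →
          Reach G T (proj₂ (ends G i)) v → Reach G T u v
  bwd   : ∀ {u v} (i : Fin (m G)) → T i ≡ true → proj₂ (ends G i) ≡ u →
          Reach G T (proj₁ (ends G i)) v → Reach G T u v

allEdges : (G : Multigraph) → EdgeSet G
allEdges G _ = true

Connected : Multigraph → Set
Connected G = ∀ u v → Reach G (allEdges G) u v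

IsSpanningTree : (G : Multigraph) → EdgeSet G → Set
IsSpanningTree G T = (suc (countFin T) ≡ n G) × (∀ u v → Reach G T u v)

weight : (G : Multigraph) → (Fin (m G) → ℕ) → EdgeSet G → ℕ
weight G w T = sumFin (λ i → if T i then w i else 0)

IsMinSpanningTree : (G : Multigraph) → (Fin (m G) → ℕ) → EdgeSet G → Set
IsMinSpanningTree G w T =
  IsSpanningTree G T × (∀ T' → IsSpanningTree G T' → weight G w T ≤ weight G w T')

packWeight : (G : Multigraph) {k : ℕ} → (Fin k → EdgeSet G) → Fin k → Fin (m G) → ℕ
packWeight G T j e = countFin (λ i → ⌊ toℕ i <? toℕ j ⌋ ∧ T i e)

IsGreedyTreePacking : (G : Multigraph) {k : ℕ} → (Fin k → EdgeSet G) → Set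
IsGreedyTreePacking G T = ∀ j → IsMinSpanningTree G (packWeight G T j) (T j)

crosses : (G : Multigraph) → VertexSet G → Fin (m G) → Bool
crosses G S i = S (proj₁ (ends G i)) xor S (proj₂ (ends G i))

cutSize : (G : Multigraph) → VertexSet G → ℕ
cutSize G S = countFin (crosses G S)

crossCount : (G : Multigraph) → EdgeSet G → VertexSet G → ℕ
crossCount G T S = countFin (λ i → T i ∧ crosses G S i)

Nontrivial : (G : Multigraph) → VertexSet G → Set
Nontrivial G S = (∃ λ v → S v ≡ true) × (∃ λ v → S v ≡ false)

IsEdgeConnectivity : (G : Multigraph) → ℕ → Set
IsEdgeConnectivity G l =
  (∃ λ S → Nontrivial G S × cutSize G S ≡ l) ×
  (∀ S → Nontrivial G S → l ≤ cutSize G S)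

{-# OPTIONS --safe #-}
-- For a ratio a/b let A maximize a∣A∣ − b·rank(A) over the edge sets A. Exponential potentials, driven by
-- the optimality of the greedy minimum spanning trees on every weight layer, show that after i rounds the
-- edges of A have load at most about (a/b)i and the other edges at least about (a/b)i.
-- Suppose no tree crosses a minimum cut once, and take 32ℓ + 1 ratios slightly below 2/ℓ. At each of these
-- levels the classes of A of degree ℓ are crossed at least twice by every tree, and those of larger degree
-- carry a load exceeding twice the number of trees. Compared with the V − 1 edges that a tree needs to join
-- the V classes, the late trees thus use an average excess of order at least x/ℓ, where x = 2∣Aᶜ∣ − ℓV at the
-- first level, and this excess barely changes along the levels. But once the loads separate consecutive levels,
-- the excess is at most the number of classes merged between them, and all merges together number at most 4x.
module Submission where

open import Defs
open import Data.Nat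
open import Data.Nat.Properties
open import Data.Nat.Tactic.RingSolver using (solve-∀)
open import Data.Nat.Logarithm using (⌈log₂_⌉; ⌈log₂⌉-mono-≤; ⌈log₂⌈n/2⌉⌉≡⌈log₂n⌉∸1)
open import Data.Nat.DivMod using (m*n/n≡m; /-monoˡ-≤; m/n*n≤m)
open import Data.Nat.Induction using (<-rec)
open import Data.Bool using (Bool; true; false; if_then_else_; _∧_; _∨_; not; _xor_; T)
open import Data.Unit using (tt)
open import Data.Bool.Properties using (∨-identityʳ; ∨-assoc) renaming (_≟_ to _≟ᵇ_)
open import Data.Fin using (Fin; toℕ; fromℕ<)
import Data.Fin as F
import Data.Fin.Properties as FP
open import Data.Product using (Σ; ∃; _×_; _,_; proj₁; proj₂)
open import Data.Sum using (_⊎_; inj₁; inj₂)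
open import Data.Empty using (⊥; ⊥-elim)
open import Relation.Nullary using (¬_; Dec; yes; no; does)
open import Relation.Nullary.Decidable using (⌊_⌋; isYes≗does)
open import Relation.Binary.PropositionalEquality
open import Function using (_∘_)

-- The edges outside one optimal set need not be cut off by a load threshold, so a tree may use more
-- than V - 1 of them and a single level gives no contradiction. Two consecutive levels sandwich a
-- threshold set once the loads are precise enough; an excess then forces classes to merge, and an
-- excess that persists exhausts them. The fifth power has the following origin. A ratio below 2/ℓ
-- at which degree ℓ + 1 still forces a load above 2 per tree lies within order 1/ℓ² of 2/ℓ. Order ℓ
-- levels in this window have spacing of order 1/ℓ³, so their common denominator `b` has order ℓ³
-- and the numerators have order ℓ². Potentials with base 1 + 1/q bound loads with relative error
-- about 1/q, so `q` of order ℓ² resolves neighbouring numerators, at the price of an additive error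
-- q log m. After i rounds the ideal loads of adjacent levels differ by i/b, which exceeds that
-- error once i has order b q log m. The rounds before this time are left out of the excess, and at
-- least as many are observed afterwards. Ratios are pairs of naturals and logarithms are
-- comparisons of exponents, so everything stays in integer arithmetic.

⟦_⟧ : Bool → ℕ
⟦ b ⟧ = if b then 1 else 0

δ : ∀ {n} → Fin n → Fin n → Bool
δ i j = does (i F.≟ j)

δ-refl : ∀ {n} (i : Fin n) → δ i i ≡ true
δ-refl i with i F.≟ i
... | yes _ = refl
... | no i≢i = ⊥-elim (i≢i refl)

δ-sound : ∀ {n} {i j : Fin n} → δ i j ≡ true → i ≡ j
δ-sound {i = i} {j} eq with i F.≟ j
... | yes p = p
δ-sound () | no _

δ-≢ : ∀ {n} {i j : Fin n} → i ≢ j → δ i j ≡ false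
δ-≢ {i = i} {j} ne with i F.≟ j
... | yes p = ⊥-elim (ne p)
... | no _ = refl

-- Finite sums and counts

sum-cong : ∀ {k} {f g : Fin k → ℕ} → (∀ i → f i ≡ g i) → sumFin f ≡ sumFin g
sum-cong {zero}  eq = refl
sum-cong {suc k} eq = cong₂ _+_ (eq F.zero) (sum-cong (eq ∘ F.suc))

sum-mono : ∀ {k} {f g : Fin k → ℕ} → (∀ i → f i ≤ g i) → sumFin f ≤ sumFin g
sum-mono {zero}  le = z≤n
sum-mono {suc k} le = +-mono-≤ (le F.zero) (sum-mono (le ∘ F.suc))

sum-+ : ∀ {k} (f g : Fin k → ℕ) → sumFin (λ i → f i + g i) ≡ sumFin f + sumFin g
sum-+ {zero}  f g = refl
sum-+ {suc k} f g = trans (cong (f F.zero + g F.zero +_) (sum-+ (f ∘ F.suc) (g ∘ F.suc)))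
  (+-interchange (f F.zero) (g F.zero) _ _)
  where
  +-interchange : ∀ a b c d → a + b + (c + d) ≡ a + c + (b + d)
  +-interchange = solve-∀

sum-* : ∀ {k} c (f : Fin k → ℕ) → sumFin (λ i → c * f i) ≡ c * sumFin f
sum-* {zero}  c f = sym (*-zeroʳ c)
sum-* {suc k} c f = trans (cong (c * f F.zero +_) (sum-* c (f ∘ F.suc)))
  (sym (*-distribˡ-+ c (f F.zero) _))

sum-0 : ∀ k → sumFin {k} (λ _ → 0) ≡ 0
sum-0 zero    = refl
sum-0 (suc k) = sum-0 k

sum-1 : ∀ k → sumFin {k} (λ _ → 1) ≡ k
sum-1 zero    = refl
sum-1 (suc k) = cong suc (sum-1 k)

sum-swap : ∀ {k l} (f : Fin k → Fin l → ℕ) →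
  sumFin (λ i → sumFin (f i)) ≡ sumFin (λ j → sumFin (λ i → f i j))
sum-swap {zero}  {l} f = sym (sum-0 l)
sum-swap {suc k} f = trans (cong (sumFin (f F.zero) +_) (sum-swap (f ∘ F.suc)))
  (sym (sum-+ (f F.zero) _))

sum-pick : ∀ {k} (f : Fin k → ℕ) j → sumFin (λ i → if δ j i then f i else 0) ≡ f j
sum-pick {suc k} f F.zero    = trans (cong (f F.zero +_) (sum-0 k)) (+-identityʳ _)
sum-pick {suc k} f (F.suc j) = sum-pick (f ∘ F.suc) j

sum-δ : ∀ {k} (j : Fin k) → sumFin (λ i → ⟦ δ j i ⟧) ≡ 1
sum-δ = sum-pick (λ _ → 1)

≤-sum : ∀ {k} (f : Fin k → ℕ) j → f j ≤ sumFin f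
≤-sum f F.zero    = m≤m+n _ _
≤-sum f (F.suc j) = ≤-trans (≤-sum (f ∘ F.suc) j) (m≤n+m _ _)

⟦⟧-mono : ∀ {p q} → (p ≡ true → q ≡ true) → ⟦ p ⟧ ≤ ⟦ q ⟧
⟦⟧-mono {false} imp = z≤n
⟦⟧-mono {true}  imp rewrite imp refl = ≤-refl

⟦⟧-split : ∀ p q → ⟦ p ⟧ ≡ ⟦ p ∧ q ⟧ + ⟦ p ∧ not q ⟧
⟦⟧-split false q     = refl
⟦⟧-split true  false = refl
⟦⟧-split true  true  = refl

∧-true : ∀ {p q} → p ∧ q ≡ true → p ≡ true × q ≡ true
∧-true {true} eq = refl , eq

∧-intro : ∀ {p q} → p ≡ true → q ≡ true → p ∧ q ≡ true
∧-intro refl refl = refl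

∨-true : ∀ {p q} → p ∨ q ≡ true → p ≡ true ⊎ q ≡ true
∨-true {true}  eq = inj₁ refl
∨-true {false} eq = inj₂ eq

∨-introˡ : ∀ {p q} → p ≡ true → p ∨ q ≡ true
∨-introˡ refl = refl

∨-introʳ : ∀ {p q} → q ≡ true → p ∨ q ≡ true
∨-introʳ {true}  refl = refl
∨-introʳ {false} refl = refl

not-true : ∀ {p} → not p ≡ true → p ≡ false
not-true {false} eq = refl

true≢false : ∀ {p} → p ≡ true → p ≡ false → ⊥
true≢false refl ()

<ᵇ-true : ∀ {a b} → (a <ᵇ b) ≡ true → a < b
<ᵇ-true {a} {b} eq = <ᵇ⇒< a b (subst T (sym eq) tt)

<ᵇ-intro : ∀ {a b} → a < b → (a <ᵇ b) ≡ true
<ᵇ-intro {a} {b} lt with a <ᵇ b in eq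
... | true  = refl
... | false = ⊥-elim (subst T eq (<⇒<ᵇ lt))

<ᵇ-false : ∀ {a b} → (a <ᵇ b) ≡ false → b ≤ a
<ᵇ-false eq = ≮⇒≥ (λ lt → true≢false (<ᵇ-intro lt) eq)

count-cong : ∀ {k} {p q : Fin k → Bool} → (∀ i → p i ≡ q i) → countFin p ≡ countFin q
count-cong eq = sum-cong (λ i → cong ⟦_⟧ (eq i))

count-mono : ∀ {k} {p q : Fin k → Bool} → (∀ i → p i ≡ true → q i ≡ true) →
  countFin p ≤ countFin q
count-mono imp = sum-mono (λ i → ⟦⟧-mono (imp i))

count-split : ∀ {k} (p q : Fin k → Bool) →
  countFin p ≡ countFin (λ i → p i ∧ q i) + countFin (λ i → p i ∧ not (q i))
count-split p q = trans (sum-cong (λ i → ⟦⟧-split (p i) (q i)))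
  (sum-+ (λ i → ⟦ p i ∧ q i ⟧) (λ i → ⟦ p i ∧ not (q i) ⟧))

-- Double counting of the pairs (i, d) with `q d` and `g d` equal to i: every i satisfying `p` has
-- the partner `f i`, while every d belongs to a single i.
count-inject : ∀ {j k} {p : Fin j → Bool} {q : Fin k → Bool}
  (f : Fin j → Fin k) (g : Fin k → Fin j) →
  (∀ i → p i ≡ true → q (f i) ≡ true × g (f i) ≡ i) → countFin p ≤ countFin q
count-inject {j} {k} {p} {q} f g inj = begin
  sumFin (λ i → ⟦ p i ⟧)                         ≤⟨ sum-mono row ⟩
  sumFin (λ i → sumFin (λ d → ⟦ q d ∧ δ (g d) i ⟧)) ≡⟨ sum-swap (λ i d → ⟦ q d ∧ δ (g d) i ⟧) ⟩
  sumFin (λ d → sumFin (λ i → ⟦ q d ∧ δ (g d) i ⟧)) ≡⟨ sum-cong column ⟩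
  sumFin (λ d → ⟦ q d ⟧)                         ∎
  where
  open ≤-Reasoning
  row : ∀ i → ⟦ p i ⟧ ≤ sumFin (λ d → ⟦ q d ∧ δ (g d) i ⟧)
  row i = ≤-trans (⟦⟧-mono (λ pi → ∧-intro (proj₁ (inj i pi))
    (subst (λ x → δ x i ≡ true) (sym (proj₂ (inj i pi))) (δ-refl i))))
    (≤-sum (λ d → ⟦ q d ∧ δ (g d) i ⟧) (f i))
  column : ∀ d → sumFin (λ i → ⟦ q d ∧ δ (g d) i ⟧) ≡ ⟦ q d ⟧
  column d with q d
  ... | true  = sum-δ (g d)
  ... | false = sum-0 j

count-≥1 : ∀ {k} {p : Fin k → Bool} i → p i ≡ true → 1 ≤ countFin p
count-≥1 {p = p} i pi = ≤-trans (≤-reflexive (cong ⟦_⟧ (sym pi))) (≤-sum (λ j → ⟦ p j ⟧) i)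

-- Induction and minimization over Boolean functions

_◂_ : ∀ {k} → Bool → (Fin k → Bool) → Fin (suc k) → Bool
(b ◂ X) F.zero    = b
(b ◂ X) (F.suc i) = X i

◂-cong : ∀ {k} b {X Y : Fin k → Bool} → (∀ i → X i ≡ Y i) → ∀ i → (b ◂ X) i ≡ (b ◂ Y) i
◂-cong b eq F.zero    = refl
◂-cong b eq (F.suc i) = eq i

◂-η : ∀ {k} (Y : Fin (suc k) → Bool) i → Y i ≡ (Y F.zero ◂ (Y ∘ F.suc)) i
◂-η Y F.zero    = refl
◂-η Y (F.suc i) = refl

insert : ∀ {k} → (Fin k → Bool) → Fin k → Fin k → Bool
insert X e i = X i ∨ δ i e

-- Pointwise equal functions need not be propositionally equal, so the predicate has to be invariant
-- under pointwise equality before a function can be rebuilt from its head and its tail.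
BoolFun-induction : ∀ {k} (P : (Fin k → Bool) → Set) →
  (∀ {X Y} → (∀ i → X i ≡ Y i) → P X → P Y) →
  P (λ _ → false) → (∀ X e → X e ≡ false → P X → P (insert X e)) → ∀ X → P X
BoolFun-induction {zero}  P ext base step X = ext (λ ()) base
BoolFun-induction {suc k} P ext base step X = finish (X F.zero) refl
  where
  ext₀ : ∀ {Y Z} → Y F.zero ≡ Z F.zero → (∀ i → Y (F.suc i) ≡ Z (F.suc i)) → P Y → P Z
  ext₀ eq₀ eq = ext λ { F.zero → eq₀ ; (F.suc i) → eq i }
  tail : P (false ◂ (X ∘ F.suc))
  tail = BoolFun-induction (λ Y → P (false ◂ Y)) (λ eq → ext (◂-cong false eq))
    (ext₀ refl (λ i → refl) base)
    (λ Y e Ye p → ext₀ refl (λ i → refl) (step (false ◂ Y) (F.suc e) Ye p))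
    (X ∘ F.suc)
  finish : ∀ b → X F.zero ≡ b → P X
  finish false eq = ext₀ (sym eq) (λ i → refl) tail
  finish true  eq = ext₀ (sym eq) (λ i → ∨-identityʳ (X (F.suc i)))
    (step (false ◂ (X ∘ F.suc)) F.zero refl tail)

-- Exhaustive search. It supplies the optimal edge sets and, applied to a distance from a target,
-- the decision procedure `crossed-once?`.
BoolFun-min : ∀ {k} (f : (Fin k → Bool) → ℕ) →
  (∀ {X Y} → (∀ i → X i ≡ Y i) → f X ≡ f Y) → ∃ λ X → ∀ Y → f X ≤ f Y
BoolFun-min {zero}  f ext = (λ ()) , λ Y → ≤-reflexive (ext (λ ()))
BoolFun-min {suc k} f ext = choose (≤-total (f (true ◂ X₁)) (f (false ◂ X₀)))
  where
  min : ∀ b → ∃ λ X → ∀ Y → f (b ◂ X) ≤ f (b ◂ Y)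
  min b = BoolFun-min (λ X → f (b ◂ X)) (λ eq → ext (◂-cong b eq))
  X₁ = proj₁ (min true)
  X₀ = proj₁ (min false)
  below : ∀ {z} → z ≤ f (true ◂ X₁) → z ≤ f (false ◂ X₀) → ∀ b Y → z ≤ f (b ◂ Y)
  below z₁ z₀ true  Y = ≤-trans z₁ (proj₂ (min true) Y)
  below z₁ z₀ false Y = ≤-trans z₀ (proj₂ (min false) Y)
  choose : f (true ◂ X₁) ≤ f (false ◂ X₀) ⊎ f (false ◂ X₀) ≤ f (true ◂ X₁) →
    ∃ λ X → ∀ Y → f X ≤ f Y
  choose (inj₁ le) = (true ◂ X₁) , λ Y →
    subst (f (true ◂ X₁) ≤_) (sym (ext (◂-η Y))) (below ≤-refl le (Y F.zero) (Y ∘ F.suc))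
  choose (inj₂ le) = (false ◂ X₀) , λ Y →
    subst (f (false ◂ X₀) ≤_) (sym (ext (◂-η Y))) (below le ≤-refl (Y F.zero) (Y ∘ F.suc))

psum : (ℕ → ℕ) → ℕ → ℕ
psum f zero    = 0
psum f (suc k) = psum f k + f k

psum-+ : ∀ f h k → psum f (h + k) ≡ psum f h + psum (λ i → f (h + i)) k
psum-+ f h zero    = trans (cong (psum f) (+-identityʳ h)) (sym (+-identityʳ _))
psum-+ f h (suc k) = trans (cong (psum f) (+-suc h k))
  (trans (cong (_+ f (h + k)) (psum-+ f h k)) (+-assoc (psum f h) _ _))

psum-sum : ∀ {j} (f : ℕ → Fin j → ℕ) k →
  sumFin (λ e → psum (λ i → f i e) k) ≡ psum (λ i → sumFin (f i)) k
psum-sum {j} f zero = sum-0 j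
psum-sum f (suc k)  = trans (sum-+ (λ e → psum (λ i → f i e) k) (f k))
  (cong (_+ sumFin (f k)) (psum-sum f k))

psum-cong : ∀ {f g : ℕ → ℕ} k → (∀ i → i < k → f i ≡ g i) → psum f k ≡ psum g k
psum-cong zero    eq = refl
psum-cong (suc k) eq = cong₂ _+_ (psum-cong k (λ i lt → eq i (m≤n⇒m≤1+n lt))) (eq k ≤-refl)

psum-≥ : ∀ {f : ℕ → ℕ} {c} k → (∀ i → i < k → c ≤ f i) → k * c ≤ psum f k
psum-≥ zero    le = z≤n
psum-≥ {f} {c} (suc k) le = ≤-trans (≤-reflexive (+-comm c (k * c)))
  (+-mono-≤ (psum-≥ k (λ i lt → le i (m≤n⇒m≤1+n lt))) (le k ≤-refl))

psum-* : ∀ c (f : ℕ → ℕ) k → psum (λ i → c * f i) k ≡ c * psum f k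
psum-* c f zero    = sym (*-zeroʳ c)
psum-* c f (suc k) = trans (cong (_+ c * f k) (psum-* c f k)) (sym (*-distribˡ-+ c _ (f k)))

-- Component labelling of an edge set

merge : ∀ {n} → (Fin n → Fin n) → Fin n → Fin n → Fin n → Fin n
merge ρ u v x = if δ (ρ x) (ρ u) then ρ v else ρ x

merge-ends : ∀ {n} (ρ : Fin n → Fin n) u v → merge ρ u v u ≡ merge ρ u v v
merge-ends ρ u v rewrite δ-refl (ρ u) with δ (ρ v) (ρ u)
... | true  = refl
... | false = refl

labels : ∀ {n m} → (Fin m → Fin n × Fin n) → (Fin m → Bool) → Fin n → Fin n
labels {m = zero}  ends A = λ x → x
labels {m = suc m} ends A =
  if A F.zero then merge ρ (proj₁ (ends F.zero)) (proj₂ (ends F.zero)) else ρ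
  where ρ = labels (ends ∘ F.suc) (A ∘ F.suc)

Respects : ∀ {n m} → (Fin m → Fin n × Fin n) → (Fin m → Bool) → (Fin n → Fin n) → Set
Respects ends A ρ = ∀ e → A e ≡ true → ρ (proj₁ (ends e)) ≡ ρ (proj₂ (ends e))

labels-respects : ∀ {n m} (ends : Fin m → Fin n × Fin n) A → Respects ends A (labels ends A)
labels-respects {m = suc m} ends A e Ae with A F.zero in eq
labels-respects {m = suc m} ends A F.zero Ae | true =
  merge-ends (labels (ends ∘ F.suc) (A ∘ F.suc)) (proj₁ (ends F.zero)) (proj₂ (ends F.zero))
labels-respects {m = suc m} ends A F.zero Ae | false = ⊥-elim (true≢false Ae eq)
labels-respects {m = suc m} ends A (F.suc e) Ae | true
  rewrite labels-respects (ends ∘ F.suc) (A ∘ F.suc) e Ae = refl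
labels-respects {m = suc m} ends A (F.suc e) Ae | false =
  labels-respects (ends ∘ F.suc) (A ∘ F.suc) e Ae

-- Relations instead of functions, because two uses are intended: the kernel of a labelling gives
-- the universal property of `lab`, and reachability gives a path from each vertex to its root.
labels-least : ∀ {n m} (ends : Fin m → Fin n × Fin n) A (R : Fin n → Fin n → Set) →
  (∀ {x} → R x x) → (∀ {x y} → R x y → R y x) → (∀ {x y z} → R x y → R y z → R x z) →
  (∀ e → A e ≡ true → R (proj₁ (ends e)) (proj₂ (ends e))) → ∀ x → R x (labels ends A x)
labels-least {m = zero}  ends A R rf sy tr step x = rf
labels-least {m = suc m} ends A R rf sy tr step x with A F.zero in eq
... | false = labels-least (ends ∘ F.suc) (A ∘ F.suc) R rf sy tr (step ∘ F.suc) x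
... | true with labels (ends ∘ F.suc) (A ∘ F.suc) x F.≟
                labels (ends ∘ F.suc) (A ∘ F.suc) (proj₁ (ends F.zero))
...   | no  _ = labels-least (ends ∘ F.suc) (A ∘ F.suc) R rf sy tr (step ∘ F.suc) x
...   | yes p = tr (subst (R x) p (ih x)) (tr (sy (ih _)) (tr (step F.zero eq) (ih _)))
  where ih = labels-least (ends ∘ F.suc) (A ∘ F.suc) R rf sy tr (step ∘ F.suc)

roots : ∀ {n} → (Fin n → Fin n) → ℕ
roots ρ = countFin (λ c → δ (ρ c) c)

module Components (G : Multigraph) where

  src tgt : Fin (m G) → Fin (n G)
  src e = proj₁ (ends G e)
  tgt e = proj₂ (ends G e)

  lab : EdgeSet G → Fin (n G) → Fin (n G)
  lab = labels (ends G)

  κ : EdgeSet G → ℕ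
  κ A = roots (lab A)

  Joined : EdgeSet G → Fin (m G) → Set
  Joined A e = lab A (src e) ≡ lab A (tgt e)

  Spans : EdgeSet G → EdgeSet G → Set
  Spans B A = ∀ e → A e ≡ true → Joined B e

  -- Universality places ρ x in the component of x without speaking of paths. All labellings of one
  -- edge set have equally many fixed points, so a convenient one may be counted in place of `lab`.
  record IsLabelling (A : EdgeSet G) (ρ : Fin (n G) → Fin (n G)) : Set where
    field
      respects  : Respects (ends G) A ρ
      universal : ∀ σ → Respects (ends G) A σ → ∀ x → σ (ρ x) ≡ σ x
  open IsLabelling

  lab-labelling : ∀ A → IsLabelling A (lab A)
  lab-labelling A .respects = labels-respects (ends G) A
  lab-labelling A .universal σ σ-resp x =
    sym (labels-least (ends G) A (λ y z → σ y ≡ σ z) refl sym trans σ-resp x)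

  lab-idem : ∀ A x → lab A (lab A x) ≡ lab A x
  lab-idem A = universal (lab-labelling A) (lab A) (respects (lab-labelling A))

  ⊆-spans : ∀ {A B} → (∀ e → A e ≡ true → B e ≡ true) → Spans B A
  ⊆-spans {A} {B} A⊆B e Ae = respects (lab-labelling B) e (A⊆B e Ae)

  joined-mono : ∀ {A B} → Spans B A → ∀ e → Joined A e → Joined B e
  joined-mono {A} {B} sp e je =
    trans (sym (universal (lab-labelling A) (lab B) sp (src e)))
      (trans (cong (lab B) je) (universal (lab-labelling A) (lab B) sp (tgt e)))

  -- A fixed point c of σ is sent to the root ρ c and is recovered from it, since σ (ρ c) = σ c = c.
  roots-anti : ∀ {A ρ σ} → IsLabelling A ρ → Respects (ends G) A σ → (∀ x → σ (σ x) ≡ σ x) →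
    roots σ ≤ roots ρ
  roots-anti {A} {ρ} {σ} ρ-lab σ-resp idem = count-inject ρ σ λ c σc →
    (subst (λ x → δ x (ρ c) ≡ true) (sym (universal ρ-lab ρ (respects ρ-lab) c)) (δ-refl (ρ c))) ,
    trans (universal ρ-lab σ σ-resp c) (δ-sound {i = σ c} {c} σc)

  κ-anti : ∀ {A B} → Spans B A → κ B ≤ κ A
  κ-anti {A} {B} sp = roots-anti (lab-labelling A) sp (lab-idem B)

  κ-cong : ∀ {A B} → (∀ e → A e ≡ B e) → κ A ≡ κ B
  κ-cong eq = ≤-antisym (κ-anti (⊆-spans (λ e Be → trans (eq e) Be)))
    (κ-anti (⊆-spans (λ e Ae → trans (sym (eq e)) Ae)))

  _⊕_ : EdgeSet G → Fin (m G) → EdgeSet G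
  _⊕_ = insert

  _∪_ _∩_ _∖_ : EdgeSet G → EdgeSet G → EdgeSet G
  (A ∪ B) i = A i ∨ B i
  (A ∩ B) i = A i ∧ B i
  (A ∖ B) i = A i ∧ not (B i)

  ∁ : EdgeSet G → EdgeSet G
  ∁ A i = not (A i)

  ∣_∣ : EdgeSet G → ℕ
  ∣ A ∣ = countFin A

  infixl 6 _∪_ _∖_ _⊕_
  infixl 7 _∩_

  ⊕-⊇ : ∀ A e i → A i ≡ true → (A ⊕ e) i ≡ true
  ⊕-⊇ A e i = ∨-introˡ

  ⊕-∋ : ∀ A e → (A ⊕ e) e ≡ true
  ⊕-∋ A e = ∨-introʳ {A e} (δ-refl e)

  ⊕-elim : ∀ A e i → (A ⊕ e) i ≡ true → A i ≡ true ⊎ i ≡ e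
  ⊕-elim A e i h with ∨-true {A i} h
  ... | inj₁ Ai = inj₁ Ai
  ... | inj₂ d  = inj₂ (δ-sound {i = i} {e} d)

  κ-insert-joined : ∀ A e → Joined A e → κ (A ⊕ e) ≡ κ A
  κ-insert-joined A e je = ≤-antisym (κ-anti (⊆-spans (⊕-⊇ A e))) (κ-anti sp)
    where
    sp : Spans A (A ⊕ e)
    sp i h with ⊕-elim A e i h
    ... | inj₁ Ai   = respects (lab-labelling A) i Ai
    ... | inj₂ refl = je

  merge-labelling : ∀ A e → IsLabelling (A ⊕ e) (merge (lab A) (src e) (tgt e))
  merge-labelling A e .respects i h with ⊕-elim A e i h
  ... | inj₂ refl = merge-ends (lab A) (src e) (tgt e)
  ... | inj₁ Ai rewrite respects (lab-labelling A) i Ai = refl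
  merge-labelling A e .universal σ σ-resp x with lab A x F.≟ lab A (src e)
  ... | no  _ = universal (lab-labelling A) σ (λ i Ai → σ-resp i (⊕-⊇ A e i Ai)) x
  ... | yes p = trans (u (tgt e)) (trans (sym (σ-resp e (⊕-∋ A e)))
                  (trans (sym (u (src e))) (trans (cong σ (sym p)) (u x))))
    where u = universal (lab-labelling A) σ (λ i Ai → σ-resp i (⊕-⊇ A e i Ai))

  -- The representatives chosen by `lab (A ⊕ e)` depend on the order of the edges, so the merged
  -- labelling μ is counted instead: among the roots of ρ exactly ρ u disappears.
  κ-insert-separate : ∀ A e → ¬ Joined A e → κ A ≡ suc (κ (A ⊕ e))
  κ-insert-separate A e ¬je = begin
    κ A ≡⟨ sum-cong pointwise ⟩
    sumFin (λ c → ⟦ δ (ρ u) c ⟧ + ⟦ δ (μ c) c ⟧) ≡⟨ sum-+ (λ c → ⟦ δ (ρ u) c ⟧) _ ⟩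
    sumFin (λ c → ⟦ δ (ρ u) c ⟧) + roots μ ≡⟨ cong (_+ roots μ) (sum-δ (ρ u)) ⟩
    suc (roots μ) ≡⟨ cong suc (≤-antisym
      (roots-anti (lab-labelling (A ⊕ e)) (respects μ-lab) (universal μ-lab μ (respects μ-lab)))
      (roots-anti μ-lab (respects (lab-labelling (A ⊕ e))) (lab-idem (A ⊕ e)))) ⟩
    suc (κ (A ⊕ e)) ∎
    where
    open ≡-Reasoning
    ρ = lab A
    u = src e
    v = tgt e
    μ = merge ρ u v
    μ-lab = merge-labelling A e
    pointwise : ∀ c → ⟦ δ (ρ c) c ⟧ ≡ ⟦ δ (ρ u) c ⟧ + ⟦ δ (μ c) c ⟧
    pointwise c with ρ c F.≟ ρ u
    ... | no ρc≢ρu = cong (_+ ⟦ δ (ρ c) c ⟧) (cong ⟦_⟧ (sym (δ-≢ {i = ρ u} {c} (λ p →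
            ρc≢ρu (trans (sym (cong ρ p)) (lab-idem A u))))))
    ... | yes p rewrite p = trans (sym (+-identityʳ _)) (cong (⟦ δ (ρ u) c ⟧ +_)
            (cong ⟦_⟧ (sym (δ-≢ {i = ρ v} {c} λ q → ¬je
              (trans (sym p) (trans (sym (cong ρ q)) (lab-idem A v)))))))

  joined? : ∀ A e → Dec (Joined A e)
  joined? A e = lab A (src e) F.≟ lab A (tgt e)

  κ-insert-≤ : ∀ A e → κ A ≤ suc (κ (A ⊕ e))
  κ-insert-≤ A e with joined? A e
  ... | yes je = m≤n⇒m≤1+n (≤-reflexive (sym (κ-insert-joined A e je)))
  ... | no ¬je = ≤-reflexive (κ-insert-separate A e ¬je)

  -- An edge joined in A is also joined in B, so an insertion that merges components of B merges
  -- components of A as well. This is submodularity of the rank n - κ for a single edge.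
  κ-insert-supermodular : ∀ {A B} e → Spans B A → κ B + κ (A ⊕ e) ≤ κ A + κ (B ⊕ e)
  κ-insert-supermodular {A} {B} e sp with joined? B e
  ... | yes je rewrite κ-insert-joined B e je | +-comm (κ A) (κ B) =
        +-monoʳ-≤ (κ B) (κ-anti (⊆-spans (⊕-⊇ A e)))
  ... | no ¬je rewrite κ-insert-separate A e (λ je → ¬je (joined-mono sp e je))
                     | κ-insert-separate B e ¬je = ≤-reflexive (cong suc (+-comm _ (κ (A ⊕ e))))

  ∪-⊕ : ∀ A X e i → (A ∪ (X ⊕ e)) i ≡ ((A ∪ X) ⊕ e) i
  ∪-⊕ A X e i = sym (∨-assoc (A i) (X i) (δ i e))

  κ-supermodular : ∀ {A B} X → Spans B A → κ B + κ (A ∪ X) ≤ κ A + κ (B ∪ X)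
  κ-supermodular {A} {B} X sp = BoolFun-induction
    (λ X → κ B + κ (A ∪ X) ≤ κ A + κ (B ∪ X))
    (λ eq → subst₂ (λ a b → κ B + a ≤ κ A + b)
      (κ-cong (λ i → cong (A i ∨_) (eq i))) (κ-cong (λ i → cong (B i ∨_) (eq i))))
    (≤-reflexive (trans (cong (κ B +_) (κ-cong (λ i → ∨-identityʳ (A i))))
      (trans (+-comm (κ B) (κ A)) (cong (κ A +_) (sym (κ-cong (λ i → ∨-identityʳ (B i))))))))
    (λ X e _ ih → subst₂ (λ a b → κ B + a ≤ κ A + b)
      (sym (κ-cong (∪-⊕ A X e))) (sym (κ-cong (∪-⊕ B X e)))
      (chain (κ B) _ _ _ _ _ ih (κ-insert-supermodular e (spans-∪ X))))
    X
    where
    spans-∪ : ∀ X → Spans (B ∪ X) (A ∪ X)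
    spans-∪ X e h with ∨-true {A e} h
    ... | inj₁ Ae = joined-mono (⊆-spans {B} {B ∪ X} (λ i → ∨-introˡ)) e (sp e Ae)
    ... | inj₂ Xe = respects (lab-labelling (B ∪ X)) e (∨-introʳ {B e} Xe)
    chain : ∀ b ax a bx axe bxe → b + ax ≤ a + bx → bx + axe ≤ ax + bxe → b + axe ≤ a + bxe
    chain b ax a bx axe bxe p q = +-cancelʳ-≤ (ax + bx) _ _
      (subst₂ _≤_ (e₁ b ax bx axe) (e₂ a bx ax bxe) (+-mono-≤ p q))
      where
      e₁ : ∀ b ax bx axe → b + ax + (bx + axe) ≡ b + axe + (ax + bx)
      e₁ = solve-∀
      e₂ : ∀ a bx ax bxe → a + bx + (ax + bxe) ≡ a + bxe + (ax + bx)
      e₂ = solve-∀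

  κ-∅ : κ (λ _ → false) ≡ n G
  κ-∅ = trans (sum-cong (λ c → cong ⟦_⟧ (trans
    (cong (λ x → δ x c) (universal (lab-labelling _) (λ x → x) (λ e ()) c)) (δ-refl c)))) (sum-1 (n G))

-- Spanning trees and minimum spanning trees

module SpanningTrees (G : Multigraph) where
  open Components G

  weight-insert : ∀ w (X : EdgeSet G) e → X e ≡ false → weight G w (X ⊕ e) ≡ w e + weight G w X
  weight-insert w X e Xe = trans (sum-cong pointwise)
    (trans (sum-+ (λ i → if δ e i then w i else 0) (λ i → if X i then w i else 0))
      (cong (_+ weight G w X) (sum-pick w e)))
    where
    pointwise : ∀ i → (if X i ∨ δ i e then w i else 0) ≡
      (if δ e i then w i else 0) + (if X i then w i else 0)
    pointwise i with i F.≟ e | e F.≟ i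
    ... | yes refl | yes _ rewrite Xe = sym (+-identityʳ (w i))
    ... | yes refl | no n = ⊥-elim (n refl)
    ... | no n | yes refl = ⊥-elim (n refl)
    ... | no _ | no _ rewrite ∨-identityʳ (X i) = refl

  count-insert : ∀ (X : EdgeSet G) e → X e ≡ false → ∣ X ⊕ e ∣ ≡ suc ∣ X ∣
  count-insert = weight-insert (λ _ → 1)

  κ-∪-≤ : ∀ A X → κ A ≤ κ (A ∪ X) + ∣ X ∣
  κ-∪-≤ A = BoolFun-induction (λ X → κ A ≤ κ (A ∪ X) + ∣ X ∣)
    (λ eq → subst₂ (λ a b → κ A ≤ a + b) (κ-cong (λ i → cong (A i ∨_) (eq i))) (count-cong eq))
    (≤-trans (≤-reflexive (sym (κ-cong (λ i → ∨-identityʳ (A i))))) (m≤m+n _ _))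
    (λ X e Xe ih → ≤-trans ih (subst₂ (λ a b → κ (A ∪ X) + ∣ X ∣ ≤ a + b)
      (sym (κ-cong (∪-⊕ A X e))) (sym (count-insert X e Xe))
      (≤-trans (+-monoˡ-≤ ∣ X ∣ (κ-insert-≤ (A ∪ X) e)) (≤-reflexive (sym (+-suc _ ∣ X ∣))))))

  κ-connected : ∀ A z → (∀ x → lab A x ≡ z) → κ A ≡ 1
  κ-connected A z const =
    trans (sum-cong (λ c → cong (λ x → ⟦ δ x c ⟧) (const c))) (sum-δ z)

  κ-positive : ∀ A → Fin (n G) → 1 ≤ κ A
  κ-positive A v = count-≥1 {p = λ c → δ (lab A c) c} (lab A v)
    (subst (λ x → δ x (lab A v) ≡ true) (sym (lab-idem A v)) (δ-refl (lab A v)))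

  Reach-trans : ∀ {T u v x} → Reach G T u v → Reach G T v x → Reach G T u x
  Reach-trans here q = q
  Reach-trans (fwd i Ti eq p) q = fwd i Ti eq (Reach-trans p q)
  Reach-trans (bwd i Ti eq p) q = bwd i Ti eq (Reach-trans p q)

  Reach-sym : ∀ {T u v} → Reach G T u v → Reach G T v u
  Reach-sym here = here
  Reach-sym (fwd i Ti refl p) = Reach-trans (Reach-sym p) (bwd i Ti refl here)
  Reach-sym (bwd i Ti refl p) = Reach-trans (Reach-sym p) (fwd i Ti refl here)

  Reach-lab : ∀ {T u v} → Reach G T u v → lab T u ≡ lab T v
  Reach-lab here = refl
  Reach-lab {T} (fwd i Ti refl p) = trans (labels-respects (ends G) T i Ti) (Reach-lab p)
  Reach-lab {T} (bwd i Ti refl p) = trans (sym (labels-respects (ends G) T i Ti)) (Reach-lab p)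

  lab-Reach : ∀ {T} u v → lab T u ≡ lab T v → Reach G T u v
  lab-Reach {T} u v eq =
    Reach-trans (to-root u) (subst (λ x → Reach G T x v) (sym eq) (Reach-sym (to-root v)))
    where
    to-root : ∀ x → Reach G T x (lab T x)
    to-root = labels-least (ends G) T (Reach G T) here Reach-sym Reach-trans
      (λ e Te → fwd e Te refl here)

  module Tree {T : EdgeSet G} (tree : IsSpanningTree G T) where

    vertex : Fin (n G)
    vertex = subst Fin (proj₁ tree) F.zero

    κ-tree : κ T ≡ 1
    κ-tree = κ-connected T (lab T vertex) (λ x → Reach-lab (proj₂ tree x vertex))

    -- One edge removes at most one component. The n - 1 edges of a tree lead from n components to
    -- one, so none of them is wasted, whichever subset is inserted before the rest.
    κ-subset : ∀ X → (∀ e → X e ≡ true → T e ≡ true) → κ X + ∣ X ∣ ≡ n G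
    κ-subset X X⊆T = ≤-antisym upper lower
      where
      open ≤-Reasoning
      X∪ : ∀ e → (X ∪ (T ∖ X)) e ≡ T e
      X∪ e with X e in eq
      ... | true  = sym (X⊆T e eq)
      ... | false with T e
      ...   | true  = refl
      ...   | false = refl
      T∩X : ∀ e → X e ≡ (T ∩ X) e
      T∩X e with X e in eq
      ... | true rewrite X⊆T e eq = refl
      ... | false with T e
      ...   | true  = refl
      ...   | false = refl
      upper : κ X + ∣ X ∣ ≤ n G
      upper = begin
        κ X + ∣ X ∣ ≤⟨ +-monoˡ-≤ ∣ X ∣ (κ-∪-≤ X (T ∖ X)) ⟩
        κ (X ∪ (T ∖ X)) + ∣ T ∖ X ∣ + ∣ X ∣
          ≡⟨ cong₂ (λ a b → a + ∣ T ∖ X ∣ + b) (trans (κ-cong X∪) κ-tree) (count-cong T∩X) ⟩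
        suc (∣ T ∖ X ∣ + ∣ T ∩ X ∣) ≡⟨ cong suc (+-comm ∣ T ∖ X ∣ _) ⟩
        suc (∣ T ∩ X ∣ + ∣ T ∖ X ∣) ≡⟨ cong suc (sym (count-split T X)) ⟩
        suc ∣ T ∣ ≡⟨ proj₁ tree ⟩
        n G ∎
      lower : n G ≤ κ X + ∣ X ∣
      lower = ≤-trans (≤-reflexive (sym κ-∅)) (κ-∪-≤ (λ _ → false) X)

  module MinTree {w : Fin (m G) → ℕ} {T : EdgeSet G} (mst : IsMinSpanningTree G w T) where
    open Tree (proj₁ mst) public

    below : ℕ → EdgeSet G
    below s e = w e <ᵇ s

    -- Otherwise replacing f by e in T would give a spanning tree that is lighter by w f - w e.
    exchange : ∀ {e f} → T e ≡ false → T f ≡ true → w e < w f →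
      ¬ Joined ((T ∖ (λ i → δ i f)) ⊕ e) f
    exchange {e} {f} Te Tf we<wf joined = <⇒≱ we<wf (+-cancelʳ-≤ (weight G w T₀) _ _ (begin
      w f + weight G w T₀ ≡⟨ sym w-T ⟩
      weight G w T ≤⟨ proj₂ mst T′ T′-tree ⟩
      weight G w T′ ≡⟨ weight-insert w T₀ e T₀e ⟩
      w e + weight G w T₀ ∎))
      where
      open ≤-Reasoning
      T₀ = T ∖ (λ i → δ i f)
      T′ = T₀ ⊕ e
      T₀e : T₀ e ≡ false
      T₀e rewrite Te = refl
      T₀f : T₀ f ≡ false
      T₀f rewrite δ-refl f | Tf = refl
      T≗ : ∀ i → T i ≡ (T₀ ⊕ f) i
      T≗ i with i F.≟ f
      ... | yes refl rewrite Tf = refl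
      ... | no _ with T i
      ...   | true = refl
      ...   | false = refl
      w-T : weight G w T ≡ w f + weight G w T₀
      w-T = trans (sum-cong (λ i → cong (λ b → if b then w i else 0) (T≗ i))) (weight-insert w T₀ f T₀f)
      spans : Spans T′ T
      spans i Ti with ⊕-elim T₀ f i (trans (sym (T≗ i)) Ti)
      ... | inj₁ T₀i  = labels-respects (ends G) T′ i (∨-introˡ T₀i)
      ... | inj₂ refl = joined
      T′-tree : IsSpanningTree G T′
      T′-tree = trans (cong suc (trans (count-insert T₀ e T₀e)
          (trans (sym (count-insert T₀ f T₀f)) (sym (count-cong T≗))))) (proj₁ (proj₁ mst)) ,
        (λ u v → lab-Reach u v (connect u v))
        where
        connect : ∀ u v → lab T′ u ≡ lab T′ v
        connect u v = trans (sym (universal (lab-labelling T) (lab T′) spans u))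
          (trans (cong (lab T′) (Reach-lab (proj₂ (proj₁ mst) u v)))
            (universal (lab-labelling T) (lab T′) spans v))
          where open IsLabelling

    -- The property behind Kruskal's algorithm. If a light edge e were not joined by the light part
    -- of T, then by `exchange` every heavy edge of T would still merge components after that part
    -- and e have been inserted, so there would be one independent edge more than the n - 1 of a
    -- tree.
    below-spans : ∀ s → Spans (T ∩ below s) (below s)
    below-spans s e we with joined? (T ∩ below s) e
    ... | yes je = je
    ... | no ¬je = ⊥-elim (<⇒≱ too-many (≤-trans (+-mono-≤ (κ-positive _ vertex) (≤-refl {∣ T ∖ L ∣}))
            (independent (T ∖ L) (λ i h → h))))
      where
      L = below s
      Z = (T ∩ L) ⊕ e
      Te : T e ≡ false
      Te with T e in eq
      ... | false = refl
      ... | true  = ⊥-elim (¬je (labels-respects (ends G) (T ∩ L) e (∧-intro eq we)))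
      independent : ∀ Y → (∀ i → Y i ≡ true → (T ∖ L) i ≡ true) → κ (Z ∪ Y) + ∣ Y ∣ ≤ κ Z
      independent = BoolFun-induction
        (λ Y → (∀ i → Y i ≡ true → (T ∖ L) i ≡ true) → κ (Z ∪ Y) + ∣ Y ∣ ≤ κ Z)
        (λ eq ih Y⊆ → subst₂ (λ a b → a + b ≤ κ Z)
          (κ-cong (λ i → cong (Z i ∨_) (eq i))) (count-cong eq)
          (ih (λ i Xi → Y⊆ i (trans (sym (eq i)) Xi))))
        (λ _ → ≤-reflexive (trans (cong₂ _+_ (κ-cong (λ i → ∨-identityʳ (Z i))) (sum-0 (m G)))
          (+-identityʳ (κ Z))))
        step
        where
        step : ∀ Y f → Y f ≡ false →
          ((∀ i → Y i ≡ true → (T ∖ L) i ≡ true) → κ (Z ∪ Y) + ∣ Y ∣ ≤ κ Z) →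
          (∀ i → (Y ⊕ f) i ≡ true → (T ∖ L) i ≡ true) → κ (Z ∪ (Y ⊕ f)) + ∣ Y ⊕ f ∣ ≤ κ Z
        step Y f Yf ih Y⊆ = ≤-trans (≤-reflexive (begin
            κ (Z ∪ (Y ⊕ f)) + ∣ Y ⊕ f ∣ ≡⟨ cong₂ _+_ (κ-cong (∪-⊕ Z Y f)) (count-insert Y f Yf) ⟩
            κ ((Z ∪ Y) ⊕ f) + suc ∣ Y ∣ ≡⟨ +-suc _ ∣ Y ∣ ⟩
            suc (κ ((Z ∪ Y) ⊕ f)) + ∣ Y ∣ ≡⟨ cong (_+ ∣ Y ∣) (sym (κ-insert-separate (Z ∪ Y) f ¬jf)) ⟩
            κ (Z ∪ Y) + ∣ Y ∣ ∎)) (ih (λ i Yi → Y⊆ i (⊕-⊇ Y f i Yi)))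
          where
          open ≡-Reasoning
          f∈ = ∧-true {T f} (Y⊆ f (⊕-∋ Y f))
          T₀ = T ∖ (λ i → δ i f)
          ⊆T₀ : ∀ i → (Z ∪ Y) i ≡ true → (T₀ ⊕ e) i ≡ true
          ⊆T₀ i h with ∨-true {Z i} h
          ⊆T₀ i h | inj₂ Yi = ∨-introˡ (∧-intro (proj₁ (∧-true {T i} (Y⊆ i (⊕-⊇ Y f i Yi))))
            (cong not (δ-≢ {i = i} {f} λ { refl → true≢false Yi Yf })))
          ⊆T₀ i h | inj₁ Zi with ⊕-elim (T ∩ L) e i Zi
          ... | inj₂ refl = ⊕-∋ T₀ e
          ... | inj₁ TL = ∨-introˡ (∧-intro (proj₁ (∧-true {T i} TL))
            (cong not (δ-≢ {i = i} {f} λ { refl →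
              true≢false (proj₂ (∧-true {T i} TL)) (not-true (proj₂ f∈)) })))
          ¬jf : ¬ Joined (Z ∪ Y) f
          ¬jf jf = exchange Te (proj₁ f∈)
            (≤-trans (<ᵇ-true {b = s} we) (<ᵇ-false {b = s} (not-true (proj₂ f∈))))
            (joined-mono (⊆-spans ⊆T₀) f jf)
      too-many : κ Z < suc ∣ T ∖ L ∣
      too-many = s≤s (+-cancelʳ-≤ (suc ∣ T ∩ L ∣) _ _ (≤-reflexive (begin
        κ Z + suc ∣ T ∩ L ∣ ≡⟨ +-suc (κ Z) _ ⟩
        suc (κ Z) + ∣ T ∩ L ∣ ≡⟨ cong (_+ ∣ T ∩ L ∣) (sym (κ-insert-separate (T ∩ L) e ¬je)) ⟩
        κ (T ∩ L) + ∣ T ∩ L ∣ ≡⟨ κ-subset (T ∩ L) (λ i h → proj₁ (∧-true h)) ⟩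
        n G ≡⟨ sym (proj₁ (proj₁ mst)) ⟩
        suc ∣ T ∣ ≡⟨ cong suc (count-split T L) ⟩
        suc (∣ T ∩ L ∣ + ∣ T ∖ L ∣) ≡⟨ +-comm (suc ∣ T ∩ L ∣) _ ⟩
        ∣ T ∖ L ∣ + suc ∣ T ∩ L ∣ ∎)))
        where open ≡-Reasoning

    κ-below : ∀ s → κ (T ∩ below s) ≡ κ (below s)
    κ-below s = ≤-antisym (κ-anti (below-spans s)) (κ-anti (⊆-spans (λ e h → proj₂ (∧-true {T e} h))))

    count-below : ∀ s → κ (below s) + ∣ T ∩ below s ∣ ≡ n G
    count-below s = trans (cong (_+ ∣ T ∩ below s ∣) (sym (κ-below s)))
      (κ-subset (T ∩ below s) (λ e h → proj₁ (∧-true h)))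

    -- Submodularity of the rank transfers the count from the whole graph to A.
    count-inside-above : ∀ A s → ∣ (A ∩ T) ∖ below s ∣ + κ A ≤ κ (A ∩ below s)
    count-inside-above A s = begin
      ∣ X ∣ + κ A ≤⟨ +-monoʳ-≤ ∣ X ∣ (κ-anti (⊆-spans X∪⊆A)) ⟩
      ∣ X ∣ + κ (A ∩ L ∪ X) ≤⟨ +-cancelˡ-≤ (κ (L ∪ X)) _ _ rearranged ⟩
      κ (A ∩ L) ∎
      where
      open ≤-Reasoning
      L = below s
      X = (A ∩ T) ∖ L
      Y = T ∩ L
      X∪⊆A : ∀ i → (A ∩ L ∪ X) i ≡ true → A i ≡ true
      X∪⊆A i h with A i
      ... | true  = refl
      ... | false = h
      T⊇ : ∀ i → (X ∪ Y) i ≡ true → T i ≡ true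
      T⊇ i h with T i
      ... | true = refl
      ... | false with A i
      ...   | true  = h
      ...   | false = h
      disjoint : ∣ X ∪ Y ∣ ≡ ∣ X ∣ + ∣ Y ∣
      disjoint = trans (sum-cong pointwise) (sum-+ (λ i → ⟦ X i ⟧) (λ i → ⟦ Y i ⟧))
        where
        pointwise : ∀ i → ⟦ (X ∪ Y) i ⟧ ≡ ⟦ X i ⟧ + ⟦ Y i ⟧
        pointwise i with A i | T i | L i
        ... | true  | true  | true  = refl
        ... | true  | true  | false = refl
        ... | true  | false | _     = refl
        ... | false | true  | true  = refl
        ... | false | true  | false = refl
        ... | false | false | _     = refl
      -- X and Y are disjoint parts of T and Y spans L, so inserting X lowers the number of
      -- components of L by the full ∣ X ∣.
      κ-X∪Y : κ (X ∪ Y) + ∣ X ∣ ≡ κ L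
      κ-X∪Y = +-cancelʳ-≡ ∣ Y ∣ _ _ (trans (+-assoc (κ (X ∪ Y)) ∣ X ∣ ∣ Y ∣)
        (trans (cong (κ (X ∪ Y) +_) (sym disjoint))
        (trans (κ-subset (X ∪ Y) T⊇) (sym (count-below s)))))
      X∪Y⊆ : ∀ i → (X ∪ Y) i ≡ true → (L ∪ X) i ≡ true
      X∪Y⊆ i h with ∨-true {X i} h
      ... | inj₁ Xi = ∨-introʳ {L i} Xi
      ... | inj₂ Yi = ∨-introˡ (proj₂ (∧-true {T i} Yi))
      rearranged : κ (L ∪ X) + (∣ X ∣ + κ (A ∩ L ∪ X)) ≤ κ (L ∪ X) + κ (A ∩ L)
      rearranged = begin
        κ (L ∪ X) + (∣ X ∣ + κ (A ∩ L ∪ X)) ≤⟨ +-monoˡ-≤ _ (κ-anti (⊆-spans X∪Y⊆)) ⟩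
        κ (X ∪ Y) + (∣ X ∣ + κ (A ∩ L ∪ X)) ≡⟨ sym (+-assoc (κ (X ∪ Y)) ∣ X ∣ _) ⟩
        κ (X ∪ Y) + ∣ X ∣ + κ (A ∩ L ∪ X) ≡⟨ cong (_+ κ (A ∩ L ∪ X)) κ-X∪Y ⟩
        κ L + κ (A ∩ L ∪ X)
          ≤⟨ κ-supermodular X (⊆-spans (λ i h → proj₂ (∧-true {A i} h))) ⟩
        κ (A ∩ L) + κ (L ∪ X) ≡⟨ +-comm (κ (A ∩ L)) _ ⟩
        κ (L ∪ X) + κ (A ∩ L) ∎

    -- After contraction of A the light tree edges still span all light edges. Those outside A
    -- therefore account for every component that A loses when `below s` is added.
    count-outside-below : ∀ A s → κ A ≤ κ (A ∪ below s) + ∣ (T ∩ below s) ∖ A ∣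
    count-outside-below A s = ≤-trans (κ-∪-≤ A X) (+-monoˡ-≤ ∣ X ∣ (κ-anti sp))
      where
      X = (T ∩ below s) ∖ A
      TL⊆ : ∀ i → (T ∩ below s) i ≡ true → (A ∪ X) i ≡ true
      TL⊆ i h with A i
      ... | true  = refl
      ... | false = ∧-intro h refl
      sp : Spans (A ∪ X) (A ∪ below s)
      sp i h with ∨-true {A i} h
      ... | inj₁ Ai = labels-respects (ends G) (A ∪ X) i (∨-introˡ Ai)
      ... | inj₂ wi = joined-mono (⊆-spans TL⊆) i (below-spans s i wi)

-- Powers and logarithms

m≤2^⌈log₂m⌉ : ∀ m → m ≤ 2 ^ ⌈log₂ m ⌉
m≤2^⌈log₂m⌉ = <-rec _ step
  where
  step : ∀ m → (∀ {h} → h < m → h ≤ 2 ^ ⌈log₂ h ⌉) → m ≤ 2 ^ ⌈log₂ m ⌉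
  step zero rec = z≤n
  step (suc zero) rec = ≤-refl
  step (suc (suc n)) rec = begin
    2 + n ≡⟨ sym (⌊n/2⌋+⌈n/2⌉≡n (2 + n)) ⟩
    ⌊ 2 + n /2⌋ + h ≤⟨ +-monoˡ-≤ h (⌊n/2⌋≤⌈n/2⌉ (2 + n)) ⟩
    h + h ≡⟨ cong (h +_) (sym (+-identityʳ h)) ⟩
    2 * h ≤⟨ *-monoʳ-≤ 2 (rec (⌈n/2⌉<n n)) ⟩
    2 * 2 ^ ⌈log₂ h ⌉ ≡⟨ cong (λ x → 2 * 2 ^ x) (⌈log₂⌈n/2⌉⌉≡⌈log₂n⌉∸1 (2 + n)) ⟩
    2 ^ suc (⌈log₂ 2 + n ⌉ ∸ 1) ≡⟨ cong (2 ^_) (m+[n∸m]≡n (⌈log₂⌉-mono-≤ (s≤s (s≤s (z≤n {n}))))) ⟩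
    2 ^ ⌈log₂ 2 + n ⌉ ∎
    where
    open ≤-Reasoning
    h = ⌈ 2 + n /2⌉

^-distribʳ-* : ∀ n x y → (x * y) ^ n ≡ x ^ n * y ^ n
^-distribʳ-* zero    x y = refl
^-distribʳ-* (suc n) x y = trans (cong (x * y *_) (^-distribʳ-* n x y)) (e x y (x ^ n) (y ^ n))
  where
  e : ∀ x y p r → x * y * (p * r) ≡ x * p * (y * r)
  e = solve-∀

0<^ : ∀ {x} n → 0 < x → 0 < x ^ n
0<^ {x} n 0<x = >-nonZero⁻¹ (x ^ n) {{m^n≢0 x n {{>-nonZero 0<x}}}}

*-cancel : ∀ {x y} z → 0 < z → x * z ≤ y * z → x ≤ y
*-cancel {x} {y} z 0<z = *-cancelʳ-≤ x y z {{>-nonZero 0<z}}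

fraction-trans : ∀ {x y u v t z} → 0 < v → x * v ≤ u * y → u * z ≤ t * v → x * z ≤ t * y
fraction-trans {x} {y} {u} {v} {t} {z} 0<v p q = *-cancel v 0<v (begin
  x * z * v ≡⟨ e₁ x z v ⟩
  x * v * z ≤⟨ *-monoˡ-≤ z p ⟩
  u * y * z ≡⟨ e₁ u y z ⟩
  u * z * y ≤⟨ *-monoˡ-≤ y q ⟩
  t * v * y ≡⟨ e₁ t v y ⟩
  t * y * v ∎)
  where
  open ≤-Reasoning
  e₁ : ∀ a b c → a * b * c ≡ a * c * b
  e₁ = solve-∀

bernoulli : ∀ d n → d ^ n * (d + n) ≤ (1 + d) ^ n * d
bernoulli d zero    = ≤-reflexive (e d)
  where
  e : ∀ d → 1 * (d + 0) ≡ 1 * d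
  e = solve-∀
bernoulli d (suc n) = begin
  d * d ^ n * (d + suc n) ≡⟨ e₁ d (d ^ n) n ⟩
  d * (d ^ n * (d + n)) + d ^ n * d ≤⟨ +-monoʳ-≤ _ (*-monoʳ-≤ (d ^ n) (m≤m+n d n)) ⟩
  d * (d ^ n * (d + n)) + d ^ n * (d + n) ≡⟨ e₂ d (d ^ n * (d + n)) ⟩
  (1 + d) * (d ^ n * (d + n)) ≤⟨ *-monoʳ-≤ (1 + d) (bernoulli d n) ⟩
  (1 + d) * ((1 + d) ^ n * d) ≡⟨ sym (*-assoc (1 + d) ((1 + d) ^ n) d) ⟩
  (1 + d) ^ suc n * d ∎
  where
  open ≤-Reasoning
  e₁ : ∀ d p n → d * p * (d + (1 + n)) ≡ d * (p * (d + n)) + p * d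
  e₁ = solve-∀
  e₂ : ∀ d x → d * x + x ≡ (1 + d) * x
  e₂ = solve-∀

-- (1 − 1/(1+d))ⁿ ≥ 1 − n/(1+d), cleared of subtraction
bernoulli⁻ : ∀ d n → (1 + d) ^ n * (1 + d) ≤ d ^ n * (1 + d) + n * (1 + d) ^ n
bernoulli⁻ d zero    = m≤m+n _ _
bernoulli⁻ d (suc n) = begin
  (1 + d) * p * (1 + d) ≡⟨ *-assoc (1 + d) p (1 + d) ⟩
  (1 + d) * (p * (1 + d)) ≤⟨ *-monoʳ-≤ (1 + d) (bernoulli⁻ d n) ⟩
  (1 + d) * (r * (1 + d) + n * p) ≡⟨ e₁ d p r n ⟩
  d * r * (1 + d) + n * ((1 + d) * p) + (1 + d) * r ≤⟨ +-monoʳ-≤ (d * r * (1 + d) + n * ((1 + d) * p)) (*-monoʳ-≤ (1 + d) (^-monoˡ-≤ n (n≤1+n d))) ⟩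
  d * r * (1 + d) + n * ((1 + d) * p) + (1 + d) * p ≡⟨ e₂ (d * r * (1 + d)) ((1 + d) * p) n ⟩
  d * r * (1 + d) + (1 + n) * ((1 + d) * p) ∎
  where
  open ≤-Reasoning
  p = (1 + d) ^ n
  r = d ^ n
  e₁ : ∀ d p r n → (1 + d) * (r * (1 + d) + n * p) ≡ d * r * (1 + d) + n * ((1 + d) * p) + (1 + d) * r
  e₁ = solve-∀
  e₂ : ∀ x y n → x + n * y + y ≡ x + (1 + n) * y
  e₂ = solve-∀

-- (1 + 1/n)ⁿ⁺¹ decreases
e-upper-step : ∀ n → 1 ≤ n →
  (2 + n) ^ (2 + n) * n ^ (1 + n) ≤ (1 + n) ^ (1 + n) * (1 + n) ^ (2 + n)
e-upper-step n 1≤n = *-cancel (d * k) (*-mono-≤ d-pos (s≤s (z≤n {n}))) (begin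
  (2 + n) ^ (2 + n) * n ^ k * (d * k) ≡⟨ e₁ (2 + n) ((2 + n) ^ k) (n ^ k) d k ⟩
  ((2 + n) ^ k * n ^ k) * ((2 + n) * k * d) ≡⟨ cong (_* ((2 + n) * k * d)) (sym (^-distribʳ-* k (2 + n) n)) ⟩
  d ^ k * ((2 + n) * k * d) ≤⟨ *-monoʳ-≤ (d ^ k) (≤-trans (m≤m+n _ k) (≤-reflexive (e₂ n))) ⟩
  d ^ k * ((d + k) * (k * k)) ≡⟨ sym (*-assoc (d ^ k) (d + k) _) ⟩
  d ^ k * (d + k) * (k * k) ≤⟨ *-monoˡ-≤ (k * k) (bernoulli d k) ⟩
  (1 + d) ^ k * d * (k * k) ≡⟨ cong (λ x → x ^ k * d * (k * k)) (e₃ n) ⟩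
  (k * k) ^ k * d * (k * k) ≡⟨ cong (λ x → x * d * (k * k)) (^-distribʳ-* k k k) ⟩
  k ^ k * k ^ k * d * (k * k) ≡⟨ e₄ (k ^ k) k d ⟩
  k ^ k * k ^ (1 + k) * (d * k) ∎)
  where
  open ≤-Reasoning
  k = 1 + n
  -- Here 1 + d = (1 + n)², so up to one factor the quotient of consecutive terms is a power of 1 +
  -- 1/d, to which Bernoulli's inequality applies.
  d = (2 + n) * n
  d-pos : 1 ≤ d
  d-pos = *-mono-≤ (s≤s (z≤n {1 + n})) 1≤n
  e₁ : ∀ a p r d k → a * p * r * (d * k) ≡ p * r * (a * k * d)
  e₁ = solve-∀
  e₂ : ∀ n → (2 + n) * (1 + n) * ((2 + n) * n) + (1 + n) ≡ ((2 + n) * n + (1 + n)) * ((1 + n) * (1 + n))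
  e₂ = solve-∀
  e₃ : ∀ n → 1 + (2 + n) * n ≡ (1 + n) * (1 + n)
  e₃ = solve-∀
  e₄ : ∀ p k d → p * p * d * (k * k) ≡ p * (k * p) * (d * k)
  e₄ = solve-∀

-- (1 + 1/n)ⁿ increases
e-lower-step : ∀ n → 1 ≤ n → (1 + n) ^ n * (1 + n) ^ (1 + n) ≤ (2 + n) ^ (1 + n) * n ^ n
e-lower-step n 1≤n = *-cancel (n * k * k) (*-mono-≤ (*-mono-≤ 1≤n (s≤s (z≤n {n}))) (s≤s (z≤n {n})))
  (+-cancelʳ-≤ (k * (k ^ k * k ^ k)) _ _ (begin
    k ^ n * k ^ k * (n * k * k) + k * (k ^ k * k ^ k) ≡⟨ e₁ n (k ^ n) ⟩
    k ^ k * k ^ k * (1 + d) ≡⟨ cong (_* (1 + d)) (sym D^k) ⟩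
    (1 + d) ^ k * (1 + d) ≤⟨ bernoulli⁻ d k ⟩
    d ^ k * (1 + d) + k * (1 + d) ^ k ≡⟨ cong₂ (λ x y → x * (1 + d) + k * y) (^-distribʳ-* k (2 + n) n) D^k ⟩
    (2 + n) ^ k * n ^ k * (1 + d) + k * (k ^ k * k ^ k) ≡⟨ cong (_+ k * (k ^ k * k ^ k)) (e₂ n ((2 + n) ^ k) (n ^ n)) ⟩
    (2 + n) ^ k * n ^ n * (n * k * k) + k * (k ^ k * k ^ k) ∎))
  where
  open ≤-Reasoning
  k = 1 + n
  d = (2 + n) * n
  square : ∀ n → 1 + (2 + n) * n ≡ (1 + n) * (1 + n)
  square = solve-∀
  D^k : (1 + d) ^ k ≡ k ^ k * k ^ k
  D^k = trans (cong (_^ k) (square n)) (^-distribʳ-* k k k)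
  e₁ : ∀ n p → p * ((1 + n) * p) * (n * (1 + n) * (1 + n)) + (1 + n) * ((1 + n) * p * ((1 + n) * p)) ≡
    (1 + n) * p * ((1 + n) * p) * (1 + (2 + n) * n)
  e₁ = solve-∀
  e₂ : ∀ n A B → A * (n * B) * (1 + (2 + n) * n) ≡ A * B * (n * (1 + n) * (1 + n))
  e₂ = solve-∀

e-upper : ∀ q j → 1 ≤ q →
  (1 + (j + q)) ^ (1 + (j + q)) * q ^ (1 + q) ≤ (1 + q) ^ (1 + q) * (j + q) ^ (1 + (j + q))
e-upper q zero    1≤q = ≤-refl
e-upper q (suc j) 1≤q = fraction-trans
  {(2 + (j + q)) ^ (2 + (j + q))} {(1 + (j + q)) ^ (2 + (j + q))}
  {(1 + (j + q)) ^ (1 + (j + q))} {(j + q) ^ (1 + (j + q))}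
  {(1 + q) ^ (1 + q)} {q ^ (1 + q)}
  (0<^ (1 + (j + q)) (≤-trans 1≤q (m≤n+m q j)))
  (e-upper-step (j + q) (≤-trans 1≤q (m≤n+m q j))) (e-upper q j 1≤q)

e-lower : ∀ q j → 1 ≤ q → (1 + q) ^ q * (j + q) ^ (j + q) ≤ (1 + (j + q)) ^ (j + q) * q ^ q
e-lower q zero    1≤q = ≤-refl
e-lower q (suc j) 1≤q = fraction-trans
  {(1 + q) ^ q} {q ^ q} {(1 + (j + q)) ^ (j + q)} {(j + q) ^ (j + q)}
  {(2 + (j + q)) ^ (1 + (j + q))} {(1 + (j + q)) ^ (1 + (j + q))}
  (0<^ (j + q) (≤-trans 1≤q (m≤n+m q j)))
  (e-lower q j 1≤q) (e-lower-step (j + q) (≤-trans 1≤q (m≤n+m q j)))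

-- (1 + 1/N)ᴺ ≤ (1 + 1/q)^(q+1) for N ≥ q
e-upper-bound : ∀ q j → 1 ≤ q →
  (1 + (j + q)) ^ (j + q) * q ^ (1 + q) ≤ (j + q) ^ (j + q) * (1 + q) ^ (1 + q)
e-upper-bound q j 1≤q = *-cancel (1 + N) (s≤s z≤n) (begin
  (1 + N) ^ N * q ^ (1 + q) * (1 + N) ≡⟨ e₁ ((1 + N) ^ N) (q ^ (1 + q)) (1 + N) ⟩
  (1 + N) ^ (1 + N) * q ^ (1 + q) ≤⟨ e-upper q j 1≤q ⟩
  (1 + q) ^ (1 + q) * N ^ (1 + N) ≤⟨ *-monoʳ-≤ ((1 + q) ^ (1 + q)) (*-monoˡ-≤ (N ^ N) (n≤1+n N)) ⟩
  (1 + q) ^ (1 + q) * ((1 + N) * N ^ N) ≡⟨ e₂ ((1 + q) ^ (1 + q)) (1 + N) (N ^ N) ⟩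
  N ^ N * (1 + q) ^ (1 + q) * (1 + N) ∎)
  where
  open ≤-Reasoning
  N = j + q
  e₁ : ∀ a b c → a * b * c ≡ c * a * b
  e₁ = solve-∀
  e₂ : ∀ a b c → a * (b * c) ≡ c * a * b
  e₂ = solve-∀

-- (1 − 1/N)ᴺ ≤ (q/(q+1))^q for N = M + 1 > q
e-lower-bound : ∀ q j → 1 ≤ q →
  (j + q) ^ (1 + (j + q)) * (1 + q) ^ q ≤ (1 + (j + q)) ^ (1 + (j + q)) * q ^ q
e-lower-bound q j 1≤q = begin
  M * M ^ M * (1 + q) ^ q ≡⟨ e₁ M (M ^ M) ((1 + q) ^ q) ⟩
  M * ((1 + q) ^ q * M ^ M) ≤⟨ *-mono-≤ (n≤1+n M) (e-lower q j 1≤q) ⟩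
  (1 + M) * ((1 + M) ^ M * q ^ q) ≡⟨ sym (*-assoc (1 + M) ((1 + M) ^ M) (q ^ q)) ⟩
  (1 + M) * (1 + M) ^ M * q ^ q ∎
  where
  open ≤-Reasoning
  M = j + q
  e₁ : ∀ a b c → a * b * c ≡ a * (c * b)
  e₁ = solve-∀

^-swap : ∀ x m n → (x ^ m) ^ n ≡ (x ^ n) ^ m
^-swap x m n = trans (^-*-assoc x m n) (trans (cong (x ^_) (*-comm m n)) (sym (^-*-assoc x n m)))

-- In fractions the hypotheses are R/N ≤ (S/N)ᵃ and (S/N)ᴺ ≤ (x/y)ᵖ. With S = N ± 1 this measures
-- the growth factor R/N of one round in powers of x/y.
power-rate : ∀ {R S N x y p} a → 0 < N → R * N ^ a ≤ N * S ^ a → S ^ N * y ^ p ≤ N ^ N * x ^ p →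
  R ^ N * y ^ (p * a) ≤ N ^ N * x ^ (p * a)
power-rate {R} {S} {N} {x} {y} {p} a 0<N h₁ h₂ = *-cancel ((N ^ a) ^ N) (0<^ N (0<^ a 0<N)) (begin
  R ^ N * y ^ (p * a) * (N ^ a) ^ N ≡⟨ e₁ (R ^ N) (y ^ (p * a)) ((N ^ a) ^ N) ⟩
  R ^ N * (N ^ a) ^ N * y ^ (p * a) ≡⟨ cong (_* y ^ (p * a)) (sym (^-distribʳ-* N R (N ^ a))) ⟩
  (R * N ^ a) ^ N * y ^ (p * a) ≤⟨ *-monoˡ-≤ (y ^ (p * a)) (^-monoˡ-≤ N h₁) ⟩
  (N * S ^ a) ^ N * y ^ (p * a) ≡⟨ cong₂ _*_ (^-distribʳ-* N N (S ^ a)) (sym (^-*-assoc y p a)) ⟩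
  N ^ N * (S ^ a) ^ N * (y ^ p) ^ a ≡⟨ cong (λ z → N ^ N * z * (y ^ p) ^ a) (^-swap S a N) ⟩
  N ^ N * (S ^ N) ^ a * (y ^ p) ^ a ≡⟨ *-assoc (N ^ N) _ _ ⟩
  N ^ N * ((S ^ N) ^ a * (y ^ p) ^ a) ≡⟨ cong (N ^ N *_) (sym (^-distribʳ-* a (S ^ N) (y ^ p))) ⟩
  N ^ N * (S ^ N * y ^ p) ^ a ≤⟨ *-monoʳ-≤ (N ^ N) (^-monoˡ-≤ a h₂) ⟩
  N ^ N * (N ^ N * x ^ p) ^ a ≡⟨ cong (N ^ N *_) (^-distribʳ-* a (N ^ N) (x ^ p)) ⟩
  N ^ N * ((N ^ N) ^ a * (x ^ p) ^ a) ≡⟨ cong₂ (λ u v → N ^ N * (u * v)) (^-swap N N a) (^-*-assoc x p a) ⟩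
  N ^ N * ((N ^ a) ^ N * x ^ (p * a)) ≡⟨ e₂ (N ^ N) ((N ^ a) ^ N) (x ^ (p * a)) ⟩
  N ^ N * x ^ (p * a) * (N ^ a) ^ N ∎)
  where
  open ≤-Reasoning
  e₁ : ∀ a b c → a * b * c ≡ a * c * b
  e₁ = solve-∀
  e₂ : ∀ a b c → a * (b * c) ≡ a * c * b
  e₂ = solve-∀

bernoulli-upper : ∀ N a → 0 < N → (N + a) * N ^ a ≤ N * (1 + N) ^ a
bernoulli-upper N a 0<N = begin
  (N + a) * N ^ a ≡⟨ *-comm (N + a) (N ^ a) ⟩
  N ^ a * (N + a) ≤⟨ bernoulli N a ⟩
  (1 + N) ^ a * N ≡⟨ *-comm ((1 + N) ^ a) N ⟩
  N * (1 + N) ^ a ∎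
  where open ≤-Reasoning

bernoulli-lower : ∀ M a c → c + a ≡ 1 + M → c * (1 + M) ^ a ≤ (1 + M) * M ^ a
bernoulli-lower M a c eq = +-cancelʳ-≤ (a * N ^ a) _ _ (begin
  c * N ^ a + a * N ^ a ≡⟨ sym (*-distribʳ-+ (N ^ a) c a) ⟩
  (c + a) * N ^ a ≡⟨ trans (cong (_* N ^ a) eq) (*-comm N (N ^ a)) ⟩
  N ^ a * N ≤⟨ bernoulli⁻ M a ⟩
  M ^ a * N + a * N ^ a ≡⟨ cong (_+ a * N ^ a) (*-comm (M ^ a) N) ⟩
  N * M ^ a + a * N ^ a ∎)
  where
  open ≤-Reasoning
  N = 1 + M

double-power : ∀ q → 1 ≤ q → 2 * q ^ q ≤ (1 + q) ^ q
double-power q 1≤q = *-cancel q 1≤q (≤-trans (≤-reflexive (e q (q ^ q))) (bernoulli q q))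
  where
  e : ∀ q p → 2 * p * q ≡ p * (q + q)
  e = solve-∀

-- Since (1 + 1/q)^q ≥ 2, a factor j, which is the number of edges in the application, costs only q
-- L in the exponent of 1 + 1/q.
log-power : ∀ q j L → 1 ≤ q → j ≤ 2 ^ L → j * q ^ (q * L) ≤ (1 + q) ^ (q * L)
log-power q j L 1≤q j≤ = begin
  j * q ^ (q * L) ≤⟨ *-monoˡ-≤ (q ^ (q * L)) j≤ ⟩
  2 ^ L * q ^ (q * L) ≡⟨ cong (2 ^ L *_) (sym (^-*-assoc q q L)) ⟩
  2 ^ L * (q ^ q) ^ L ≡⟨ sym (^-distribʳ-* L 2 (q ^ q)) ⟩
  (2 * q ^ q) ^ L ≤⟨ ^-monoˡ-≤ L (double-power q 1≤q) ⟩
  ((1 + q) ^ q) ^ L ≡⟨ ^-*-assoc (1 + q) q L ⟩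
  (1 + q) ^ (q * L) ∎
  where open ≤-Reasoning

-- A substitute for logarithms: in the N-th power of the potential bound (x/y)ʷ ≤ (R/N)ⁱ j, the
-- growth factor and j can both be replaced by powers with explicit exponents.
power-combine : ∀ {N R x y α β} i j w g d → 0 < N →
  x ^ w * N ^ i ≤ R ^ i * j * y ^ w → R ^ N * y ^ g ≤ N ^ N * x ^ g → j * β ^ d ≤ α ^ d →
  x ^ (w * N) * y ^ (g * i) * β ^ (d * N) ≤ y ^ (w * N) * x ^ (g * i) * α ^ (d * N)
power-combine {N} {R} {x} {y} {α} {β} i j w g d 0<N h₁ h₂ h₃ =
  *-cancel ((N ^ i) ^ N) (0<^ N (0<^ i 0<N)) (begin
  x ^ (w * N) * y ^ (g * i) * β ^ (d * N) * (N ^ i) ^ N ≡⟨ cong (λ z → z * y ^ (g * i) * β ^ (d * N) * (N ^ i) ^ N) (sym (^-*-assoc x w N)) ⟩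
  (x ^ w) ^ N * y ^ (g * i) * β ^ (d * N) * (N ^ i) ^ N ≡⟨ e₁ ((x ^ w) ^ N) _ _ ((N ^ i) ^ N) ⟩
  (x ^ w) ^ N * (N ^ i) ^ N * (y ^ (g * i) * β ^ (d * N)) ≡⟨ cong (_* (y ^ (g * i) * β ^ (d * N))) (sym (^-distribʳ-* N (x ^ w) (N ^ i))) ⟩
  (x ^ w * N ^ i) ^ N * (y ^ (g * i) * β ^ (d * N)) ≤⟨ *-monoˡ-≤ _ (^-monoˡ-≤ N h₁) ⟩
  (R ^ i * j * y ^ w) ^ N * (y ^ (g * i) * β ^ (d * N)) ≡⟨ cong₂ _*_
      (trans (^-distribʳ-* N (R ^ i * j) (y ^ w)) (cong (_* (y ^ w) ^ N) (^-distribʳ-* N (R ^ i) j)))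
      (cong₂ _*_ (sym (^-*-assoc y g i)) (sym (^-*-assoc β d N))) ⟩
  (R ^ i) ^ N * j ^ N * (y ^ w) ^ N * ((y ^ g) ^ i * (β ^ d) ^ N) ≡⟨ cong (λ z → z * j ^ N * (y ^ w) ^ N * ((y ^ g) ^ i * (β ^ d) ^ N)) (^-swap R i N) ⟩
  (R ^ N) ^ i * j ^ N * (y ^ w) ^ N * ((y ^ g) ^ i * (β ^ d) ^ N) ≡⟨ e₂ ((R ^ N) ^ i) (j ^ N) ((y ^ w) ^ N) ((y ^ g) ^ i) ((β ^ d) ^ N) ⟩
  (y ^ w) ^ N * ((R ^ N) ^ i * (y ^ g) ^ i) * (j ^ N * (β ^ d) ^ N) ≡⟨ cong₂ (λ u v → (y ^ w) ^ N * u * v)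
      (sym (^-distribʳ-* i (R ^ N) (y ^ g))) (sym (^-distribʳ-* N j (β ^ d))) ⟩
  (y ^ w) ^ N * (R ^ N * y ^ g) ^ i * (j * β ^ d) ^ N ≤⟨ *-mono-≤ (*-monoʳ-≤ ((y ^ w) ^ N) (^-monoˡ-≤ i h₂)) (^-monoˡ-≤ N h₃) ⟩
  (y ^ w) ^ N * (N ^ N * x ^ g) ^ i * (α ^ d) ^ N ≡⟨ cong₂ (λ u v → (y ^ w) ^ N * u * v) (^-distribʳ-* i (N ^ N) (x ^ g)) (^-*-assoc α d N) ⟩
  (y ^ w) ^ N * ((N ^ N) ^ i * (x ^ g) ^ i) * α ^ (d * N) ≡⟨ cong₂ (λ u v → u * v * α ^ (d * N)) (^-*-assoc y w N)
      (cong₂ _*_ (^-swap N N i) (^-*-assoc x g i)) ⟩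
  y ^ (w * N) * ((N ^ i) ^ N * x ^ (g * i)) * α ^ (d * N) ≡⟨ e₃ (y ^ (w * N)) ((N ^ i) ^ N) (x ^ (g * i)) (α ^ (d * N)) ⟩
  y ^ (w * N) * x ^ (g * i) * α ^ (d * N) * (N ^ i) ^ N ∎)
  where
  open ≤-Reasoning
  e₁ : ∀ a b c z → a * b * c * z ≡ a * z * (b * c)
  e₁ = solve-∀
  e₂ : ∀ r j y g b → r * j * y * (g * b) ≡ y * (r * g) * (j * b)
  e₂ = solve-∀
  e₃ : ∀ y n x a → y * (n * x) * a ≡ y * x * a * n
  e₃ = solve-∀

exponent-compare : ∀ q x y → 1 ≤ q → (1 + q) ^ x * q ^ y ≤ (1 + q) ^ y * q ^ x → x ≤ y
exponent-compare q x y 1≤q h with x ≤? y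
... | yes x≤y = x≤y
... | no x≰y = ⊥-elim (<⇒≱ (^-monoˡ-< d {{>-nonZero 0<d}} (n<1+n q))
    (*-cancel (P * Q) (*-mono-≤ (0<^ y (s≤s z≤n)) (0<^ y 1≤q)) (begin
      (1 + q) ^ d * (P * Q) ≡⟨ e₁ ((1 + q) ^ d) P Q ⟩
      P * (1 + q) ^ d * Q ≡⟨ cong (_* Q) (split (1 + q)) ⟩
      (1 + q) ^ x * Q ≤⟨ h ⟩
      P * q ^ x ≡⟨ cong (P *_) (sym (split q)) ⟩
      P * (Q * q ^ d) ≡⟨ e₂ P Q (q ^ d) ⟩
      q ^ d * (P * Q) ∎)))
  where
  open ≤-Reasoning
  P = (1 + q) ^ y
  Q = q ^ y
  d = x ∸ y
  y<x = ≰⇒> x≰y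
  0<d : 0 < d
  0<d = m<n⇒0<n∸m y<x
  split : ∀ z → z ^ y * z ^ d ≡ z ^ x
  split z = trans (sym (^-distribˡ-+-* z y d)) (cong (z ^_) (m+[n∸m]≡n (<⇒≤ y<x)))
  e₁ : ∀ a b c → a * (b * c) ≡ b * a * c
  e₁ = solve-∀
  e₂ : ∀ a b c → a * (b * c) ≡ c * (a * b)
  e₂ = solve-∀

-- The hypothesis reads (1 + 1/q)ʷ ≤ (1 + a/(bq))ⁱ j. Taken to base 1 + 1/q, the first factor
-- contributes the ideal load (a/b)i with relative error 1/q and the second one the additive error q
-- L.
load-upper : ∀ b q a i j w L → 1 ≤ b → 1 ≤ q → j ≤ 2 ^ L →
  (b * q) ^ i * (1 + q) ^ w ≤ (b * q + a) ^ i * j * q ^ w →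
  w * (b * q) ≤ (1 + q) * a * i + q * L * (b * q)
load-upper (suc b) q a i j w L _ 1≤q j≤ h = exponent-compare q _ _ 1≤q (begin
  (1 + q) ^ (w * N) * q ^ (p * i + q * L * N) ≡⟨ cong ((1 + q) ^ (w * N) *_) (^-distribˡ-+-* q (p * i) _) ⟩
  (1 + q) ^ (w * N) * (q ^ (p * i) * q ^ (q * L * N)) ≡⟨ sym (*-assoc ((1 + q) ^ (w * N)) _ _) ⟩
  (1 + q) ^ (w * N) * q ^ (p * i) * q ^ (q * L * N)
    ≤⟨ power-combine {N} {N + a} {1 + q} {q} {1 + q} {q} i j w p (q * L) 0<N
         (≤-trans (≤-reflexive (*-comm ((1 + q) ^ w) (N ^ i))) h)
         (power-rate {N + a} {1 + N} {N} {1 + q} {q} {1 + q} a 0<N (bernoulli-upper N a 0<N) e-bound)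
         (log-power q j L 1≤q j≤) ⟩
  q ^ (w * N) * (1 + q) ^ (p * i) * (1 + q) ^ (q * L * N) ≡⟨ e₁ (q ^ (w * N)) _ _ ⟩
  (1 + q) ^ (p * i) * (1 + q) ^ (q * L * N) * q ^ (w * N) ≡⟨ cong (_* q ^ (w * N)) (sym (^-distribˡ-+-* (1 + q) (p * i) _)) ⟩
  (1 + q) ^ (p * i + q * L * N) * q ^ (w * N) ∎)
  where
  open ≤-Reasoning
  N = suc b * q
  p = (1 + q) * a
  0<N : 0 < N
  0<N = ≤-trans 1≤q (m≤m+n q (b * q))
  e-bound : (1 + N) ^ N * q ^ (1 + q) ≤ N ^ N * (1 + q) ^ (1 + q)
  e-bound rewrite +-comm q (b * q) = e-upper-bound q (b * q) 1≤q
  e₁ : ∀ a b c → a * b * c ≡ b * c * a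
  e₁ = solve-∀

-- The mirror image of `load-upper`, with (1 - 1/N)ᴺ in the role of (1 + 1/N)ᴺ: the hypothesis reads
-- (q/(1+q))ʷ ≤ (1 - a/N)ⁱ j for N = b(1 + q).
load-lower : ∀ b q a c i j w L → 1 ≤ b → 1 ≤ q → j ≤ 2 ^ L → c + a ≡ b * (1 + q) →
  (b * (1 + q)) ^ i * q ^ w ≤ c ^ i * j * (1 + q) ^ w →
  q * a * i ≤ (w + q * L) * (b * (1 + q))
load-lower (suc b) q a c i j w L _ 1≤q j≤ c+a h = exponent-compare q _ _ 1≤q (begin
  (1 + q) ^ (p * i) * q ^ ((w + q * L) * N) ≡⟨ cong ((1 + q) ^ (p * i) *_) (split q) ⟩
  (1 + q) ^ (p * i) * (q ^ (w * N) * q ^ (q * L * N)) ≡⟨ e₁ ((1 + q) ^ (p * i)) (q ^ (w * N)) _ ⟩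
  q ^ (w * N) * (1 + q) ^ (p * i) * q ^ (q * L * N)
    ≤⟨ power-combine {N} {c} {q} {1 + q} {1 + q} {q} i j w p (q * L) (s≤s z≤n)
         (≤-trans (≤-reflexive (*-comm (q ^ w) (N ^ i))) h)
         (power-rate {c} {M} {N} {q} {1 + q} {q} a (s≤s z≤n) (bernoulli-lower M a c c+a) e-bound)
         (log-power q j L 1≤q j≤) ⟩
  (1 + q) ^ (w * N) * q ^ (p * i) * (1 + q) ^ (q * L * N) ≡⟨ e₂ ((1 + q) ^ (w * N)) _ _ ⟩
  (1 + q) ^ (w * N) * (1 + q) ^ (q * L * N) * q ^ (p * i) ≡⟨ cong (_* q ^ (p * i)) (sym (split (1 + q))) ⟩
  (1 + q) ^ ((w + q * L) * N) * q ^ (p * i) ∎)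
  where
  open ≤-Reasoning
  N = suc b * (1 + q)
  M = q + b * (1 + q)
  p = q * a
  e-bound : M ^ N * (1 + q) ^ q ≤ N ^ N * q ^ q
  e-bound rewrite +-comm q (b * (1 + q)) = e-lower-bound q (b * (1 + q)) 1≤q
  split : ∀ z → z ^ ((w + q * L) * N) ≡ z ^ (w * N) * z ^ (q * L * N)
  split z = trans (cong (z ^_) (*-distribʳ-+ N w (q * L))) (^-distribˡ-+-* z (w * N) _)
  e₁ : ∀ a b c → a * (b * c) ≡ b * a * c
  e₁ = solve-∀
  e₂ : ∀ a b c → a * b * c ≡ a * c * b
  e₂ = solve-∀

-- Exponential potential

wsum : ∀ {j} → (Fin j → Bool) → (Fin j → ℕ) → ℕ
wsum X f = sumFin (λ e → ⟦ X e ⟧ * f e)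

wsum-cong : ∀ {j} (X : Fin j → Bool) {f g : Fin j → ℕ} → (∀ e → f e ≡ g e) → wsum X f ≡ wsum X g
wsum-cong X eq = sum-cong (λ e → cong (⟦ X e ⟧ *_) (eq e))

⟦⟧-∧ : ∀ p q → ⟦ p ∧ q ⟧ ≡ ⟦ p ⟧ * ⟦ q ⟧
⟦⟧-∧ false q = refl
⟦⟧-∧ true  q = sym (+-identityʳ ⟦ q ⟧)

wsum-+* : ∀ {j} (X : Fin j → Bool) (f : Fin j → ℕ) c (p : Fin j → Bool) →
  wsum X (λ e → f e + c * ⟦ p e ⟧) ≡ wsum X f + c * countFin (λ e → X e ∧ p e)
wsum-+* X f c p = trans (sum-cong pointwise) (trans (sum-+ (λ e → ⟦ X e ⟧ * f e) _)
  (cong (wsum X f +_) (sum-* c (λ e → ⟦ X e ∧ p e ⟧))))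
  where
  e₁ : ∀ x f c p → x * (f + c * p) ≡ x * f + c * (x * p)
  e₁ = solve-∀
  pointwise : ∀ e → ⟦ X e ⟧ * (f e + c * ⟦ p e ⟧) ≡ ⟦ X e ⟧ * f e + c * ⟦ X e ∧ p e ⟧
  pointwise e rewrite ⟦⟧-∧ (X e) (p e) = e₁ ⟦ X e ⟧ (f e) c ⟦ p e ⟧

-- A monotone function of w is a combination, with nonnegative coefficients, of the indicators of w
-- ≥ s, and the hypothesis compares X and Y on each of these layers.
layer-cake : ∀ {j} (X Y : Fin j → Bool) (w : Fin j → ℕ) (a b : ℕ) (φ : ℕ → ℕ) →
  (∀ s → φ s ≤ φ (suc s)) →
  (∀ s → b * countFin (λ e → X e ∧ not (w e <ᵇ s)) ≤ a * countFin (λ e → Y e ∧ not (w e <ᵇ s))) →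
  b * wsum X (φ ∘ w) ≤ a * wsum Y (φ ∘ w)
layer-cake {j} X Y w a b φ mono layer = subst₂ (λ x y → b * x ≤ a * y) (full X) (full Y) (truncated M)
  where
  open ≤-Reasoning
  -- No weight exceeds M, so truncation at M changes nothing, and the layers can be added one at a
  -- time by raising the truncation from 0.
  M = sumFin w
  full : ∀ Z → wsum Z (λ e → φ (w e ⊓ M)) ≡ wsum Z (φ ∘ w)
  full Z = wsum-cong Z (λ e → cong φ (m≤n⇒m⊓n≡m (≤-sum w e)))
  above : ℕ → ∀ e → Bool
  above s e = not (w e <ᵇ s)
  increment : ∀ s e → φ (w e ⊓ suc s) ≡ φ (w e ⊓ s) + (φ (suc s) ∸ φ s) * ⟦ above (suc s) e ⟧
  increment s e with w e <ᵇ suc s in eq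
  ... | true  rewrite m≤n⇒m⊓n≡m (<⇒≤ (<ᵇ-true {w e} {suc s} eq))
                    | m≤n⇒m⊓n≡m (≤-pred (<ᵇ-true {w e} {suc s} eq))
                    | *-zeroʳ (φ (suc s) ∸ φ s) = sym (+-identityʳ _)
  ... | false rewrite m≥n⇒m⊓n≡n (<ᵇ-false {w e} {suc s} eq)
                    | m≥n⇒m⊓n≡n (≤-trans (n≤1+n s) (<ᵇ-false {w e} {suc s} eq))
                    | *-identityʳ (φ (suc s) ∸ φ s) = sym (m+[n∸m]≡n (mono s))
  unfold : ∀ Z s → wsum Z (λ e → φ (w e ⊓ suc s)) ≡
    wsum Z (λ e → φ (w e ⊓ s)) + (φ (suc s) ∸ φ s) * countFin (λ e → Z e ∧ above (suc s) e)
  unfold Z s = trans (wsum-cong Z (increment s)) (wsum-+* Z (λ e → φ (w e ⊓ s)) (φ (suc s) ∸ φ s) (above (suc s)))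
  base : ∀ Z → wsum Z (λ e → φ (w e ⊓ 0)) ≡ φ 0 * countFin (λ e → Z e ∧ above 0 e)
  base Z = trans (wsum-cong Z (λ e → trans (cong φ (⊓-zeroʳ (w e))) (sym (*-identityʳ (φ 0)))))
    (trans (wsum-+* Z (λ _ → 0) (φ 0) (above 0))
      (cong (_+ φ 0 * countFin (λ e → Z e ∧ above 0 e))
        (trans (sum-cong (λ e → *-zeroʳ ⟦ Z e ⟧)) (sum-0 j))))
  scale : ∀ c x y → b * x ≤ a * y → b * (c * x) ≤ a * (c * y)
  scale c x y h = subst₂ _≤_ (e c b x) (e c a y) (*-monoʳ-≤ c h)
    where
    e : ∀ c b x → c * (b * x) ≡ b * (c * x)
    e = solve-∀
  truncated : ∀ s → b * wsum X (λ e → φ (w e ⊓ s)) ≤ a * wsum Y (λ e → φ (w e ⊓ s))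
  truncated zero rewrite base X | base Y = scale (φ 0) _ _ (layer 0)
  truncated (suc s) rewrite unfold X s | unfold Y s
    | *-distribˡ-+ b (wsum X (λ e → φ (w e ⊓ s))) ((φ (suc s) ∸ φ s) * countFin (λ e → X e ∧ above (suc s) e))
    | *-distribˡ-+ a (wsum Y (λ e → φ (w e ⊓ s))) ((φ (suc s) ∸ φ s) * countFin (λ e → Y e ∧ above (suc s) e)) =
    +-mono-≤ (truncated s) (scale (φ (suc s) ∸ φ s) _ _ (layer (suc s)))

uses : ∀ {j} → (ℕ → Fin j → Bool) → ℕ → Fin j → ℕ
uses X i e = psum (λ t → ⟦ X t e ⟧) i

uses-≤ : ∀ {j} (X : ℕ → Fin j → Bool) i e → uses X i e ≤ i
uses-≤ X zero    e = z≤n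
uses-≤ X (suc i) e with X i e
... | true  = ≤-trans (+-monoˡ-≤ 1 (uses-≤ X i e)) (≤-reflexive (+-comm i 1))
... | false = ≤-trans (+-monoˡ-≤ 0 (uses-≤ X i e)) (≤-trans (≤-reflexive (+-identityʳ i)) (n≤1+n i))

-- An edge used w times in i rounds has potential (q+1)ʷ qⁱ⁻ʷ, a monotone function of w,
-- so a bound on every layer of the round's edges bounds the growth of the total.
potential : ∀ {j} (B : Fin j → Bool) (X : ℕ → Fin j → Bool) (q a b k : ℕ) →
  (∀ i → i < k → ∀ s → b * countFin (λ e → (B e ∧ X i e) ∧ not (uses X i e <ᵇ s)) ≤
                       a * countFin (λ e → B e ∧ not (uses X i e <ᵇ s))) →
  ∀ i → i ≤ k → ∀ e → B e ≡ true →
  (b * q) ^ i * (1 + q) ^ uses X i e ≤ (b * q + a) ^ i * j * q ^ uses X i e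
potential {j} B X q a b k layers i i≤k e Be = begin
  (b * q) ^ i * (1 + q) ^ w ≡⟨ cong (_* (1 + q) ^ w) (^-distribʳ-* i b q) ⟩
  b ^ i * q ^ i * (1 + q) ^ w ≡⟨ cong (λ x → b ^ i * x * (1 + q) ^ w) (sym q-split) ⟩
  b ^ i * (q ^ w * q ^ (i ∸ w)) * (1 + q) ^ w ≡⟨ e₁ (b ^ i) (q ^ w) (q ^ (i ∸ w)) ((1 + q) ^ w) ⟩
  b ^ i * (1 * Φ i w) * q ^ w ≤⟨ *-monoˡ-≤ (q ^ w) (*-monoʳ-≤ (b ^ i) single) ⟩
  b ^ i * Ψ i * q ^ w ≤⟨ *-monoˡ-≤ (q ^ w) (growth i i≤k) ⟩
  (b * q + a) ^ i * j * q ^ w ∎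
  where
  open ≤-Reasoning
  w = uses X i e
  Φ : ℕ → ℕ → ℕ
  Φ i w = (1 + q) ^ w * q ^ (i ∸ w)
  Ψ : ℕ → ℕ
  Ψ i = wsum B (λ e → Φ i (uses X i e))
  e₁ : ∀ b p r s → b * (p * r) * s ≡ b * (1 * (s * r)) * p
  e₁ = solve-∀
  q-split : q ^ w * q ^ (i ∸ w) ≡ q ^ i
  q-split = trans (sym (^-distribˡ-+-* q w (i ∸ w))) (cong (q ^_) (m+[n∸m]≡n (uses-≤ X i e)))
  single : 1 * Φ i w ≤ Ψ i
  single = ≤-trans (≤-reflexive (cong (λ x → ⟦ x ⟧ * Φ i w) (sym Be)))
    (≤-sum (λ e → ⟦ B e ⟧ * Φ i (uses X i e)) e)
  Φ-mono : ∀ i w → Φ i w ≤ Φ i (suc w)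
  Φ-mono i w with w <? i
  ... | yes w<i rewrite +-∸-assoc 1 w<i = begin
    (1 + q) ^ w * (q * q ^ (i ∸ suc w)) ≤⟨ *-monoʳ-≤ ((1 + q) ^ w) (*-monoˡ-≤ _ (n≤1+n q)) ⟩
    (1 + q) ^ w * ((1 + q) * q ^ (i ∸ suc w)) ≡⟨ e₂ ((1 + q) ^ w) (1 + q) _ ⟩
    (1 + q) * (1 + q) ^ w * q ^ (i ∸ suc w) ∎
    where
    e₂ : ∀ a b c → a * (b * c) ≡ b * a * c
    e₂ = solve-∀
  -- No edge has been used more than i times, but `layer-cake` needs monotonicity at every
  -- threshold; beyond i the truncated exponent of q stays at zero.
  ... | no w≮i rewrite m≤n⇒m∸n≡0 (≮⇒≥ w≮i) | m≤n⇒m∸n≡0 (≤-trans (≮⇒≥ w≮i) (n≤1+n w)) =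
    *-monoˡ-≤ 1 (m≤m+n ((1 + q) ^ w) (q * (1 + q) ^ w))
  Φ-suc : ∀ i e → Φ (suc i) (uses X (suc i) e) ≡ q * Φ i (uses X i e) + Φ i (uses X i e) * ⟦ X i e ⟧
  Φ-suc i e with X i e
  ... | true rewrite +-comm (uses X i e) 1 = e₃ q ((1 + q) ^ uses X i e) (q ^ (i ∸ uses X i e))
    where
    e₃ : ∀ q p r → (1 + q) * p * r ≡ q * (p * r) + p * r * 1
    e₃ = solve-∀
  ... | false rewrite +-identityʳ (uses X i e) | +-∸-assoc 1 (uses-≤ X i e) =
      e₄ q ((1 + q) ^ uses X i e) (q ^ (i ∸ uses X i e))
    where
    e₄ : ∀ q p r → p * (q * r) ≡ q * (p * r) + p * r * 0
    e₄ = solve-∀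
  Ψ-suc : ∀ i → Ψ (suc i) ≡ q * Ψ i + wsum (λ e → B e ∧ X i e) (λ e → Φ i (uses X i e))
  Ψ-suc i = trans (sum-cong pointwise) (trans (sum-+ (λ e → q * (⟦ B e ⟧ * Φ i (uses X i e))) _)
    (cong (_+ wsum (λ e → B e ∧ X i e) (λ e → Φ i (uses X i e))) (sum-* q (λ e → ⟦ B e ⟧ * Φ i (uses X i e)))))
    where
    e₅ : ∀ x q f y → x * (q * f + f * y) ≡ q * (x * f) + x * y * f
    e₅ = solve-∀
    pointwise : ∀ e → ⟦ B e ⟧ * Φ (suc i) (uses X (suc i) e) ≡
      q * (⟦ B e ⟧ * Φ i (uses X i e)) + ⟦ B e ∧ X i e ⟧ * Φ i (uses X i e)
    pointwise e rewrite Φ-suc i e | ⟦⟧-∧ (B e) (X i e) = e₅ ⟦ B e ⟧ q (Φ i (uses X i e)) ⟦ X i e ⟧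
  growth : ∀ i → i ≤ k → b ^ i * Ψ i ≤ (b * q + a) ^ i * j
  growth zero _ = *-monoʳ-≤ 1 (≤-trans (sum-mono (λ e → ≤-trans (≤-reflexive (*-identityʳ ⟦ B e ⟧))
    (⟦⟧-mono {q = true} (λ _ → refl)))) (≤-reflexive (sum-1 j)))
  growth (suc i) i<k = begin
    b * b ^ i * Ψ (suc i) ≡⟨ cong (b * b ^ i *_) (Ψ-suc i) ⟩
    b * b ^ i * (q * Ψ i + Θ) ≡⟨ e₆ b (b ^ i) q (Ψ i) Θ ⟩
    b ^ i * (b * q * Ψ i + b * Θ) ≤⟨ *-monoʳ-≤ (b ^ i) (+-monoʳ-≤ (b * q * Ψ i)
      (layer-cake (λ e → B e ∧ X i e) B (uses X i) a b (Φ i) (Φ-mono i) (layers i i<k))) ⟩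
    b ^ i * (b * q * Ψ i + a * Ψ i) ≡⟨ e₇ (b ^ i) (b * q) (Ψ i) a ⟩
    (b * q + a) * (b ^ i * Ψ i) ≤⟨ *-monoʳ-≤ (b * q + a) (growth i (<⇒≤ i<k)) ⟩
    (b * q + a) * ((b * q + a) ^ i * j) ≡⟨ sym (*-assoc (b * q + a) _ j) ⟩
    (b * q + a) ^ suc i * j ∎
    where
    Θ = wsum (λ e → B e ∧ X i e) (λ e → Φ i (uses X i e))
    e₆ : ∀ b p q s t → b * p * (q * s + t) ≡ p * (b * q * s + b * t)
    e₆ = solve-∀
    e₇ : ∀ p c s a → p * (c * s + a * s) ≡ (c + a) * (p * s)
    e₇ = solve-∀

-- Optimal edge sets and concentration of the loads

module OptimalSets (G : Multigraph) where
  open Components G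
  open SpanningTrees G

  -- A maximizes a∣A∣ − b·rank(A); as a/b grows, these sets are the level sets of the ideal loads.
  Optimal : ℕ → ℕ → EdgeSet G → Set
  Optimal a b A = ∀ B → a * ∣ ∁ A ∣ + b * κ B ≤ a * ∣ ∁ B ∣ + b * κ A

  κ≤n : ∀ A → κ A ≤ n G
  κ≤n A = ≤-trans (κ-anti (⊆-spans {λ _ → false} {A} (λ e ()))) (≤-reflexive κ-∅)

  -- The rank is n - κ, and minimizing a∣ ∁ X ∣ + b·rank keeps the objective a natural number.
  optimal-exists : ∀ a b → ∃ (Optimal a b)
  optimal-exists a b = A , λ B → +-cancelʳ-≤ (b * (n G ∸ κ A) + b * (n G ∸ κ B)) _ _ (begin
    a * ∣ ∁ A ∣ + b * κ B + (b * (n G ∸ κ A) + b * (n G ∸ κ B))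
      ≡⟨ e₁ (a * ∣ ∁ A ∣) b (κ B) (n G ∸ κ A) (n G ∸ κ B) ⟩
    a * ∣ ∁ A ∣ + b * (n G ∸ κ A) + b * (κ B + (n G ∸ κ B))
      ≤⟨ +-mono-≤ (proj₂ least B) (≤-reflexive (cong (b *_) (trans (m+[n∸m]≡n (κ≤n B)) (sym (m+[n∸m]≡n (κ≤n A)))))) ⟩
    a * ∣ ∁ B ∣ + b * (n G ∸ κ B) + b * (κ A + (n G ∸ κ A))
      ≡⟨ e₂ (a * ∣ ∁ B ∣) b (κ A) (n G ∸ κ A) (n G ∸ κ B) ⟩
    a * ∣ ∁ B ∣ + b * κ A + (b * (n G ∸ κ A) + b * (n G ∸ κ B)) ∎)
    where
    open ≤-Reasoning
    least = BoolFun-min (λ X → a * ∣ ∁ X ∣ + b * (n G ∸ κ X))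
      (λ eq → cong₂ (λ x y → a * x + b * (n G ∸ y)) (count-cong (λ i → cong not (eq i))) (κ-cong eq))
    A = proj₁ least
    e₁ : ∀ x b k u v → x + b * k + (b * u + b * v) ≡ x + b * u + b * (k + v)
    e₁ = solve-∀
    e₂ : ∀ x b k u v → x + b * v + b * (k + u) ≡ x + b * k + (b * u + b * v)
    e₂ = solve-∀

  count-∁-⊕ : ∀ A e → A e ≡ false → ∣ ∁ A ∣ ≡ suc ∣ ∁ (A ⊕ e) ∣
  count-∁-⊕ A e Ae = trans (count-cong pointwise) (count-insert (∁ (A ⊕ e)) e e∉)
    where
    e∉ : ∁ (A ⊕ e) e ≡ false
    e∉ rewrite ⊕-∋ A e = refl
    pointwise : ∀ i → ∁ A i ≡ (∁ (A ⊕ e) ⊕ e) i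
    pointwise i with i F.≟ e
    ... | yes refl rewrite Ae = refl
    ... | no _ with A i
    ...   | true  = refl
    ...   | false = refl

  module _ {a b A} (opt : Optimal a b A) where

    -- Inserting e gains a and costs at most b. Hence for a > b an optimal set contains all edges,
    -- which later ends the climb through the levels.
    optimal-bound : ∀ e → A e ≡ false → a ≤ b
    optimal-bound e Ae = +-cancelʳ-≤ (a * c + b * κ (A ⊕ e)) a b (begin
      a + (a * c + b * κ (A ⊕ e)) ≡⟨ e₁ a c (b * κ (A ⊕ e)) ⟩
      a * suc c + b * κ (A ⊕ e) ≡⟨ cong (λ x → a * x + b * κ (A ⊕ e)) (sym (count-∁-⊕ A e Ae)) ⟩
      a * ∣ ∁ A ∣ + b * κ (A ⊕ e) ≤⟨ opt (A ⊕ e) ⟩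
      a * c + b * κ A ≤⟨ +-monoʳ-≤ (a * c) (*-monoʳ-≤ b (κ-insert-≤ A e)) ⟩
      a * c + b * suc (κ (A ⊕ e)) ≡⟨ e₂ (a * c) b (κ (A ⊕ e)) ⟩
      b + (a * c + b * κ (A ⊕ e)) ∎)
      where
      open ≤-Reasoning
      c = ∣ ∁ (A ⊕ e) ∣
      e₁ : ∀ a c x → a + (a * c + x) ≡ a * (1 + c) + x
      e₁ = solve-∀
      e₂ : ∀ x b y → x + b * (1 + y) ≡ b + (x + b * y)
      e₂ = solve-∀

    -- A joined edge can be added without changing the rank, hence at a pure gain of a. So the edges
    -- outside A are exactly those between different classes.
    optimal-closed : 1 ≤ a → ∀ e → Joined A e → A e ≡ true
    optimal-closed 1≤a e je with A e in Ae
    ... | true  = refl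
    ... | false = ⊥-elim (<⇒≱ 1≤a (+-cancelʳ-≤ (a * c + b * κ A) a 0 (begin
      a + (a * c + b * κ A) ≡⟨ e₁ a c (b * κ A) ⟩
      a * suc c + b * κ A ≡⟨ cong₂ (λ x y → a * x + b * y) (sym (count-∁-⊕ A e Ae)) (sym (κ-insert-joined A e je)) ⟩
      a * ∣ ∁ A ∣ + b * κ (A ⊕ e) ≤⟨ opt (A ⊕ e) ⟩
      a * c + b * κ A ∎)))
      where
      open ≤-Reasoning
      c = ∣ ∁ (A ⊕ e) ∣
      e₁ : ∀ a c x → a + (a * c + x) ≡ a * (1 + c) + x
      e₁ = solve-∀

    module _ {w T} (mst : IsMinSpanningTree G w T) where
      open MinTree mst

      -- Removing the heavy edges from A does not pay, so the components this creates number at most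
      -- a/b times the removed edges; by `count-inside-above` they also bound the heavy tree edges
      -- in A.
      inside-layer : ∀ s → b * ∣ (A ∩ T) ∖ below s ∣ ≤ a * ∣ A ∖ below s ∣
      inside-layer s = +-cancelˡ-≤ (a * ∣ ∁ A ∣ + b * κ A) _ _ (begin
        a * ∣ ∁ A ∣ + b * κ A + b * x ≡⟨ e₁ (a * ∣ ∁ A ∣) b (κ A) x ⟩
        a * ∣ ∁ A ∣ + b * (x + κ A) ≤⟨ +-monoʳ-≤ (a * ∣ ∁ A ∣) (*-monoʳ-≤ b (count-inside-above A s)) ⟩
        a * ∣ ∁ A ∣ + b * κ (A ∩ L) ≤⟨ opt (A ∩ L) ⟩
        a * ∣ ∁ (A ∩ L) ∣ + b * κ A ≡⟨ cong (λ z → a * z + b * κ A) outside ⟩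
        a * (∣ ∁ A ∣ + ∣ A ∖ L ∣) + b * κ A ≡⟨ e₂ a ∣ ∁ A ∣ ∣ A ∖ L ∣ (b * κ A) ⟩
        a * ∣ ∁ A ∣ + b * κ A + a * ∣ A ∖ L ∣ ∎)
        where
        open ≤-Reasoning
        L = below s
        x = ∣ (A ∩ T) ∖ L ∣
        outside : ∣ ∁ (A ∩ L) ∣ ≡ ∣ ∁ A ∣ + ∣ A ∖ L ∣
        outside = trans (sum-cong pointwise) (sum-+ (λ i → ⟦ ∁ A i ⟧) (λ i → ⟦ (A ∖ L) i ⟧))
          where
          pointwise : ∀ i → ⟦ ∁ (A ∩ L) i ⟧ ≡ ⟦ ∁ A i ⟧ + ⟦ (A ∖ L) i ⟧
          pointwise i with A i
          ... | true  = refl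
          ... | false = refl
        e₁ : ∀ y b k x → y + b * k + b * x ≡ y + b * (x + k)
        e₁ = solve-∀
        e₂ : ∀ a c d y → a * (c + d) + y ≡ a * c + y + a * d
        e₂ = solve-∀

      -- Adding the light edges to A does not pay, so T contains at least the fraction a/b of the
      -- light edges outside A. The bound is phrased for the omitted edges, because the potential
      -- argument yields only upper bounds.
      outside-layer : ∀ c → c + a ≡ b → ∀ s →
        b * ∣ (∁ A ∩ ∁ T) ∩ below s ∣ ≤ c * ∣ ∁ A ∩ below s ∣
      outside-layer c c+a s = +-cancelʳ-≤ (a * (p + r)) _ _ (begin
        b * r + a * (p + r) ≤⟨ +-monoʳ-≤ (b * r) used ⟩
        b * r + b * p ≡⟨ trans (e₁ b r p) (cong (_* (p + r)) (sym c+a)) ⟩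
        (c + a) * (p + r) ≡⟨ *-distribʳ-+ (p + r) c a ⟩
        c * (p + r) + a * (p + r) ≡⟨ cong (λ z → c * z + a * (p + r)) (sym split) ⟩
        c * ∣ ∁ A ∩ L ∣ + a * (p + r) ∎)
        where
        open ≤-Reasoning
        L = below s
        p = ∣ (T ∩ L) ∖ A ∣
        r = ∣ (∁ A ∩ ∁ T) ∩ L ∣
        e₁ : ∀ b r p → b * r + b * p ≡ b * (p + r)
        e₁ = solve-∀
        e₂ : ∀ a c d y → a * c + (a * d + y) ≡ a * (c + d) + y
        e₂ = solve-∀
        e₃ : ∀ x b p k → x + b * (k + p) ≡ x + (b * p + b * k)
        e₃ = solve-∀
        split : ∣ ∁ A ∩ L ∣ ≡ p + r
        split = trans (sum-cong pointwise)
          (sum-+ (λ i → ⟦ ((T ∩ L) ∖ A) i ⟧) (λ i → ⟦ ((∁ A ∩ ∁ T) ∩ L) i ⟧))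
          where
          pointwise : ∀ i → ⟦ (∁ A ∩ L) i ⟧ ≡ ⟦ ((T ∩ L) ∖ A) i ⟧ + ⟦ ((∁ A ∩ ∁ T) ∩ L) i ⟧
          pointwise i with A i | T i | L i
          ... | true  | true  | true  = refl
          ... | true  | true  | false = refl
          ... | true  | false | _     = refl
          ... | false | true  | true  = refl
          ... | false | true  | false = refl
          ... | false | false | _     = refl
        complement : ∣ ∁ A ∣ ≡ ∣ ∁ (A ∪ L) ∣ + (p + r)
        complement = trans (sum-cong pointwise)
          (trans (sum-+ (λ i → ⟦ ∁ (A ∪ L) i ⟧) (λ i → ⟦ (∁ A ∩ L) i ⟧)) (cong (∣ ∁ (A ∪ L) ∣ +_) split))
          where
          pointwise : ∀ i → ⟦ ∁ A i ⟧ ≡ ⟦ ∁ (A ∪ L) i ⟧ + ⟦ (∁ A ∩ L) i ⟧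
          pointwise i with A i | L i
          ... | true  | _     = refl
          ... | false | true  = refl
          ... | false | false = refl
        used : a * (p + r) ≤ b * p
        used = +-cancelʳ-≤ (b * κ (A ∪ L)) _ _ (+-cancelˡ-≤ (a * ∣ ∁ (A ∪ L) ∣) _ _ (begin
          a * ∣ ∁ (A ∪ L) ∣ + (a * (p + r) + b * κ (A ∪ L)) ≡⟨ e₂ a ∣ ∁ (A ∪ L) ∣ (p + r) (b * κ (A ∪ L)) ⟩
          a * (∣ ∁ (A ∪ L) ∣ + (p + r)) + b * κ (A ∪ L) ≡⟨ cong (λ z → a * z + b * κ (A ∪ L)) (sym complement) ⟩
          a * ∣ ∁ A ∣ + b * κ (A ∪ L) ≤⟨ opt (A ∪ L) ⟩
          a * ∣ ∁ (A ∪ L) ∣ + b * κ A ≤⟨ +-monoʳ-≤ (a * ∣ ∁ (A ∪ L) ∣) (*-monoʳ-≤ b (count-outside-below A s)) ⟩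
          a * ∣ ∁ (A ∪ L) ∣ + b * (κ (A ∪ L) + p) ≡⟨ e₃ (a * ∣ ∁ (A ∪ L) ∣) b p (κ (A ∪ L)) ⟩
          a * ∣ ∁ (A ∪ L) ∣ + (b * p + b * κ (A ∪ L)) ∎))

module Loads (G : Multigraph) (k : ℕ) (T : ℕ → EdgeSet G)
  (greedy : ∀ i → i < k → IsMinSpanningTree G (uses T i) (T i)) where
  open Components G
  open OptimalSets G
  open SpanningTrees G

  uses-complement : ∀ i e → uses T i e + uses (λ t → ∁ (T t)) i e ≡ i
  uses-complement zero    e = refl
  uses-complement (suc i) e = trans (e₁ (uses T i e) ⟦ T i e ⟧ (uses (λ t → ∁ (T t)) i e) ⟦ not (T i e) ⟧)
    (trans (cong₂ _+_ (uses-complement i e) (bit (T i e))) (+-comm i 1))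
    where
    e₁ : ∀ a b c d → a + b + (c + d) ≡ a + c + (b + d)
    e₁ = solve-∀
    bit : ∀ x → ⟦ x ⟧ + ⟦ not x ⟧ ≡ 1
    bit true  = refl
    bit false = refl

  module _ {a b q A} (1≤b : 1 ≤ b) (1≤q : 1 ≤ q) (opt : Optimal a b A) where

    load-inside : ∀ i → i ≤ k → ∀ e → A e ≡ true →
      uses T i e * (b * q) ≤ (1 + q) * a * i + q * ⌈log₂ m G ⌉ * (b * q)
    load-inside i i≤k e Ae = load-upper b q a i (m G) (uses T i e) ⌈log₂ m G ⌉ 1≤b 1≤q (m≤2^⌈log₂m⌉ (m G))
      (potential A T q a b k (λ i i<k s → inside-layer {a} {b} {A} opt (greedy i i<k) s) i i≤k e Ae)

    -- The potential is run on the complements of the trees: few omissions mean a large load, and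
    -- the edges with at least s omissions in i rounds are those of load at most i - s.
    load-outside : ∀ i → i ≤ k → ∀ e → A e ≡ false →
      q * a * i ≤ (uses T i e + q * ⌈log₂ m G ⌉) * (b * (1 + q))
    load-outside i i≤k e Ae = load-lower b q a (b * q + c) i (m G) w ⌈log₂ m G ⌉ 1≤b 1≤q
      (m≤2^⌈log₂m⌉ (m G)) (trans (+-assoc (b * q) c a) (trans (cong (b * q +_) c+a) (e₀ b q)))
      -- The potential bounds the omissions w′ = i - w; splitting qⁱ and (1 + q)ⁱ along i = w + w′
      -- trades them for w.
      (*-cancel (q ^ i) (0<^ i 1≤q) (begin
        (b * (1 + q)) ^ i * q ^ w * q ^ i ≡⟨ cong (λ x → x * q ^ w * q ^ i) (^-distribʳ-* i b (1 + q)) ⟩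
        b ^ i * (1 + q) ^ i * q ^ w * q ^ i ≡⟨ cong (λ x → b ^ i * x * q ^ w * q ^ i) (split (1 + q)) ⟩
        b ^ i * ((1 + q) ^ w * (1 + q) ^ w′) * q ^ w * q ^ i ≡⟨ e₁ (b ^ i) ((1 + q) ^ w) ((1 + q) ^ w′) (q ^ w) (q ^ i) ⟩
        b ^ i * q ^ i * (1 + q) ^ w′ * (q ^ w * (1 + q) ^ w) ≡⟨ cong (λ x → x * (1 + q) ^ w′ * (q ^ w * (1 + q) ^ w)) (sym (^-distribʳ-* i b q)) ⟩
        (b * q) ^ i * (1 + q) ^ w′ * (q ^ w * (1 + q) ^ w)
          ≤⟨ *-monoˡ-≤ (q ^ w * (1 + q) ^ w) (potential (∁ A) (λ t → ∁ (T t)) q c b k layers i i≤k e (cong not Ae)) ⟩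
        (b * q + c) ^ i * m G * q ^ w′ * (q ^ w * (1 + q) ^ w) ≡⟨ e₂ ((b * q + c) ^ i) (m G) (q ^ w′) (q ^ w) ((1 + q) ^ w) ⟩
        (b * q + c) ^ i * m G * (1 + q) ^ w * (q ^ w * q ^ w′) ≡⟨ cong ((b * q + c) ^ i * m G * (1 + q) ^ w *_) (sym (split q)) ⟩
        (b * q + c) ^ i * m G * (1 + q) ^ w * q ^ i ∎))
      where
      open ≤-Reasoning
      w = uses T i e
      w′ = uses (λ t → ∁ (T t)) i e
      c = b ∸ a
      c+a : c + a ≡ b
      c+a = m∸n+n≡m (optimal-bound {a} {b} {A} opt e Ae)
      e₀ : ∀ b q → b * q + b ≡ b * (1 + q)
      e₀ = solve-∀
      e₁ : ∀ b x y z t → b * (x * y) * z * t ≡ b * t * y * (z * x)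
      e₁ = solve-∀
      e₂ : ∀ c m x y z → c * m * x * (y * z) ≡ c * m * z * (y * x)
      e₂ = solve-∀
      split : ∀ z → z ^ i ≡ z ^ w * z ^ w′
      split z = trans (cong (z ^_) (sym (uses-complement i e))) (^-distribˡ-+-* z w w′)
      layers : ∀ i → i < k → ∀ s →
        b * countFin (λ e → (∁ A ∩ ∁ (T i)) e ∧ not (uses (λ t → ∁ (T t)) i e <ᵇ s)) ≤
        c * countFin (λ e → ∁ A e ∧ not (uses (λ t → ∁ (T t)) i e <ᵇ s))
      layers i i<k s with s ≤? i
      ... | yes s≤i = subst₂ (λ x y → b * x ≤ c * y)
              (count-cong (λ e → cong ((∁ A ∩ ∁ (T i)) e ∧_) (reflect e)))
              (count-cong (λ e → cong (∁ A e ∧_) (reflect e)))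
              (outside-layer {a} {b} {A} opt (greedy i i<k) c c+a (suc (i ∸ s)))
        where
        reflect : ∀ e → (uses T i e <ᵇ suc (i ∸ s)) ≡ not (uses (λ t → ∁ (T t)) i e <ᵇ s)
        reflect e with uses (λ t → ∁ (T t)) i e <ᵇ s in eq
        ... | false = <ᵇ-intro (s≤s (m+n≤o⇒m≤o∸n (uses T i e)
                (≤-trans (+-monoʳ-≤ (uses T i e) (<ᵇ-false {_} {s} eq)) (≤-reflexive (uses-complement i e)))))
        ... | true with uses T i e <ᵇ suc (i ∸ s) in eq′
        ...   | false = refl
        ...   | true  = ⊥-elim (<-irrefl (uses-complement i e) (begin-strict
                uses T i e + uses (λ t → ∁ (T t)) i e <⟨ +-monoʳ-< (uses T i e) (<ᵇ-true {_} {s} eq) ⟩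
                uses T i e + s ≤⟨ +-monoˡ-≤ s (≤-pred (<ᵇ-true {_} {suc (i ∸ s)} eq′)) ⟩
                i ∸ s + s ≡⟨ m∸n+n≡m s≤i ⟩
                i ∎))
      -- Nothing is omitted more than i times in i rounds, so this layer is empty.
      ... | no s≰i = ≤-trans (≤-reflexive (trans (cong (b *_) none) (*-zeroʳ b))) z≤n
        where
        none : countFin (λ e → (∁ A ∩ ∁ (T i)) e ∧ not (uses (λ t → ∁ (T t)) i e <ᵇ s)) ≡ 0
        none = trans (sum-cong pointwise) (sum-0 (m G))
          where
          pointwise : ∀ e → ⟦ (∁ A ∩ ∁ (T i)) e ∧ not (uses (λ t → ∁ (T t)) i e <ᵇ s) ⟧ ≡ 0
          pointwise e rewrite <ᵇ-intro (≤-<-trans (uses-≤ (λ t → ∁ (T t)) i e) (≰⇒> s≰i))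
            with (∁ A ∩ ∁ (T i)) e
          ... | true  = refl
          ... | false = refl

-- Numerical estimates

cancel-scaled : ∀ c {x y} → 0 < c → c * x ≤ c * y → x ≤ y
cancel-scaled c 0<c h = *-cancelˡ-≤ c {{>-nonZero 0<c}} h

-- The relative error turns into a i / q, which 4a ≤ q limits to i/4. After scaling by b,
-- consecutive levels have ideal loads at distance i, so this is a quarter of their spacing.
inside-estimate : ∀ b q a i w L → 1 ≤ q → 4 * a ≤ q →
  w * (b * q) ≤ (1 + q) * a * i + q * L * (b * q) →
  4 * (b * w) ≤ 4 * (a * i) + i + 4 * (q * L * b)
inside-estimate b q a i w L 1≤q 4a≤q h = cancel-scaled q 1≤q (begin
  q * (4 * (b * w)) ≡⟨ e₁ q b w ⟩
  4 * (w * (b * q)) ≤⟨ *-monoʳ-≤ 4 h ⟩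
  4 * ((1 + q) * a * i + q * L * (b * q)) ≡⟨ e₂ q a i L b ⟩
  q * (4 * (a * i) + 4 * (q * L * b)) + 4 * a * i ≤⟨ +-monoʳ-≤ (q * (4 * (a * i) + 4 * (q * L * b))) (*-monoˡ-≤ i 4a≤q) ⟩
  q * (4 * (a * i) + 4 * (q * L * b)) + q * i ≡⟨ e₃ q (4 * (a * i)) (4 * (q * L * b)) i ⟩
  q * (4 * (a * i) + i + 4 * (q * L * b)) ∎)
  where
  open ≤-Reasoning
  e₁ : ∀ q b w → q * (4 * (b * w)) ≡ 4 * (w * (b * q))
  e₁ = solve-∀
  e₂ : ∀ q a i L b → 4 * ((1 + q) * a * i + q * L * (b * q)) ≡ q * (4 * (a * i) + 4 * (q * L * b)) + 4 * a * i
  e₂ = solve-∀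
  e₃ : ∀ q x y i → q * (x + y) + q * i ≡ q * (x + i + y)
  e₃ = solve-∀

outside-estimate : ∀ b q a i w L → 4 * a ≤ q →
  q * a * i ≤ (w + q * L) * (b * (1 + q)) →
  4 * (a * i) ≤ 4 * (b * w) + 4 * (q * L * b) + i
outside-estimate b q a i w L 4a≤q h = cancel-scaled (1 + q) (s≤s z≤n) (begin
  (1 + q) * (4 * (a * i)) ≡⟨ e₁ q a i ⟩
  4 * (q * a * i) + 4 * a * i ≤⟨ +-mono-≤ (*-monoʳ-≤ 4 h) (*-monoˡ-≤ i (≤-trans 4a≤q (n≤1+n q))) ⟩
  4 * ((w + q * L) * (b * (1 + q))) + (1 + q) * i ≡⟨ e₂ q b w L i ⟩
  (1 + q) * (4 * (b * w) + 4 * (q * L * b) + i) ∎)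
  where
  open ≤-Reasoning
  e₁ : ∀ q a i → (1 + q) * (4 * (a * i)) ≡ 4 * (q * a * i) + 4 * a * i
  e₁ = solve-∀
  e₂ : ∀ q b w L i → 4 * ((w + q * L) * (b * (1 + q))) + (1 + q) * i ≡ (1 + q) * (4 * (b * w) + 4 * (q * L * b) + i)
  e₂ = solve-∀

-- The error terms are relative to a, so enlarging a beyond a₀ only helps.
late-estimate : ∀ b q a₀ s h K w y L → 3 ≤ q → 4 * a₀ ≤ q → q * L * b ≤ K → h ≤ K →
  q * (s + a₀) * (h + K) ≤ (w + y + q * L) * (b * (1 + q)) →
  w * (b * q) ≤ (1 + q) * (1 + (s + a₀)) * h + q * L * (b * q) →
  a₀ * K ≤ b * y + 5 * K
late-estimate b q a₀ s h K w y L 3≤q 4a₀≤q W≤K h≤K h₁ h₂ =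
  cancel-scaled (4 * (q * (1 + q))) (*-mono-≤ {1} {4} (s≤s z≤n) (*-mono-≤ 1≤q (s≤s (z≤n {q})))) (begin
  4 * (q * (1 + q)) * (a₀ * K) ≡⟨ e₄ q a₀ K ⟩
  4 * (q * q * a₀ * K) + q * (4 * a₀) * K ≤⟨ +-monoˡ-≤ (q * (4 * a₀) * K) (*-monoʳ-≤ 4 step₃) ⟩
  4 * (q * (1 + q) * (b * y) + ((2 * q + 1) * a₀ * h + (1 + q) * (1 + q) * h + 2 * (q * (1 + q) * W))) + q * (4 * a₀) * K
    ≡⟨ e₅ q (b * y) a₀ h W K ⟩
  4 * (q * (1 + q)) * (b * y) + ((2 * q + 1) * (4 * a₀) * h + 4 * ((1 + q) * (1 + q) * h) + 8 * (q * (1 + q) * W) + q * (4 * a₀) * K)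
    ≤⟨ +-monoʳ-≤ (4 * (q * (1 + q)) * (b * y)) (+-mono-≤ (+-mono-≤ (+-mono-≤
         (*-mono-≤ (*-monoʳ-≤ (2 * q + 1) 4a₀≤q) h≤K)
         (*-monoʳ-≤ 4 (*-mono-≤ (*-monoˡ-≤ (1 + q) 1+q≤2q) h≤K)))
         (*-monoʳ-≤ 8 (*-monoʳ-≤ (q * (1 + q)) W≤K)))
         (*-monoˡ-≤ K (*-monoʳ-≤ q 4a₀≤q))) ⟩
  4 * (q * (1 + q)) * (b * y) + ((2 * q + 1) * q * K + 4 * (2 * q * (1 + q) * K) + 8 * (q * (1 + q) * K) + q * q * K)
    ≤⟨ ≤-trans (m≤m+n _ (q * q * K + 3 * q * K)) (≤-reflexive (e₆ q (b * y) K)) ⟩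
  4 * (q * (1 + q)) * (b * y + 5 * K) ∎)
  where
  open ≤-Reasoning
  W = q * L * b
  a = s + a₀
  1≤q : 1 ≤ q
  1≤q = ≤-trans (s≤s z≤n) 3≤q
  1+q≤2q : 1 + q ≤ 2 * q
  1+q≤2q = ≤-trans (+-monoˡ-≤ q 1≤q) (≤-reflexive (cong (q +_) (sym (+-identityʳ q))))
  e₁ : ∀ q a k → q * q * a * k ≡ q * (q * a * k)
  e₁ = solve-∀
  e₂ : ∀ q w y L b → q * ((w + y + q * L) * (b * (1 + q))) ≡ (1 + q) * (w * (b * q)) + (q * (1 + q) * (b * y) + q * (1 + q) * (q * L * b))
  e₂ = solve-∀
  e₃ : ∀ q a h L b y → (1 + q) * ((1 + q) * (1 + a) * h + q * L * (b * q)) + (q * (1 + q) * (b * y) + q * (1 + q) * (q * L * b)) ≡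
    q * (1 + q) * (b * y) + ((1 + q) * (1 + q) * ((1 + a) * h) + 2 * (q * (1 + q) * (q * L * b)))
  e₃ = solve-∀
  step₁ : q * q * a * (h + K) ≤ q * (1 + q) * (b * y) + ((1 + q) * (1 + q) * ((1 + a) * h) + 2 * (q * (1 + q) * W))
  step₁ = begin
    q * q * a * (h + K) ≡⟨ e₁ q a (h + K) ⟩
    q * (q * a * (h + K)) ≤⟨ *-monoʳ-≤ q h₁ ⟩
    q * ((w + y + q * L) * (b * (1 + q))) ≡⟨ e₂ q w y L b ⟩
    (1 + q) * (w * (b * q)) + (q * (1 + q) * (b * y) + q * (1 + q) * W) ≤⟨ +-monoˡ-≤ _ (*-monoʳ-≤ (1 + q) h₂) ⟩
    (1 + q) * ((1 + q) * (1 + a) * h + q * L * (b * q)) + (q * (1 + q) * (b * y) + q * (1 + q) * W) ≡⟨ e₃ q a h L b y ⟩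
    q * (1 + q) * (b * y) + ((1 + q) * (1 + q) * ((1 + a) * h) + 2 * (q * (1 + q) * W)) ∎
  -- The part s of the numerator is not bounded by q, so its error is absorbed by the growth from h
  -- to h + K ≥ 2h: for q ≥ 3 one has (1 + q)² ≤ 2q².
  squares : (1 + q) * (1 + q) * (s * h) ≤ q * q * (s * (h + K))
  squares = begin
    (1 + q) * (1 + q) * (s * h) ≡⟨ cong (_* (s * h)) (f₁ q) ⟩
    (q * q + (2 * q + 1)) * (s * h) ≤⟨ *-monoˡ-≤ (s * h) (+-monoʳ-≤ (q * q) (≤-trans (+-monoʳ-≤ (2 * q) 1≤q)
        (≤-trans (≤-reflexive (f₂ q)) (*-monoˡ-≤ q 3≤q)))) ⟩
    (q * q + q * q) * (s * h) ≡⟨ f₃ q s h ⟩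
    q * q * (s * (h + h)) ≤⟨ *-monoʳ-≤ (q * q) (*-monoʳ-≤ s (+-monoʳ-≤ h h≤K)) ⟩
    q * q * (s * (h + K)) ∎
    where
    f₁ : ∀ q → (1 + q) * (1 + q) ≡ q * q + (2 * q + 1)
    f₁ = solve-∀
    f₂ : ∀ q → 2 * q + q ≡ 3 * q
    f₂ = solve-∀
    f₃ : ∀ q s h → (q * q + q * q) * (s * h) ≡ q * q * (s * (h + h))
    f₃ = solve-∀
  step₃ : q * q * a₀ * K ≤ q * (1 + q) * (b * y) + ((2 * q + 1) * a₀ * h + (1 + q) * (1 + q) * h + 2 * (q * (1 + q) * W))
  step₃ = +-cancelʳ-≤ (q * q * a₀ * h + q * q * (s * (h + K))) _ _ (begin
    q * q * a₀ * K + (q * q * a₀ * h + q * q * (s * (h + K))) ≡⟨ f₁ q a₀ s h K ⟩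
    q * q * a * (h + K) ≤⟨ step₁ ⟩
    q * (1 + q) * (b * y) + ((1 + q) * (1 + q) * ((1 + a) * h) + 2 * (q * (1 + q) * W)) ≡⟨ f₂ q (b * y) a₀ s h W ⟩
    X + q * q * a₀ * h + (1 + q) * (1 + q) * (s * h) ≤⟨ +-monoʳ-≤ (X + q * q * a₀ * h) squares ⟩
    X + q * q * a₀ * h + q * q * (s * (h + K)) ≡⟨ +-assoc X _ _ ⟩
    X + (q * q * a₀ * h + q * q * (s * (h + K))) ∎)
    where
    X = q * (1 + q) * (b * y) + ((2 * q + 1) * a₀ * h + (1 + q) * (1 + q) * h + 2 * (q * (1 + q) * W))
    f₁ : ∀ q a₀ s h K → q * q * a₀ * K + (q * q * a₀ * h + q * q * (s * (h + K))) ≡ q * q * (s + a₀) * (h + K)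
    f₁ = solve-∀
    f₂ : ∀ q z a₀ s h W → q * (1 + q) * z + ((1 + q) * (1 + q) * ((1 + (s + a₀)) * h) + 2 * (q * (1 + q) * W)) ≡
      q * (1 + q) * z + ((2 * q + 1) * a₀ * h + (1 + q) * (1 + q) * h + 2 * (q * (1 + q) * W)) + q * q * a₀ * h + (1 + q) * (1 + q) * (s * h)
    f₂ = solve-∀
  e₄ : ∀ q a₀ K → 4 * (q * (1 + q)) * (a₀ * K) ≡ 4 * (q * q * a₀ * K) + q * (4 * a₀) * K
  e₄ = solve-∀
  e₅ : ∀ q z a₀ h W K → 4 * (q * (1 + q) * z + ((2 * q + 1) * a₀ * h + (1 + q) * (1 + q) * h + 2 * (q * (1 + q) * W))) + q * (4 * a₀) * K ≡
    4 * (q * (1 + q)) * z + ((2 * q + 1) * (4 * a₀) * h + 4 * ((1 + q) * (1 + q) * h) + 8 * (q * (1 + q) * W) + q * (4 * a₀) * K)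
  e₅ = solve-∀
  e₆ : ∀ q z K → 4 * (q * (1 + q)) * z + ((2 * q + 1) * q * K + 4 * (2 * q * (1 + q) * K) + 8 * (q * (1 + q) * K) + q * q * K) + (q * q * K + 3 * q * K) ≡
    4 * (q * (1 + q)) * (z + 5 * K)
  e₆ = solve-∀

-- From numerator a at time h to a + 1 at time h + K the ideal value grows by aK + h + K. The errors
-- (h + K)/4 + h/4 + 2W add at most K, and h ≤ K makes the total at most (a + 3)K.
middle-estimate : ∀ b a h K w y W → h ≤ K → 8 * W ≤ h →
  4 * (b * (w + y)) ≤ 4 * ((1 + a) * (h + K)) + (h + K) + 4 * W →
  4 * (a * h) ≤ 4 * (b * w) + 4 * W + h →
  b * y ≤ (a + 3) * K
middle-estimate b a h K w y W h≤K 8W≤h h₁ h₂ = cancel-scaled 4 (s≤s z≤n)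
  (+-cancelʳ-≤ (4 * (b * w) + 4 * (a * h)) _ _ (begin
  4 * (b * y) + (4 * (b * w) + 4 * (a * h)) ≡⟨ e₁ b y w (a * h) ⟩
  4 * (b * (w + y)) + 4 * (a * h) ≤⟨ +-mono-≤ h₁ h₂ ⟩
  4 * ((1 + a) * (h + K)) + (h + K) + 4 * W + (4 * (b * w) + 4 * W + h) ≡⟨ e₂ a h K W (b * w) ⟩
  X + (6 * h + 8 * W) ≤⟨ +-monoʳ-≤ X (+-mono-≤ (*-monoʳ-≤ 6 h≤K) (≤-trans 8W≤h h≤K)) ⟩
  X + (6 * K + K) ≡⟨ e₃ a h K (b * w) ⟩
  4 * ((a + 3) * K) + (4 * (b * w) + 4 * (a * h)) ∎))
  where
  open ≤-Reasoning
  X = 4 * (a * K) + 5 * K + (4 * (b * w) + 4 * (a * h))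
  e₁ : ∀ b y w z → 4 * (b * y) + (4 * (b * w) + 4 * z) ≡ 4 * (b * (w + y)) + 4 * z
  e₁ = solve-∀
  e₂ : ∀ a h K W z → 4 * ((1 + a) * (h + K)) + (h + K) + 4 * W + (4 * z + 4 * W + h) ≡
    4 * (a * K) + 5 * K + (4 * z + 4 * (a * h)) + (6 * h + 8 * W)
  e₂ = solve-∀
  e₃ : ∀ a h K z → 4 * (a * K) + 5 * K + (4 * z + 4 * (a * h)) + (6 * K + K) ≡ 4 * ((a + 3) * K) + (4 * z + 4 * (a * h))
  e₃ = solve-∀

-- The ideal values differ by i, while the two errors i/4 + W together are at most 3i/4 because W ≤
-- i/8.
separation-estimate : ∀ a i z W → 1 ≤ i → 8 * W ≤ i →
  4 * ((1 + a) * i) ≤ 4 * z + 4 * W + i → 4 * (a * i) + i + 4 * W < 4 * z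
separation-estimate a i z W 1≤i 8W≤i h = +-cancelʳ-≤ (8 * W + i) _ _ (begin
  1 + (4 * (a * i) + i + 4 * W) + (8 * W + i) ≤⟨ +-mono-≤ (+-monoˡ-≤ (4 * (a * i) + i + 4 * W) 1≤i) (+-monoˡ-≤ i 8W≤i) ⟩
  i + (4 * (a * i) + i + 4 * W) + (i + i) ≡⟨ e₁ a i W ⟩
  4 * ((1 + a) * i) + 4 * W ≤⟨ +-monoˡ-≤ (4 * W) h ⟩
  4 * z + 4 * W + i + 4 * W ≡⟨ e₂ z W i ⟩
  4 * z + (8 * W + i) ∎)
  where
  open ≤-Reasoning
  e₁ : ∀ a i W → i + (4 * (a * i) + i + 4 * W) + (i + i) ≡ 4 * ((1 + a) * i) + 4 * W
  e₁ = solve-∀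
  e₂ : ∀ z W i → 4 * z + 4 * W + i + 4 * W ≡ 4 * z + (8 * W + i)
  e₂ = solve-∀

-- With t = a/b the levels run from 2/ℓ − 3/(4ℓ²) to 2/ℓ − 1/(2ℓ²) in steps of 1/(128ℓ³).
level-scale level-base : ℕ → ℕ
level-scale l = 128 * (l * l * l)
level-base  l = 160 * (l * l) + 96 * (l * (l ∸ 1))

-- The target load per tree is 3/2 + d/(2l). It equals 2 at d = l, where double crossing is all that
-- is known, and it is linear in d so that it can be summed over the classes. For d > l it is
-- attained because a₀/b is only 3/(4l²) below 2/l.
cut-estimate : ∀ p t K d load → let l = 2 + p in d ≡ suc l + t →
  d * (level-base l * K) ≤ level-scale l * load + 5 * (d * K) →
  3 * l * K + K * d ≤ 2 * l * load
cut-estimate p t K d load refl h = cancel-scaled (64 * (l * l)) (s≤s z≤n)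
  (+-cancelʳ-≤ (5 * (d * K)) _ _ (begin
  64 * (l * l) * (3 * l * K + K * d) + 5 * (d * K) ≤⟨ ≤-trans (m≤m+n _ _) (≤-reflexive (e₁ p t K)) ⟩
  d * (level-base l * K) ≤⟨ h ⟩
  level-scale l * load + 5 * (d * K) ≡⟨ cong (_+ 5 * (d * K)) (e₂ l load) ⟩
  64 * (l * l) * (2 * l * load) + 5 * (d * K) ∎))
  where
  open ≤-Reasoning
  l = 2 + p
  e₂ : ∀ l x → 128 * (l * l * l) * x ≡ 64 * (l * l) * (2 * l * x)
  e₂ = solve-∀
  e₁ : ∀ p t K → 64 * ((2 + p) * (2 + p)) * (3 * (2 + p) * K + K * (3 + p + t)) + 5 * ((3 + p + t) * K) +
      (177 + 283 * p + 96 * (p * p) + t * (571 + 672 * p + 192 * (p * p))) * K ≡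
    (3 + p + t) * ((160 * ((2 + p) * (2 + p)) + 96 * ((2 + p) * (1 + p))) * K)
  e₁ = solve-∀

-- Summing the first inequality, V falls by at most 4 x₀ in total. Then Z loses at most 12 K x₀ /
-- (160 l²), so it stays above half of its initial bound K x₀ / (4l), and each step lowers V by at
-- least 1 + x₀ / (8l). Over 32l steps this is 32l + 4 x₀; the summand 1 settles the case x₀ = 0.
descent : ∀ l K (V x Z : ℕ → ℕ) → 1 ≤ l → 1 ≤ K →
  (∀ s → s < 32 * l → V s + 4 * x (suc s) ≤ V (suc s) + 4 * x s) →
  (∀ s → s < 32 * l → 160 * (l * l) * Z s + 3 * K * V (suc s) ≤ 160 * (l * l) * Z (suc s) + 3 * K * V s) →
  (∀ s → s < 32 * l → Z (suc s) + K + K * V (suc s) ≤ K * V s) →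
  K * x 0 ≤ 4 * l * Z 0 → ⊥
descent l K V x Z 1≤l 1≤K hV hZ hD h₀ = <⇒≱ (*-mono-≤ {1} {32} (s≤s z≤n) (*-mono-≤ 1≤l (*-mono-≤ {1} {8} (s≤s z≤n) 1≤l)))
  (+-cancelʳ-≤ (8 * l * V r + 32 * l * x 0) (32 * (l * (8 * l))) 0 (begin
  32 * (l * (8 * l)) + (8 * l * V r + 32 * l * x 0) ≡⟨ e₁ l (V r) (x 0) ⟩
  8 * l * V r + 32 * l * (8 * l + x 0) ≤⟨ fall r ≤-refl ⟩
  8 * l * V 0 ≤⟨ *-monoʳ-≤ (8 * l) (≤-trans (m≤m+n (V 0) (4 * x r)) (V-fall r ≤-refl)) ⟩
  8 * l * (V r + 4 * x 0) ≡⟨ e₂ l (V r) (x 0) ⟩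
  8 * l * V r + 32 * l * x 0 ∎))
  where
  open ≤-Reasoning
  r = 32 * l
  c = 160 * (l * l)
  e₁ : ∀ l v x → 32 * (l * (8 * l)) + (8 * l * v + 32 * l * x) ≡ 8 * l * v + 32 * l * (8 * l + x)
  e₁ = solve-∀
  e₂ : ∀ l v x → 8 * l * (v + 4 * x) ≡ 8 * l * v + 32 * l * x
  e₂ = solve-∀
  telescope : ∀ a b c d e f → a + b ≤ c + d → c + e ≤ f + b → a + e ≤ f + d
  telescope a b c d e f p q = +-cancelʳ-≤ (b + c) _ _ (subst₂ _≤_ (g₁ a b c e) (g₂ c d f b) (+-mono-≤ p q))
    where
    g₁ : ∀ a b c e → a + b + (c + e) ≡ a + e + (b + c)
    g₁ = solve-∀
    g₂ : ∀ c d f b → c + d + (f + b) ≡ f + d + (b + c)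
    g₂ = solve-∀
  V-fall : ∀ s → s ≤ r → V 0 + 4 * x s ≤ V s + 4 * x 0
  V-fall zero    _  = ≤-refl
  V-fall (suc s) le = telescope (V 0) (4 * x s) (V s) (4 * x 0) (4 * x (suc s)) (V (suc s)) (V-fall s (<⇒≤ le)) (hV s le)
  Z-fall : ∀ s → s ≤ r → c * Z 0 + 3 * K * V s ≤ c * Z s + 3 * K * V 0
  Z-fall zero    _  = ≤-refl
  Z-fall (suc s) le = telescope (c * Z 0) (3 * K * V s) (c * Z s) (3 * K * V 0) (3 * K * V (suc s)) (c * Z (suc s))
    (Z-fall s (<⇒≤ le)) (hZ s le)
  Z-large : ∀ s → s ≤ r → K * x 0 ≤ 8 * l * Z s
  Z-large s le = cancel-scaled (20 * l) (*-mono-≤ {1} {20} (s≤s z≤n) 1≤l)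
    (+-cancelʳ-≤ (20 * l * (K * x 0) + 3 * K * V s) _ _ (begin
    20 * l * (K * x 0) + (20 * l * (K * x 0) + 3 * K * V s) ≡⟨ g₁ l (K * x 0) (3 * K * V s) ⟩
    40 * l * (K * x 0) + 3 * K * V s ≤⟨ +-monoˡ-≤ (3 * K * V s) (*-monoʳ-≤ (40 * l) h₀) ⟩
    40 * l * (4 * l * Z 0) + 3 * K * V s ≡⟨ cong (_+ 3 * K * V s) (g₂ l (Z 0)) ⟩
    c * Z 0 + 3 * K * V s ≤⟨ Z-fall s le ⟩
    c * Z s + 3 * K * V 0 ≤⟨ +-monoʳ-≤ (c * Z s) (*-monoʳ-≤ (3 * K) (≤-trans (m≤m+n (V 0) (4 * x s)) (V-fall s le))) ⟩
    c * Z s + 3 * K * (V s + 4 * x 0) ≡⟨ g₃ (c * Z s) K (V s) (x 0) ⟩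
    c * Z s + 12 * (K * x 0) + 3 * K * V s ≤⟨ +-monoˡ-≤ (3 * K * V s) (+-monoʳ-≤ (c * Z s)
       (*-monoˡ-≤ (K * x 0) (*-mono-≤ {12} {20} (m≤m+n 12 8) 1≤l))) ⟩
    c * Z s + 20 * l * (K * x 0) + 3 * K * V s ≡⟨ g₄ l (Z s) (20 * l * (K * x 0)) (3 * K * V s) ⟩
    20 * l * (8 * l * Z s) + (20 * l * (K * x 0) + 3 * K * V s) ∎))
    where
    g₁ : ∀ l z v → 20 * l * z + (20 * l * z + v) ≡ 40 * l * z + v
    g₁ = solve-∀
    g₂ : ∀ l z → 40 * l * (4 * l * z) ≡ 160 * (l * l) * z
    g₂ = solve-∀
    g₃ : ∀ z K v x → z + 3 * K * (v + 4 * x) ≡ z + 12 * (K * x) + 3 * K * v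
    g₃ = solve-∀
    g₄ : ∀ l z x v → 160 * (l * l) * z + x + v ≡ 20 * l * (8 * l * z) + (x + v)
    g₄ = solve-∀
  fall : ∀ s → s ≤ r → 8 * l * V s + s * (8 * l + x 0) ≤ 8 * l * V 0
  fall zero    _  = ≤-reflexive (+-identityʳ _)
  fall (suc s) le = begin
    8 * l * V (suc s) + suc s * (8 * l + x 0) ≡⟨ g₁ (8 * l) (V (suc s)) s (x 0) ⟩
    8 * l * V (suc s) + (8 * l + x 0) + s * (8 * l + x 0) ≤⟨ +-monoˡ-≤ (s * (8 * l + x 0)) drop ⟩
    8 * l * V s + s * (8 * l + x 0) ≤⟨ fall s (<⇒≤ le) ⟩
    8 * l * V 0 ∎
    where
    g₁ : ∀ u v s x → u * v + (1 + s) * (u + x) ≡ u * v + (u + x) + s * (u + x)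
    g₁ = solve-∀
    g₂ : ∀ K u v x → K * (u * v + (u + x)) ≡ K * x + u * (K + K * v)
    g₂ = solve-∀
    g₃ : ∀ u z y → u * z + u * y ≡ u * (z + y)
    g₃ = solve-∀
    drop : 8 * l * V (suc s) + (8 * l + x 0) ≤ 8 * l * V s
    drop = cancel-scaled K 1≤K (begin
      K * (8 * l * V (suc s) + (8 * l + x 0)) ≡⟨ g₂ K (8 * l) (V (suc s)) (x 0) ⟩
      K * x 0 + 8 * l * (K + K * V (suc s)) ≤⟨ +-monoˡ-≤ _ (Z-large (suc s) le) ⟩
      8 * l * Z (suc s) + 8 * l * (K + K * V (suc s)) ≡⟨ g₃ (8 * l) (Z (suc s)) _ ⟩
      8 * l * (Z (suc s) + (K + K * V (suc s))) ≡⟨ cong (8 * l *_) (sym (+-assoc (Z (suc s)) K _)) ⟩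
      8 * l * (Z (suc s) + K + K * V (suc s)) ≤⟨ *-monoʳ-≤ (8 * l) (hD s le) ⟩
      8 * l * (K * V s) ≡⟨ g₄ (8 * l) K (V s) ⟩
      K * (8 * l * V s) ∎)
      where
      g₄ : ∀ u K v → u * (K * v) ≡ K * (u * v)
      g₄ = solve-∀

-- Cuts

count-witness : ∀ {j} (p : Fin j → Bool) → 1 ≤ countFin p → ∃ λ i → p i ≡ true
count-witness {suc j} p le with p F.zero in eq
... | true  = F.zero , eq
... | false = let (i , pi) = count-witness (p ∘ F.suc) le in F.suc i , pi

count-≥2 : ∀ {j} {p : Fin j → Bool} x y → x ≢ y → p x ≡ true → p y ≡ true → 2 ≤ countFin p
count-≥2 {p = p} x y x≢y px py = begin
  2 ≡⟨ sym (cong₂ _+_ (sum-δ x) (sum-δ y)) ⟩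
  sumFin (λ i → ⟦ δ x i ⟧) + sumFin (λ i → ⟦ δ y i ⟧) ≡⟨ sym (sum-+ (λ i → ⟦ δ x i ⟧) (λ i → ⟦ δ y i ⟧)) ⟩
  sumFin (λ i → ⟦ δ x i ⟧ + ⟦ δ y i ⟧) ≤⟨ sum-mono pointwise ⟩
  countFin p ∎
  where
  open ≤-Reasoning
  pointwise : ∀ i → ⟦ δ x i ⟧ + ⟦ δ y i ⟧ ≤ ⟦ p i ⟧
  pointwise i with x F.≟ i | y F.≟ i
  ... | yes refl | yes refl = ⊥-elim (x≢y refl)
  ... | yes refl | no _ rewrite px = ≤-refl
  ... | no _ | yes refl rewrite py = ≤-refl
  ... | no _ | no _ = z≤n

wsum-uses : ∀ {j} (B : Fin j → Bool) (X : ℕ → Fin j → Bool) i →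
  wsum B (uses X i) ≡ psum (λ t → countFin (λ e → X t e ∧ B e)) i
wsum-uses {j} B X i = trans (sum-cong (λ e → trans (sym (psum-* ⟦ B e ⟧ (λ t → ⟦ X t e ⟧) i))
    (psum-cong i (λ t _ → trans (*-comm ⟦ B e ⟧ ⟦ X t e ⟧) (sym (⟦⟧-∧ (X t e) (B e)))))))
  (psum-sum (λ t e → ⟦ X t e ∧ B e ⟧) i)

wsum-mono : ∀ {j} (B : Fin j → Bool) {f g : Fin j → ℕ} → (∀ e → B e ≡ true → f e ≤ g e) → wsum B f ≤ wsum B g
wsum-mono B {f} {g} le = sum-mono pointwise
  where
  pointwise : ∀ e → ⟦ B e ⟧ * f e ≤ ⟦ B e ⟧ * g e
  pointwise e with B e in eq
  ... | true  = *-monoʳ-≤ 1 (le e eq)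
  ... | false = z≤n

wsum-linear : ∀ {j} (B : Fin j → Bool) b (f : Fin j → ℕ) c →
  wsum B (λ e → b * f e + c) ≡ b * wsum B f + c * countFin B
wsum-linear B b f c = trans (sum-cong (λ e → g ⟦ B e ⟧ b (f e) c))
  (trans (sum-+ (λ e → b * (⟦ B e ⟧ * f e)) (λ e → c * ⟦ B e ⟧))
    (cong₂ _+_ (sum-* b (λ e → ⟦ B e ⟧ * f e)) (sum-* c (λ e → ⟦ B e ⟧))))
  where
  g : ∀ x b f c → x * (b * f + c) ≡ b * (x * f) + c * x
  g = solve-∀

wsum-const : ∀ {j} (B : Fin j → Bool) c → wsum B (λ _ → c) ≡ c * countFin B
wsum-const B c = trans (sum-cong (λ e → *-comm ⟦ B e ⟧ c)) (sum-* c (λ e → ⟦ B e ⟧))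

wsum-scale : ∀ {j} (B : Fin j → Bool) c (f : Fin j → ℕ) → wsum B (λ e → c * f e) ≡ c * wsum B f
wsum-scale B c f = trans (wsum-cong B (λ e → sym (+-identityʳ (c * f e))))
  (trans (wsum-linear B c f 0) (+-identityʳ _))

module Cuts (G : Multigraph) where
  open Components G
  open SpanningTrees G

  xor-true : ∀ {p q} → p xor q ≡ true → (p ≡ true × q ≡ false) ⊎ (p ≡ false × q ≡ true)
  xor-true {true}  {false} eq = inj₁ (refl , refl)
  xor-true {false} {true}  eq = inj₂ (refl , refl)

  crossing-nontrivial : ∀ {S e} → crosses G S e ≡ true → Nontrivial G S
  crossing-nontrivial {S} {e} cr with xor-true {S (src e)} cr
  ... | inj₁ (p , q) = (src e , p) , (tgt e , q)
  ... | inj₂ (p , q) = (tgt e , q) , (src e , p)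

  path-crosses : ∀ {X S u v} → Reach G X u v → S u ≡ true → S v ≡ false →
    ∃ λ e → X e ∧ crosses G S e ≡ true
  path-crosses here Su Sv = ⊥-elim (true≢false Su Sv)
  path-crosses {S = S} (fwd e Xe refl p) Su Sv with S (tgt e) in eq
  ... | true  = path-crosses p eq Sv
  ... | false = e , ∧-intro Xe (trans (cong₂ _xor_ Su eq) refl)
  path-crosses {S = S} (bwd e Xe refl p) Su Sv with S (src e) in eq
  ... | true  = path-crosses p eq Sv
  ... | false = e , ∧-intro Xe (trans (cong₂ _xor_ eq Su) refl)

  crossCount-≥1 : ∀ {X S} → (∀ u v → Reach G X u v) → Nontrivial G S → 1 ≤ crossCount G X S
  crossCount-≥1 {X} {S} reach ((u , Su) , (v , Sv)) =
    let (e , cr) = path-crosses (reach u v) Su Sv in count-≥1 {p = λ i → X i ∧ crosses G S i} e cr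

  class : EdgeSet G → Fin (n G) → VertexSet G
  class A c v = δ (lab A v) c

  IsRoot : EdgeSet G → Fin (n G) → Bool
  IsRoot A c = δ (lab A c) c

  crossing-outside : ∀ A c e → crosses G (class A c) e ≡ true → A e ≡ false
  crossing-outside A c e cr with A e in eq
  ... | false = refl
  ... | true rewrite labels-respects (ends G) A e eq with δ (lab A (tgt e)) c
  ...   | true  = ⊥-elim (true≢false cr refl)
  ...   | false = ⊥-elim (true≢false cr refl)

  -- An edge outside a closed set has its ends in two different classes and lies on the boundary of
  -- both; an edge inside lies on none.
  class-boundaries : ∀ A e → (Joined A e → A e ≡ true) →
    sumFin (λ c → ⟦ crosses G (class A c) e ⟧) ≡ 2 * ⟦ ∁ A e ⟧
  class-boundaries A e closed with joined? A e
  ... | yes je rewrite closed je = trans (sum-cong pointwise) (sum-0 (n G))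
    where
    pointwise : ∀ c → ⟦ crosses G (class A c) e ⟧ ≡ 0
    pointwise c rewrite je with δ (lab A (tgt e)) c
    ... | true  = refl
    ... | false = refl
  ... | no ¬je with A e in eq
  ...   | true  = ⊥-elim (¬je (labels-respects (ends G) A e eq))
  ...   | false = trans (sum-cong pointwise) (trans (sum-+ (λ c → ⟦ δ (lab A (src e)) c ⟧) (λ c → ⟦ δ (lab A (tgt e)) c ⟧))
          (cong₂ _+_ (sum-δ (lab A (src e))) (sum-δ (lab A (tgt e)))))
    where
    pointwise : ∀ c → ⟦ crosses G (class A c) e ⟧ ≡ ⟦ δ (lab A (src e)) c ⟧ + ⟦ δ (lab A (tgt e)) c ⟧
    pointwise c with lab A (src e) F.≟ c | lab A (tgt e) F.≟ c
    ... | yes p | yes q = ⊥-elim (¬je (trans p (sym q)))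
    ... | yes _ | no _ = refl
    ... | no _ | yes _ = refl
    ... | no _ | no _ = refl

  class-sum : ∀ A → (∀ e → Joined A e → A e ≡ true) → (y : Fin (m G) → ℕ) →
    sumFin (λ c → wsum (crosses G (class A c)) y) ≡ 2 * wsum (∁ A) y
  class-sum A closed y = trans (sum-swap (λ c e → ⟦ crosses G (class A c) e ⟧ * y e))
    (trans (sum-cong pointwise) (sum-* 2 (λ e → ⟦ ∁ A e ⟧ * y e)))
    where
    pointwise : ∀ e → sumFin (λ c → ⟦ crosses G (class A c) e ⟧ * y e) ≡ 2 * (⟦ ∁ A e ⟧ * y e)
    pointwise e = trans (sum-cong (λ c → *-comm ⟦ crosses G (class A c) e ⟧ (y e)))
      (trans (sum-* (y e) (λ c → ⟦ crosses G (class A c) e ⟧))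
      (trans (cong (y e *_) (class-boundaries A e (closed e))) (g (y e) ⟦ ∁ A e ⟧)))
      where
      g : ∀ y x → y * (2 * x) ≡ 2 * (x * y)
      g = solve-∀

  class-degrees : ∀ A → (∀ e → Joined A e → A e ≡ true) →
    sumFin (λ c → cutSize G (class A c)) ≡ 2 * ∣ ∁ A ∣
  class-degrees A closed = trans (sum-cong (λ c → sym (unit (crosses G (class A c)))))
    (trans (class-sum A closed (λ _ → 1)) (cong (2 *_) (unit (∁ A))))
    where
    unit : ∀ (B : EdgeSet G) → wsum B (λ _ → 1) ≡ ∣ B ∣
    unit B = trans (wsum-const B 1) (+-identityʳ ∣ B ∣)

  nonroot-cut : ∀ A c → IsRoot A c ≡ false → cutSize G (class A c) ≡ 0
  nonroot-cut A c nr = trans (sum-cong (λ e → cong₂ (λ p q → ⟦ p xor q ⟧) (empty (src e)) (empty (tgt e)))) (sum-0 (m G))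
    where
    empty : ∀ v → class A c v ≡ false
    empty v = δ-≢ {i = lab A v} {c} λ eq → true≢false
      (trans (cong (λ x → δ x c) (trans (cong (lab A) (sym eq)) (trans (lab-idem A v) eq))) (δ-refl c)) nr

  -- The sum may run over all vertices, since those that are not roots index empty classes. Free
  -- coefficients let one summation serve both the degrees and the loads.
  class-inequality : ∀ A → (∀ e → Joined A e → A e ≡ true) → ∀ α β γ (y : Fin (m G) → ℕ) →
    (∀ c → IsRoot A c ≡ true →
      γ + β * cutSize G (class A c) ≤ α * wsum (crosses G (class A c)) y) →
    γ * κ A + β * (2 * ∣ ∁ A ∣) ≤ α * (2 * wsum (∁ A) y)
  class-inequality A closed α β γ y bound = begin
    γ * κ A + β * (2 * ∣ ∁ A ∣) ≡⟨ cong₂ _+_ (sym (sum-* γ (λ c → ⟦ IsRoot A c ⟧)))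
        (trans (cong (β *_) (sym (class-degrees A closed))) (sym (sum-* β (λ c → cutSize G (class A c))))) ⟩
    sumFin (λ c → γ * ⟦ IsRoot A c ⟧) + sumFin (λ c → β * cutSize G (class A c))
      ≡⟨ sym (sum-+ (λ c → γ * ⟦ IsRoot A c ⟧) (λ c → β * cutSize G (class A c))) ⟩
    sumFin (λ c → γ * ⟦ IsRoot A c ⟧ + β * cutSize G (class A c)) ≤⟨ sum-mono pointwise ⟩
    sumFin (λ c → α * wsum (crosses G (class A c)) y) ≡⟨ sum-* α (λ c → wsum (crosses G (class A c)) y) ⟩
    α * sumFin (λ c → wsum (crosses G (class A c)) y) ≡⟨ cong (α *_) (class-sum A closed y) ⟩
    α * (2 * wsum (∁ A) y) ∎
    where
    open ≤-Reasoning
    pointwise : ∀ c → γ * ⟦ IsRoot A c ⟧ + β * cutSize G (class A c) ≤ α * wsum (crosses G (class A c)) y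
    pointwise c with IsRoot A c in eq
    ... | true  rewrite *-identityʳ γ = bound c eq
    ... | false rewrite nonroot-cut A c eq | *-zeroʳ γ | *-zeroʳ β = z≤n

  κ-≤1-joined : ∀ A → κ A ≤ 1 → ∀ e → Joined A e
  κ-≤1-joined A κ≤1 e with joined? A e
  ... | yes je = je
  ... | no ¬je = ⊥-elim (<⇒≱ (count-≥2 {p = IsRoot A} (lab A (src e)) (lab A (tgt e)) ¬je (root (src e)) (root (tgt e))) κ≤1)
    where
    root : ∀ v → IsRoot A (lab A v) ≡ true
    root v = trans (cong (λ x → δ x (lab A v)) (lab-idem A v)) (δ-refl (lab A v))

  root-nontrivial : ∀ A c → 2 ≤ κ A → IsRoot A c ≡ true → Nontrivial G (class A c)
  root-nontrivial A c 2≤κ rc with FP.any? (λ v → class A c v ≟ᵇ false)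
  ... | yes other = (c , rc) , other
  ... | no ¬other = ⊥-elim (<⇒≱ 2≤κ (≤-reflexive (κ-connected A c (λ v → in-class v))))
    where
    in-class : ∀ v → lab A v ≡ c
    in-class v with class A c v in eq
    ... | true  = δ-sound {i = lab A v} {c} eq
    ... | false = ⊥-elim (¬other (v , eq))

-- Constraints on the constants and comparison of consecutive levels

record Scales (l K W : ℕ) : Set where
  field
    b q a₀ : ℕ
    1≤b    : 1 ≤ b
    3≤q    : 3 ≤ q
    1≤a₀   : 1 ≤ a₀
    4a≤q   : 4 * (32 * l + a₀) ≤ q
    -- The top numerator is 32l + a₀, and this puts its ratio to b exactly 64l/b below 2/l.
    2b     : 2 * b ≡ (32 * l + a₀) * l + 64 * (l * l)
    a≤     : 32 * l + a₀ ≤ 256 * (l * l)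
    ≤a     : 160 * (l * l) ≤ a₀
    8b     : l * (4 * (32 * l + a₀) + 2) < 8 * b
    large  : ∀ d load → l < d → d * (a₀ * K) ≤ b * load + 5 * (d * K) →
             3 * l * K + K * d ≤ 2 * l * load

-- The higher level is tested against the lower one. With 2M = lV + x and the value of 2b, the terms
-- a l V cancel and 64l²(V - V′) ≤ a(x - x′) remains; the distance u to the top level only helps.
-- The factor 4 is 256/64.
rank-step : ∀ l a u b V V′ M M′ x x′ → 1 ≤ a → 1 ≤ l → a + u ≤ 256 * (l * l) → V′ ≤ V →
  2 * b ≡ (a + u) * l + 64 * (l * l) → l * V + x ≡ 2 * M → l * V′ + x′ ≡ 2 * M′ →
  a * M′ + b * V ≤ a * M + b * V′ → V + 4 * x′ ≤ V′ + 4 * x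
rank-step l a u b V V′ M M′ x x′ 1≤a 1≤l a≤ V′≤V 2b eM eM′ opt = begin
  V + 4 * x′ ≡⟨ cong (_+ 4 * x′) (sym (m+[n∸m]≡n V′≤V)) ⟩
  V′ + D + 4 * x′ ≤⟨ +-monoˡ-≤ (4 * x′) (+-monoʳ-≤ V′ D≤4ε) ⟩
  V′ + 4 * ε + 4 * x′ ≡⟨ e₃ V′ ε x′ ⟩
  V′ + 4 * (x′ + ε) ≡⟨ cong (λ z → V′ + 4 * z) (m+[n∸m]≡n x′≤x) ⟩
  V′ + 4 * x ∎
  where
  open ≤-Reasoning
  e₁ : ∀ l a u V V′ x′ → a * (l * V′ + x′) + ((a + u) * l + 64 * (l * l)) * V ≡
    a * x′ + 64 * (l * l) * V + (a * l * V′ + a * l * V + u * l * V)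
  e₁ = solve-∀
  e₀ : ∀ a b M V → 2 * (a * M + b * V) ≡ a * (2 * M) + 2 * b * V
  e₀ = solve-∀
  scaled : a * x′ + 64 * (l * l) * V ≤ a * x + 64 * (l * l) * V′
  scaled = +-cancelʳ-≤ (a * l * V′ + a * l * V + u * l * V) _ _ (begin
    a * x′ + 64 * (l * l) * V + (a * l * V′ + a * l * V + u * l * V) ≡⟨ sym (e₁ l a u V V′ x′) ⟩
    a * (l * V′ + x′) + ((a + u) * l + 64 * (l * l)) * V ≡⟨ cong₂ (λ y z → a * y + z * V) eM′ (sym 2b) ⟩
    a * (2 * M′) + 2 * b * V ≡⟨ sym (e₀ a b M′ V) ⟩
    2 * (a * M′ + b * V) ≤⟨ *-monoʳ-≤ 2 opt ⟩
    2 * (a * M + b * V′) ≡⟨ e₀ a b M V′ ⟩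
    a * (2 * M) + 2 * b * V′ ≡⟨ cong₂ (λ y z → a * y + z * V′) (sym eM) 2b ⟩
    a * (l * V + x) + ((a + u) * l + 64 * (l * l)) * V′ ≡⟨ e₁ l a u V′ V x ⟩
    a * x + 64 * (l * l) * V′ + (a * l * V + a * l * V′ + u * l * V′)
      ≤⟨ +-monoʳ-≤ (a * x + 64 * (l * l) * V′) (+-mono-≤ (≤-reflexive (+-comm (a * l * V) (a * l * V′))) (*-monoʳ-≤ (u * l) V′≤V)) ⟩
    a * x + 64 * (l * l) * V′ + (a * l * V′ + a * l * V + u * l * V) ∎)
  x′≤x : x′ ≤ x
  x′≤x = cancel-scaled a 1≤a (+-cancelʳ-≤ (64 * (l * l) * V′) _ _
    (≤-trans (+-monoʳ-≤ (a * x′) (*-monoʳ-≤ (64 * (l * l)) V′≤V)) scaled))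
  D = V ∸ V′
  ε = x ∸ x′
  e₂ : ∀ a x′ c V′ D → a * x′ + c * (V′ + D) ≡ a * x′ + c * V′ + c * D
  e₂ = solve-∀
  e₄ : ∀ a x′ ε y → a * (x′ + ε) + y ≡ a * x′ + y + a * ε
  e₄ = solve-∀
  e₃ : ∀ v ε x → v + 4 * ε + 4 * x ≡ v + 4 * (x + ε)
  e₃ = solve-∀
  e₅ : ∀ l ε → 256 * (l * l) * ε ≡ 64 * (l * l) * (4 * ε)
  e₅ = solve-∀
  D≤4ε : D ≤ 4 * ε
  D≤4ε = cancel-scaled (64 * (l * l)) (*-mono-≤ {1} {64} (s≤s z≤n) (*-mono-≤ 1≤l 1≤l)) (begin
    64 * (l * l) * D ≤⟨ +-cancelˡ-≤ (a * x′ + 64 * (l * l) * V′) _ _ (begin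
      a * x′ + 64 * (l * l) * V′ + 64 * (l * l) * D ≡⟨ sym (e₂ a x′ (64 * (l * l)) V′ D) ⟩
      a * x′ + 64 * (l * l) * (V′ + D) ≡⟨ cong (λ z → a * x′ + 64 * (l * l) * z) (m+[n∸m]≡n V′≤V) ⟩
      a * x′ + 64 * (l * l) * V ≤⟨ scaled ⟩
      a * x + 64 * (l * l) * V′ ≡⟨ cong (λ z → a * z + 64 * (l * l) * V′) (sym (m+[n∸m]≡n x′≤x)) ⟩
      a * (x′ + ε) + 64 * (l * l) * V′ ≡⟨ e₄ a x′ ε (64 * (l * l) * V′) ⟩
      a * x′ + 64 * (l * l) * V′ + a * ε ∎) ⟩
    a * ε ≤⟨ *-monoˡ-≤ ε (≤-trans (m≤m+n a u) a≤) ⟩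
    256 * (l * l) * ε ≡⟨ e₅ l ε ⟩
    64 * (l * l) * (4 * ε) ∎)

-- The lower level is tested against the higher one, which gives a·mid ≤ b(V - V′). At a load of at
-- most (a + 3)K/b each, the middle edges carry at most (1 + 3/a)K(V - V′), while KV itself falls by
-- K(V - V′). Only 3K(V - V′)/a is left for the loss of Z.
load-step : ∀ a b c K V V′ M M′ mid Y Y′ ymid Z Z′ → 1 ≤ b → c ≤ a → V′ ≤ V →
  M ≡ M′ + mid → Y ≡ Y′ + ymid → K * V + Z ≡ Y → K * V′ + Z′ ≡ Y′ →
  a * M + b * V′ ≤ a * M′ + b * V → b * ymid ≤ (a + 3) * K * mid →
  c * Z + 3 * K * V′ ≤ c * Z′ + 3 * K * V
load-step a b c K V V′ _ M′ mid _ _ ymid Z Z′ 1≤b c≤a V′≤V refl refl eZ refl opt hy = by-cases (≤-total Z Z′)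
  where
  open ≤-Reasoning
  f₁ : ∀ a M m z → a * (M + m) + z ≡ a * M + (a * m + z)
  f₁ = solve-∀
  mid-bound : a * mid + b * V′ ≤ b * V
  mid-bound = +-cancelˡ-≤ (a * M′) _ _ (≤-trans (≤-reflexive (sym (f₁ a M′ mid (b * V′)))) opt)
  f₂ : ∀ a b K V y → b * (a * y + (a + 3) * K * V) ≡ a * (b * y) + (a + 3) * K * (b * V)
  f₂ = solve-∀
  f₃ : ∀ a K m w → a * ((a + 3) * K * m) + (a + 3) * K * w ≡ (a + 3) * K * (a * m + w)
  f₃ = solve-∀
  f₄ : ∀ a b K V → (a + 3) * K * (b * V) ≡ b * ((a + 3) * K * V)
  f₄ = solve-∀
  y-bound : a * ymid + (a + 3) * K * V′ ≤ (a + 3) * K * V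
  y-bound = cancel-scaled b 1≤b (begin
    b * (a * ymid + (a + 3) * K * V′) ≡⟨ f₂ a b K V′ ymid ⟩
    a * (b * ymid) + (a + 3) * K * (b * V′) ≤⟨ +-monoˡ-≤ _ (*-monoʳ-≤ a hy) ⟩
    a * ((a + 3) * K * mid) + (a + 3) * K * (b * V′) ≡⟨ f₃ a K mid (b * V′) ⟩
    (a + 3) * K * (a * mid + b * V′) ≤⟨ *-monoʳ-≤ ((a + 3) * K) mid-bound ⟩
    (a + 3) * K * (b * V) ≡⟨ f₄ a b K V ⟩
    b * ((a + 3) * K * V) ∎)
  f₅ : ∀ a K V V′ Z → a * Z + 3 * K * V′ + (a * K * V + a * K * V′) ≡ a * (K * V + Z) + (a + 3) * K * V′
  f₅ = solve-∀
  f₆ : ∀ a K V′ Z′ y x → a * (K * V′ + Z′ + y) + x ≡ a * (K * V′ + Z′) + (a * y + x)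
  f₆ = solve-∀
  f₇ : ∀ a K V V′ Z′ → a * (K * V′ + Z′) + (a + 3) * K * V ≡ a * Z′ + 3 * K * V + (a * K * V + a * K * V′)
  f₇ = solve-∀
  Z-bound : a * Z + 3 * K * V′ ≤ a * Z′ + 3 * K * V
  Z-bound = +-cancelʳ-≤ (a * K * V + a * K * V′) _ _ (begin
    a * Z + 3 * K * V′ + (a * K * V + a * K * V′) ≡⟨ f₅ a K V V′ Z ⟩
    a * (K * V + Z) + (a + 3) * K * V′ ≡⟨ cong (λ z → a * z + (a + 3) * K * V′) eZ ⟩
    a * (K * V′ + Z′ + ymid) + (a + 3) * K * V′ ≡⟨ f₆ a K V′ Z′ ymid _ ⟩
    a * (K * V′ + Z′) + (a * ymid + (a + 3) * K * V′) ≤⟨ +-monoʳ-≤ (a * (K * V′ + Z′)) y-bound ⟩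
    a * (K * V′ + Z′) + (a + 3) * K * V ≡⟨ f₇ a K V V′ Z′ ⟩
    a * Z′ + 3 * K * V + (a * K * V + a * K * V′) ∎)
  f₈ : ∀ a z ζ v → a * (z + ζ) + v ≡ a * z + (a * ζ + v)
  f₈ = solve-∀
  -- Replacing a by the smaller c weakens the bound only when Z does not increase; when it does not
  -- decrease, both summands compare directly.
  by-cases : Z ≤ Z′ ⊎ Z′ ≤ Z → c * Z + 3 * K * V′ ≤ c * Z′ + 3 * K * V
  by-cases (inj₁ Z≤Z′) = +-mono-≤ (*-monoʳ-≤ c Z≤Z′) (*-monoʳ-≤ (3 * K) V′≤V)
  by-cases (inj₂ Z′≤Z) = begin
    c * Z + 3 * K * V′ ≡⟨ cong (λ z → c * z + 3 * K * V′) (sym split) ⟩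
    c * (Z′ + ζ) + 3 * K * V′ ≡⟨ f₈ c Z′ ζ _ ⟩
    c * Z′ + (c * ζ + 3 * K * V′) ≤⟨ +-monoʳ-≤ (c * Z′) (+-monoˡ-≤ (3 * K * V′) (*-monoˡ-≤ ζ c≤a)) ⟩
    c * Z′ + (a * ζ + 3 * K * V′) ≤⟨ +-monoʳ-≤ (c * Z′) (+-cancelˡ-≤ (a * Z′) _ _ (begin
      a * Z′ + (a * ζ + 3 * K * V′) ≡⟨ sym (f₈ a Z′ ζ _) ⟩
      a * (Z′ + ζ) + 3 * K * V′ ≡⟨ cong (λ z → a * z + 3 * K * V′) split ⟩
      a * Z + 3 * K * V′ ≤⟨ Z-bound ⟩
      a * Z′ + 3 * K * V ∎)) ⟩
    c * Z′ + 3 * K * V ∎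
    where
    ζ = Z ∸ Z′
    split = m+[n∸m]≡n Z′≤Z

floor-threshold : ∀ c X → 1 ≤ c → ∃ λ d → (∀ w → c * w ≤ X → w ≤ d) × (∀ w → w ≤ d → c * w ≤ X)
floor-threshold (suc c) X _ = X / suc c ,
  (λ w h → ≤-trans (≤-reflexive (sym (m*n/n≡m w (suc c))))
    (/-monoˡ-≤ (suc c) (≤-trans (≤-reflexive (*-comm w (suc c))) h))) ,
  (λ w h → ≤-trans (*-monoʳ-≤ (suc c) h) (≤-trans (≤-reflexive (*-comm (suc c) (X / suc c))) (m/n*n≤m X (suc c))))

psum-suc-≤ : ∀ {f : ℕ → ℕ} {c} k → (∀ t → t < k → suc (f t) ≤ c) → psum f k + k ≤ k * c
psum-suc-≤ zero    le = z≤n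
psum-suc-≤ {f} {c} (suc k) le = ≤-trans (≤-reflexive (e (psum f k) (f k) k))
  (+-mono-≤ (le k ≤-refl) (psum-suc-≤ k (λ t lt → le t (m≤n⇒m≤1+n lt))))
  where
  e : ∀ p f k → p + f + (1 + k) ≡ 1 + f + (p + k)
  e = solve-∀

-- The density argument

module Descent (G : Multigraph) (l K : ℕ) (1≤l : 1 ≤ l)
  (min-cut : VertexSet G) (min-cut-size : cutSize G min-cut ≡ l) (min-cut-nontrivial : Nontrivial G min-cut)
  (connectivity : ∀ S → Nontrivial G S → l ≤ cutSize G S)
  (W : ℕ) (scales : Scales l K W) (W-def : W ≡ Scales.q scales * ⌈log₂ m G ⌉ * Scales.b scales)
  (1≤W : 1 ≤ W) (8W≤K : 8 * W ≤ K) (T : ℕ → EdgeSet G)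
  (greedy : ∀ i → i < 8 * W + K → IsMinSpanningTree G (uses T i) (T i))
  (crossed-twice : ∀ i → i < 8 * W + K → ∀ S → Nontrivial G S → cutSize G S ≡ l → 2 ≤ crossCount G (T i) S)
  where
  open Components G
  open SpanningTrees G
  open OptimalSets G
  open Cuts G
  open Scales scales
  open Loads G (8 * W + K) T greedy
  open ≤-Reasoning

  h k r : ℕ
  -- Before this round the additive error W can hide the distance between consecutive levels;
  -- `separation-estimate` holds from here on.
  h = 8 * W
  k = h + K
  r = 32 * l

  1≤q : 1 ≤ q
  1≤q = ≤-trans (s≤s z≤n) 3≤q

  1≤K : 1 ≤ K
  1≤K = ≤-trans 1≤W (≤-trans (m≤m+n W (7 * W)) 8W≤K)

  a : ℕ → ℕ
  a s = s + a₀

  a-top : ∀ {s} → s ≤ r → a s ≤ 32 * l + a₀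
  a-top = +-monoˡ-≤ a₀

  A : ℕ → EdgeSet G
  A s = proj₁ (optimal-exists (a s) b)

  opt : ∀ s → Optimal (a s) b (A s)
  opt s = proj₂ (optimal-exists (a s) b)

  closed : ∀ s e → Joined (A s) e → A s e ≡ true
  closed s = optimal-closed {a s} {b} {A s} (opt s) (≤-trans 1≤a₀ (m≤n+m a₀ s))

  late : ℕ → EdgeSet G
  late t = T (h + t)

  y : Fin (m G) → ℕ
  y = uses late K

  uses-late : ∀ e → uses T k e ≡ uses T h e + y e
  uses-late e = psum-+ (λ t → ⟦ T t e ⟧) h K

  inside : ∀ {s} → s ≤ r → ∀ i → i ≤ k → ∀ e → A s e ≡ true →
    4 * (b * uses T i e) ≤ 4 * (a s * i) + i + 4 * W
  inside {s} s≤r i i≤k e Ae = subst (λ z → 4 * (b * uses T i e) ≤ 4 * (a s * i) + i + 4 * z) (sym W-def)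
    (inside-estimate b q (a s) i (uses T i e) _ 1≤q (≤-trans (*-monoʳ-≤ 4 (a-top s≤r)) 4a≤q)
      (load-inside {a s} {b} {q} {A s} 1≤b 1≤q (opt s) i i≤k e Ae))

  outside : ∀ {s} → s ≤ r → ∀ i → i ≤ k → ∀ e → A s e ≡ false →
    4 * (a s * i) ≤ 4 * (b * uses T i e) + 4 * W + i
  outside {s} s≤r i i≤k e Ae = subst (λ z → 4 * (a s * i) ≤ 4 * (b * uses T i e) + 4 * z + i) (sym W-def)
    (outside-estimate b q (a s) i (uses T i e) _ (≤-trans (*-monoʳ-≤ 4 (a-top s≤r)) 4a≤q)
      (load-outside {a s} {b} {q} {A s} 1≤b 1≤q (opt s) i i≤k e Ae))

  W≤K : W ≤ K
  W≤K = ≤-trans (m≤m+n W (7 * W)) 8W≤K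

  -- Climb to the level at which e enters the optimal set; it exists since a s ≤ b while e is outside.
  late-outside : ∀ s e → A s e ≡ false → a₀ * K ≤ b * y e + 5 * K
  late-outside s e = climb (suc b) s (≤-trans (m≤n+m (suc b) (a s)) ≤-refl)
    where
    climb : ∀ fuel s → b < a s + fuel → A s e ≡ false → a₀ * K ≤ b * y e + 5 * K
    climb zero s b< Ae = ⊥-elim (<⇒≱ b< (≤-trans (≤-reflexive (+-identityʳ (a s)))
      (optimal-bound {a s} {b} {A s} (opt s) e Ae)))
    climb (suc fuel) s b< Ae with A (suc s) e in A′e
    ... | false = climb fuel (suc s) (≤-trans b< (≤-reflexive (+-suc (a s) fuel))) A′e
    ... | true = late-estimate b q a₀ s h K (uses T h e) (y e) ⌈log₂ m G ⌉ 3≤q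
            (≤-trans (*-monoʳ-≤ 4 (m≤n+m a₀ (32 * l))) 4a≤q)
            (≤-trans (≤-reflexive (sym W-def)) W≤K) 8W≤K
            (subst (λ z → q * a s * k ≤ (z + q * ⌈log₂ m G ⌉) * (b * (1 + q))) (uses-late e)
              (load-outside {a s} {b} {q} {A s} 1≤b 1≤q (opt s) k ≤-refl e Ae))
            (load-inside {a (suc s)} {b} {q} {A (suc s)} 1≤b 1≤q (opt (suc s)) h (m≤m+n h K) e A′e)

  late-middle : ∀ {s} → s < r → ∀ e → A (suc s) e ≡ true → A s e ≡ false → b * y e ≤ (a s + 3) * K
  late-middle {s} s<r e A′e Ae = middle-estimate b (a s) h K (uses T h e) (y e) W 8W≤K ≤-refl
    (subst (λ z → 4 * (b * z) ≤ 4 * ((1 + a s) * k) + k + 4 * W) (uses-late e) (inside s<r k ≤-refl e A′e))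
    (outside (<⇒≤ s<r) h (m≤m+n h K) e Ae)

  -- Minimum spanning trees are controlled on threshold sets of the current loads, not on the
  -- optimal sets. A threshold set between `A s` and `A (suc s)` carries that control over; as loads
  -- are integers, σ is one more than a rounded quotient.
  separate : ∀ {s} → s < r → ∀ i → h ≤ i → i ≤ k → ∃ λ σ →
    (∀ e → A s e ≡ true → uses T i e < σ) × (∀ e → uses T i e < σ → A (suc s) e ≡ true)
  separate {s} s<r i h≤i i≤k = suc (proj₁ floor) ,
    (λ e Ae → s≤s (proj₁ (proj₂ floor) (uses T i e) (≤-trans (≤-reflexive (*-assoc 4 b (uses T i e))) (inside (<⇒≤ s<r) i i≤k e Ae)))) ,
    below-inside
    where
    floor = floor-threshold (4 * b) (4 * (a s * i) + i + 4 * W) (*-mono-≤ {1} {4} (s≤s z≤n) 1≤b)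
    below-inside : ∀ e → uses T i e < suc (proj₁ floor) → A (suc s) e ≡ true
    below-inside e lt with A (suc s) e in A′e
    ... | true  = refl
    ... | false = ⊥-elim (<⇒≱ (separation-estimate (a s) i (b * uses T i e) W
            (≤-trans 1≤W (≤-trans (m≤m+n W (7 * W)) h≤i)) h≤i (outside s<r i i≤k e A′e))
          (≤-trans (≤-reflexive (sym (*-assoc 4 b (uses T i e)))) (proj₂ (proj₂ floor) (uses T i e) (≤-pred lt))))

  nested : ∀ {s} → s < r → ∀ e → A s e ≡ true → A (suc s) e ≡ true
  nested s<r e Ae = let (σ , low , high) = separate s<r h ≤-refl (m≤m+n h K) in high e (low e Ae)

  V M x Y Z : ℕ → ℕ
  V s = κ (A s)
  M s = ∣ ∁ (A s) ∣
  x s = 2 * M s ∸ l * V s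
  Y s = wsum (∁ (A s)) y
  Z s = Y s ∸ K * V s

  V-anti : ∀ {s} → s < r → V (suc s) ≤ V s
  V-anti {s} s<r = κ-anti {A s} {A (suc s)} (⊆-spans (nested s<r))

  -- The tree has n - κ (`below σ`) ≥ n - V s edges of load below σ, and all of them lie in
  -- `A (suc s)`. Of its n - 1 edges at most V s - 1 remain.
  late-uses-few : ∀ {s} → s < r → ∀ t → t < K → suc ∣ late t ∖ A (suc s) ∣ ≤ V s
  late-uses-few {s} s<r t t<K = +-cancelʳ-≤ ∣ late t ∩ A (suc s) ∣ _ _ (begin
    suc ∣ late t ∖ A (suc s) ∣ + ∣ late t ∩ A (suc s) ∣ ≡⟨ cong suc (+-comm ∣ late t ∖ A (suc s) ∣ _) ⟩
    suc (∣ late t ∩ A (suc s) ∣ + ∣ late t ∖ A (suc s) ∣) ≡⟨ cong suc (sym (count-split (late t) (A (suc s)))) ⟩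
    suc ∣ late t ∣ ≡⟨ proj₁ (proj₁ mst) ⟩
    n G ≡⟨ sym (count-below σ) ⟩
    κ (below σ) + ∣ late t ∩ below σ ∣ ≤⟨ +-mono-≤
        (κ-anti {A s} {below σ} (⊆-spans (λ e Ae → <ᵇ-intro (low e Ae))))
        (count-mono {p = late t ∩ below σ} {late t ∩ A (suc s)} (λ e h → ∧-intro (proj₁ (∧-true {late t e} h))
          (high e (<ᵇ-true {_} {σ} (proj₂ (∧-true {late t e} h)))))) ⟩
    V s + ∣ late t ∩ A (suc s) ∣ ∎)
    where
    mst = greedy (h + t) (+-monoʳ-< h t<K)
    open MinTree mst
    separation = separate s<r (h + t) (m≤m+n h t) (<⇒≤ (+-monoʳ-< h t<K))
    σ = proj₁ separation
    low = proj₁ (proj₂ separation)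
    high = proj₂ (proj₂ separation)

  tree-sum : ∀ {s} → s < r → Y (suc s) + K ≤ K * V s
  tree-sum {s} s<r = ≤-trans (≤-reflexive (cong (_+ K) (wsum-uses (∁ (A (suc s))) late K)))
    (psum-suc-≤ K (late-uses-few s<r))

  -- With a single class all edges would belong to the closed set `A s` and obey its load bound. As
  -- the ratios stay below 2/l, the minimum cut would carry a load below 2k, although each of the k
  -- trees crosses it twice.
  V≥2 : ∀ {s} → s ≤ r → 2 ≤ V s
  V≥2 {s} s≤r with 2 ≤? V s
  ... | yes le = le
  ... | no ¬le = ⊥-elim (<⇒≱ 8b (*-cancel k 1≤k (begin
    8 * b * k ≡⟨ e₁ b k ⟩
    4 * b * (k * 2) ≤⟨ *-monoʳ-≤ (4 * b) (psum-≥ k (λ i i<k → crossed-twice i i<k min-cut min-cut-nontrivial min-cut-size)) ⟩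
    4 * b * psum (λ i → crossCount G (T i) min-cut) k ≡⟨ cong (4 * b *_) (sym (wsum-uses cr T k)) ⟩
    4 * b * wsum cr (uses T k) ≡⟨ sym (wsum-scale cr (4 * b) (uses T k)) ⟩
    wsum cr (λ e → 4 * b * uses T k e) ≤⟨ wsum-mono cr (λ e _ → bounded e) ⟩
    wsum cr (λ _ → (4 * (32 * l + a₀) + 2) * k) ≡⟨ wsum-const cr _ ⟩
    (4 * (32 * l + a₀) + 2) * k * cutSize G min-cut ≡⟨ cong ((4 * (32 * l + a₀) + 2) * k *_) min-cut-size ⟩
    (4 * (32 * l + a₀) + 2) * k * l ≡⟨ e₂ (4 * (32 * l + a₀) + 2) k l ⟩
    l * (4 * (32 * l + a₀) + 2) * k ∎)))
    where
    cr = crosses G min-cut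
    1≤k : 1 ≤ k
    1≤k = ≤-trans 1≤K (m≤n+m K h)
    e₁ : ∀ b k → 8 * b * k ≡ 4 * b * (k * 2)
    e₁ = solve-∀
    e₂ : ∀ z k l → z * k * l ≡ l * z * k
    e₂ = solve-∀
    e₃ : ∀ z k → 4 * (z * k) + k + k ≡ (4 * z + 2) * k
    e₃ = solve-∀
    4W≤k : 4 * W ≤ k
    4W≤k = ≤-trans (*-monoˡ-≤ W (m≤m+n 4 4)) (m≤m+n h K)
    bounded : ∀ e → 4 * b * uses T k e ≤ (4 * (32 * l + a₀) + 2) * k
    bounded e = begin
      4 * b * uses T k e ≡⟨ *-assoc 4 b (uses T k e) ⟩
      4 * (b * uses T k e) ≤⟨ inside s≤r k ≤-refl e (closed s e (κ-≤1-joined (A s) (≤-pred (≰⇒> ¬le)) e)) ⟩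
      4 * (a s * k) + k + 4 * W ≤⟨ +-mono-≤ (+-monoˡ-≤ k (*-monoʳ-≤ 4 (*-monoˡ-≤ k (a-top s≤r)))) 4W≤k ⟩
      4 * ((32 * l + a₀) * k) + k + k ≡⟨ e₃ (32 * l + a₀) k ⟩
      (4 * (32 * l + a₀) + 2) * k ∎

  class-degree : ∀ {s} → s ≤ r → ∀ c → IsRoot (A s) c ≡ true → l ≤ cutSize G (class (A s) c)
  class-degree {s} s≤r c rc = connectivity _ (root-nontrivial (A s) c (V≥2 s≤r) rc)

  degree-sum : ∀ {s} → s ≤ r → l * V s ≤ 2 * M s
  degree-sum {s} s≤r = begin
    l * V s ≤⟨ m≤m+n (l * V s) _ ⟩
    l * V s + 0 * (2 * M s) ≤⟨ class-inequality (A s) (closed s) 1 0 l (λ _ → 1) (λ c rc → begin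
      l + 0 ≡⟨ +-identityʳ l ⟩
      l ≤⟨ class-degree s≤r c rc ⟩
      cutSize G (class (A s) c) ≡⟨ sym (unit (crosses G (class (A s) c))) ⟩
      1 * wsum (crosses G (class (A s) c)) (λ _ → 1) ∎) ⟩
    1 * (2 * wsum (∁ (A s)) (λ _ → 1)) ≡⟨ trans (*-identityˡ _) (cong (2 *_) (trans (wsum-const (∁ (A s)) 1) (*-identityˡ (M s)))) ⟩
    2 * M s ∎
    where
    unit : ∀ (B : EdgeSet G) → 1 * wsum B (λ _ → 1) ≡ ∣ B ∣
    unit B = trans (*-identityˡ _) (trans (wsum-const B 1) (*-identityˡ ∣ B ∣))

  -- For degree l the class is a minimum cut, and double crossing meets the target exactly; for
  -- larger degree the boundary lies outside `A s`, where every edge has a large late load.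
  class-load : ∀ {s} → s ≤ r → ∀ c → IsRoot (A s) c ≡ true →
    3 * l * K + K * cutSize G (class (A s) c) ≤ 2 * l * wsum (crosses G (class (A s) c)) y
  class-load {s} s≤r c rc = by-degree (m≤n⇒m<n∨m≡n (class-degree s≤r c rc))
    where
    S = class (A s) c
    cr = crosses G S
    d = cutSize G S
    e₁ : ∀ l K → 3 * l * K + K * l ≡ 2 * l * (K * 2)
    e₁ = solve-∀
    e₂ : ∀ d z → d * z ≡ z * d
    e₂ = solve-∀
    e₃ : ∀ K d → 5 * K * d ≡ 5 * (d * K)
    e₃ = solve-∀
    by-degree : l < d ⊎ l ≡ d → 3 * l * K + K * d ≤ 2 * l * wsum cr y
    by-degree (inj₂ l≡d) = begin
      3 * l * K + K * d ≡⟨ cong (λ z → 3 * l * K + K * z) (sym l≡d) ⟩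
      3 * l * K + K * l ≡⟨ e₁ l K ⟩
      2 * l * (K * 2) ≤⟨ *-monoʳ-≤ (2 * l) (psum-≥ K (λ t t<K → crossed-twice (h + t) (+-monoʳ-< h t<K) S
           (root-nontrivial (A s) c (V≥2 s≤r) rc) (sym l≡d))) ⟩
      2 * l * psum (λ t → crossCount G (late t) S) K ≡⟨ cong (2 * l *_) (sym (wsum-uses cr late K)) ⟩
      2 * l * wsum cr y ∎
    by-degree (inj₁ l<d) = large d (wsum cr y) l<d (begin
      d * (a₀ * K) ≡⟨ trans (e₂ d (a₀ * K)) (sym (wsum-const cr (a₀ * K))) ⟩
      wsum cr (λ _ → a₀ * K) ≤⟨ wsum-mono cr (λ e cre → late-outside s e (crossing-outside (A s) c e cre)) ⟩
      wsum cr (λ e → b * y e + 5 * K) ≡⟨ wsum-linear cr b y (5 * K) ⟩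
      b * wsum cr y + 5 * K * d ≡⟨ cong (b * wsum cr y +_) (e₃ K d) ⟩
      b * wsum cr y + 5 * (d * K) ∎)

  load-sum : ∀ {s} → s ≤ r → 3 * l * K * V s + K * (2 * M s) ≤ 2 * l * (2 * Y s)
  load-sum {s} s≤r = class-inequality (A s) (closed s) (2 * l) K (3 * l * K) y (class-load s≤r)

  x-def : ∀ {s} → s ≤ r → l * V s + x s ≡ 2 * M s
  x-def s≤r = m+[n∸m]≡n (degree-sum s≤r)

  -- Per tree, the bounds 3/2 + d/(2l) sum to 2V + x/(2l), because the degrees sum to lV + x. Each
  -- edge is counted twice, which leaves V + x/(4l).
  load-excess : ∀ {s} → s ≤ r → 4 * l * (K * V s) + K * x s ≤ 4 * l * Y s
  load-excess {s} s≤r = begin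
    4 * l * (K * V s) + K * x s ≡⟨ e₁ l K (V s) (x s) ⟩
    3 * l * K * V s + K * (l * V s + x s) ≡⟨ cong (λ z → 3 * l * K * V s + K * z) (x-def s≤r) ⟩
    3 * l * K * V s + K * (2 * M s) ≤⟨ load-sum s≤r ⟩
    2 * l * (2 * Y s) ≡⟨ e₂ l (Y s) ⟩
    4 * l * Y s ∎
    where
    e₁ : ∀ l K V x → 4 * l * (K * V) + K * x ≡ 3 * l * K * V + K * (l * V + x)
    e₁ = solve-∀
    e₂ : ∀ l Y → 2 * l * (2 * Y) ≡ 4 * l * Y
    e₂ = solve-∀

  Z-def : ∀ {s} → s ≤ r → K * V s + Z s ≡ Y s
  Z-def {s} s≤r = m+[n∸m]≡n (cancel-scaled (4 * l) (*-mono-≤ {1} {4} (s≤s z≤n) 1≤l)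
    (≤-trans (m≤m+n (4 * l * (K * V s)) _) (load-excess s≤r)))

  middle-split : ∀ {s} → s < r → ∀ (f : Fin (m G) → ℕ) →
    wsum (∁ (A s)) f ≡ wsum (∁ (A (suc s))) f + wsum (A (suc s) ∖ A s) f
  middle-split {s} s<r f = trans (sum-cong pointwise)
    (sum-+ (λ e → ⟦ ∁ (A (suc s)) e ⟧ * f e) (λ e → ⟦ (A (suc s) ∖ A s) e ⟧ * f e))
    where
    bits : ∀ p p′ z → (p ≡ true → p′ ≡ true) → ⟦ not p ⟧ * z ≡ ⟦ not p′ ⟧ * z + ⟦ p′ ∧ not p ⟧ * z
    bits true  p′    z imp rewrite imp refl = refl
    bits false true  z imp = refl
    bits false false z imp = sym (+-identityʳ (1 * z))
    pointwise : ∀ e → ⟦ ∁ (A s) e ⟧ * f e ≡ ⟦ ∁ (A (suc s)) e ⟧ * f e + ⟦ (A (suc s) ∖ A s) e ⟧ * f e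
    pointwise e = bits (A s e) (A (suc s) e) (f e) (nested s<r e)

  middle-count : ∀ {s} → s < r → M s ≡ M (suc s) + ∣ A (suc s) ∖ A s ∣
  middle-count {s} s<r = trans (sym (unit (∁ (A s)))) (trans (middle-split s<r (λ _ → 1))
    (cong₂ _+_ (unit (∁ (A (suc s)))) (unit (A (suc s) ∖ A s))))
    where
    unit : ∀ (B : EdgeSet G) → wsum B (λ _ → 1) ≡ ∣ B ∣
    unit B = trans (wsum-const B 1) (*-identityˡ ∣ B ∣)

  middle-load : ∀ {s} → s < r → b * wsum (A (suc s) ∖ A s) y ≤ (a s + 3) * K * ∣ A (suc s) ∖ A s ∣
  middle-load {s} s<r = begin
    b * wsum mid y ≡⟨ sym (wsum-scale mid b y) ⟩
    wsum mid (λ e → b * y e) ≤⟨ wsum-mono mid (λ e me → late-middle s<r e (proj₁ (∧-true {A (suc s) e} me))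
        (not-true (proj₂ (∧-true {A (suc s) e} me)))) ⟩
    wsum mid (λ _ → (a s + 3) * K) ≡⟨ wsum-const mid _ ⟩
    (a s + 3) * K * ∣ mid ∣ ∎
    where mid = A (suc s) ∖ A s

  contradiction : ⊥
  contradiction = descent l K V x Z 1≤l 1≤K V-step Z-step D-step Z-start
    where
    V-step : ∀ s → s < r → V s + 4 * x (suc s) ≤ V (suc s) + 4 * x s
    V-step s s<r = rank-step l (a (suc s)) (r ∸ suc s) b (V s) (V (suc s)) (M s) (M (suc s)) (x s) (x (suc s))
      (s≤s z≤n) 1≤l (≤-trans (≤-reflexive total) a≤) (V-anti s<r)
      (trans 2b (cong (λ z → z * l + 64 * (l * l)) (sym total))) (x-def (<⇒≤ s<r)) (x-def s<r) (opt (suc s) (A s))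
      where
      swap : ∀ s a u → s + a + u ≡ s + u + a
      swap = solve-∀
      total : a (suc s) + (r ∸ suc s) ≡ r + a₀
      total = trans (swap (suc s) a₀ (r ∸ suc s)) (cong (_+ a₀) (m+[n∸m]≡n s<r))
    Z-step : ∀ s → s < r → 160 * (l * l) * Z s + 3 * K * V (suc s) ≤ 160 * (l * l) * Z (suc s) + 3 * K * V s
    Z-step s s<r = load-step (a s) b (160 * (l * l)) K (V s) (V (suc s)) (M s) (M (suc s)) _ (Y s) (Y (suc s)) _
      (Z s) (Z (suc s)) 1≤b (≤-trans ≤a (m≤n+m a₀ s)) (V-anti s<r) (middle-count s<r) (middle-split s<r y)
      (Z-def (<⇒≤ s<r)) (Z-def s<r) (opt s (A (suc s))) (middle-load s<r)
    D-step : ∀ s → s < r → Z (suc s) + K + K * V (suc s) ≤ K * V s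
    D-step s s<r = begin
      Z (suc s) + K + K * V (suc s) ≡⟨ e (Z (suc s)) K (K * V (suc s)) ⟩
      K * V (suc s) + Z (suc s) + K ≡⟨ cong (_+ K) (Z-def s<r) ⟩
      Y (suc s) + K ≤⟨ tree-sum s<r ⟩
      K * V s ∎
      where
      e : ∀ z k v → z + k + v ≡ v + z + k
      e = solve-∀
    Z-start : K * x 0 ≤ 4 * l * Z 0
    Z-start = +-cancelˡ-≤ (4 * l * (K * V 0)) _ _ (begin
      4 * l * (K * V 0) + K * x 0 ≤⟨ load-excess z≤n ⟩
      4 * l * Y 0 ≡⟨ cong (4 * l *_) (sym (Z-def z≤n)) ⟩
      4 * l * (K * V 0 + Z 0) ≡⟨ *-distribˡ-+ (4 * l) (K * V 0) (Z 0) ⟩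
      4 * l * (K * V 0) + 4 * l * Z 0 ∎)

-- Explicit constants and reduction to the density argument

scales : ∀ p K W → Scales (2 + p) K W
scales p K W = record
  { b    = level-scale l
  ; q    = 1024 * (l * l)
  ; a₀   = level-base l
  ; 1≤b  = *-mono-≤ {1} {128} (s≤s z≤n) (*-mono-≤ 1≤l² (s≤s (z≤n {1 + p})))
  ; 3≤q  = *-mono-≤ {3} {1024} (m≤m+n 3 1021) 1≤l²
  ; 1≤a₀ = ≤-trans (*-mono-≤ {1} {160} (s≤s z≤n) 1≤l²) (m≤m+n _ _)
  ; 4a≤q = ≤-trans (m≤m+n _ (256 * l)) (≤-reflexive (e₁ p))
  ; 2b   = e₂ p
  ; a≤   = ≤-trans (m≤m+n _ (64 * l)) (≤-reflexive (e₃ p))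
  ; ≤a   = m≤m+n _ _
  ; 8b   = ≤-trans (m≤m+n _ (1019 + 1022 * p + 256 * (p * p))) (≤-reflexive (e₄ p))
  ; large = λ d load l<d → cut-estimate p (d ∸ suc l) K d load (sym (m+[n∸m]≡n l<d))
  }
  where
  l = 2 + p
  1≤l² : 1 ≤ l * l
  1≤l² = s≤s z≤n
  e₁ : ∀ p → 4 * (32 * (2 + p) + (160 * ((2 + p) * (2 + p)) + 96 * ((2 + p) * (1 + p)))) + 256 * (2 + p) ≡
    1024 * ((2 + p) * (2 + p))
  e₁ = solve-∀
  e₂ : ∀ p → 2 * (128 * ((2 + p) * (2 + p) * (2 + p))) ≡
    (32 * (2 + p) + (160 * ((2 + p) * (2 + p)) + 96 * ((2 + p) * (1 + p)))) * (2 + p) + 64 * ((2 + p) * (2 + p))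
  e₂ = solve-∀
  e₃ : ∀ p → 32 * (2 + p) + (160 * ((2 + p) * (2 + p)) + 96 * ((2 + p) * (1 + p))) + 64 * (2 + p) ≡
    256 * ((2 + p) * (2 + p))
  e₃ = solve-∀
  e₄ : ∀ p → 1 + (2 + p) * (4 * (32 * (2 + p) + (160 * ((2 + p) * (2 + p)) + 96 * ((2 + p) * (1 + p)))) + 2) +
      (1019 + 1022 * p + 256 * (p * p)) ≡ 8 * (128 * ((2 + p) * (2 + p) * (2 + p)))
  e₄ = solve-∀

-- Trees beyond the packing are empty.
nth : ∀ {k} {B : Set} → (Fin k → B → Bool) → ℕ → B → Bool
nth {k} T i with i <? k
... | yes i<k = T (fromℕ< i<k)
... | no  _   = λ _ → false

nth-toℕ : ∀ {k} {B : Set} (T : Fin k → B → Bool) j → nth T (toℕ j) ≡ T j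
nth-toℕ {k} T j with toℕ j <? k
... | yes lt = cong T (FP.fromℕ<-toℕ j lt)
... | no ¬lt = ⊥-elim (¬lt (FP.toℕ<n j))

count-prefix : ∀ {k} (f : Fin k → Bool) (F : ℕ → Bool) → (∀ i → F (toℕ i) ≡ f i) → ∀ j → j ≤ k →
  countFin (λ i → ⌊ toℕ i <? j ⌋ ∧ f i) ≡ psum (λ t → ⟦ F t ⟧) j
count-prefix {k} f F eq zero j≤k = trans (sum-cong (λ i → cong (λ b → ⟦ b ∧ f i ⟧) (isYes≗does (toℕ i <? 0)))) (sum-0 k)
count-prefix {suc k} f F eq (suc j) (s≤s j≤k) = begin
  ⟦ f F.zero ⟧ + countFin (λ i → ⌊ toℕ (F.suc i) <? suc j ⌋ ∧ f (F.suc i))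
    ≡⟨ cong₂ _+_ (cong ⟦_⟧ (sym (eq F.zero))) (trans (count-cong (λ i → cong (_∧ f (F.suc i))
         (trans (isYes≗does (toℕ (F.suc i) <? suc j)) (sym (isYes≗does (toℕ i <? j))))))
         (count-prefix (f ∘ F.suc) (F ∘ suc) (eq ∘ F.suc) j j≤k)) ⟩
  ⟦ F 0 ⟧ + psum (λ t → ⟦ F (suc t) ⟧) j ≡⟨ sym (psum-+ (λ t → ⟦ F t ⟧) 1 j) ⟩
  psum (λ t → ⟦ F t ⟧) (suc j) ∎
  where open ≡-Reasoning

packWeight-uses : ∀ G {k} (T : Fin k → EdgeSet G) j e → packWeight G T j e ≡ uses (nth T) (toℕ j) e
packWeight-uses G T j e = count-prefix (λ i → T i e) (λ t → nth T t e)
  (λ i → cong (λ X → X e) (nth-toℕ T i)) (toℕ j) (<⇒≤ (FP.toℕ<n j))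

weight-cong : ∀ G {w w′ : Fin (m G) → ℕ} X → (∀ e → w e ≡ w′ e) → weight G w X ≡ weight G w′ X
weight-cong G X eq = sum-cong (λ e → cong (λ z → if X e then z else 0) (eq e))

module Search (G : Multigraph) (l : ℕ) where

  -- The sum of the two distances vanishes exactly when both equalities hold, so a minimizing S
  -- decides the question and provides the witness.
  crossed-once? : ∀ X → Dec (∃ λ S → cutSize G S ≡ l × crossCount G X S ≡ 1)
  crossed-once? X with BoolFun-min
    (λ S → ∣ cutSize G S - l ∣ + ∣ crossCount G X S - 1 ∣)
    (λ eq → cong₂ (λ x y → ∣ x - l ∣ + ∣ y - 1 ∣)
      (count-cong (λ e → cong₂ _xor_ (eq (proj₁ (ends G e))) (eq (proj₂ (ends G e)))))
      (count-cong (λ e → cong (X e ∧_) (cong₂ _xor_ (eq (proj₁ (ends G e))) (eq (proj₂ (ends G e)))))))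
  ... | S , least with ∣ cutSize G S - l ∣ + ∣ crossCount G X S - 1 ∣ in eq
  ...   | zero = yes (S , ∣m-n∣≡0⇒m≡n (m+n≡0⇒m≡0 _ eq) , ∣m-n∣≡0⇒m≡n (m+n≡0⇒n≡0 ∣ cutSize G S - l ∣ eq))
  ...   | suc _ = no λ { (S′ , c , x) → <⇒≱ (s≤s z≤n) (≤-trans (least S′)
            (≤-reflexive (cong₂ _+_ (m≡n⇒∣m-n∣≡0 c) (m≡n⇒∣m-n∣≡0 x)))) }

-- The additive load error q L multiplied by b, for q = c l² and b = d l³.
error : ℕ → ℕ → ℕ → ℕ → ℕ
error c d l L = c * (l * l) * L * (d * (l * l * l))

-- The factor 16 consists of 8W rounds before the loads separate and at least 8W rounds to observe;
-- 16·1024·128 is the final constant 2097152.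
error-bound : ∀ c d C → 16 * c * d ≡ C → ∀ l L → 8 * error c d l L + 8 * error c d l L ≤ C * l ^ 5 * L
error-bound c d _ refl l L = ≤-reflexive (e c d l L)
  where
  e : ∀ c d l L → 8 * (c * (l * l) * L * (d * (l * l * l))) + 8 * (c * (l * l) * L * (d * (l * l * l))) ≡
    16 * c * d * (l * (l * (l * (l * (l * 1))))) * L
  e = solve-∀

1≤error : ∀ c d l L → 1 ≤ c → 1 ≤ d → 1 ≤ l → 1 ≤ L → 1 ≤ error c d l L
1≤error c d l L 1≤c 1≤d 1≤l 1≤L = *-mono-≤ (*-mono-≤ (*-mono-≤ 1≤c (*-mono-≤ 1≤l 1≤l)) 1≤L)
  (*-mono-≤ 1≤d (*-mono-≤ (*-mono-≤ 1≤l 1≤l) 1≤l))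

large-connectivity : ∀ G p → (∃ λ S → Nontrivial G S × cutSize G S ≡ 2 + p) →
  (∀ S → Nontrivial G S → 2 + p ≤ cutSize G S) → ∀ k (T : Fin k → EdgeSet G) → IsGreedyTreePacking G T →
  ∀ W → W ≡ error 1024 128 (2 + p) ⌈log₂ m G ⌉ → 8 * W + 8 * W ≤ k →
  ∃ λ i → ∃ λ S → Nontrivial G S × cutSize G S ≡ 2 + p × crossCount G (T i) S ≡ 1
large-connectivity G p (S , nontrivial , size) connectivity k T greedy W W-def 16W≤k =
  conclude (FP.any? (λ i → Search.crossed-once? G l (T i)))
    where
    open Cuts G
    l = 2 + p
    K = k ∸ 8 * W
    m≥2 : 2 ≤ m G
    m≥2 = ≤-trans (s≤s (s≤s z≤n)) (≤-trans (≤-reflexive (sym size))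
      (≤-trans (count-mono {p = crosses G S} {λ _ → true} (λ _ _ → refl)) (≤-reflexive (sum-1 (m G)))))
    1≤W : 1 ≤ W
    1≤W = subst (1 ≤_) (sym W-def) (1≤error 1024 128 l ⌈log₂ m G ⌉ (s≤s z≤n) (s≤s z≤n) (s≤s z≤n) (⌈log₂⌉-mono-≤ m≥2))
    total : 8 * W + K ≡ k
    total = m+[n∸m]≡n (≤-trans (m≤m+n (8 * W) (8 * W)) 16W≤k)
    8W≤K : 8 * W ≤ K
    8W≤K = +-cancelˡ-≤ (8 * W) _ _ (≤-trans 16W≤k (≤-reflexive (sym total)))
    conclude : Dec (∃ λ i → ∃ λ S → cutSize G S ≡ l × crossCount G (T i) S ≡ 1) →
      ∃ λ i → ∃ λ S → Nontrivial G S × cutSize G S ≡ l × crossCount G (T i) S ≡ 1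
    -- The search did not ask for nontriviality; the edge in which T i crosses S has its ends on
    -- different sides and proves it.
    conclude (yes (i , S , c , x)) = i , S , crossing-nontrivial (proj₂ (∧-true {T i (proj₁ crossing)} (proj₂ crossing))) , c , x
      where crossing = count-witness (λ e → T i e ∧ crosses G S e) (≤-reflexive (sym x))
    conclude (no none) = ⊥-elim (Descent.contradiction G l K (s≤s z≤n) S size nontrivial connectivity
      W (scales p K W) W-def 1≤W 8W≤K (nth T)
      (λ i i< → by-index (λ i X → IsMinSpanningTree G (uses (nth T) i) X) tree (subst (i <_) total i<))
      (λ i i< → by-index (λ _ X → ∀ S → Nontrivial G S → cutSize G S ≡ l → 2 ≤ crossCount G X S)
        (λ j S nt c → ≤∧≢⇒< (crossCount-≥1 (proj₂ (proj₁ (greedy j))) nt) (λ x → none (j , S , c , sym x)))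
        (subst (i <_) total i<)))
      where
      by-index : (P : ℕ → EdgeSet G → Set) → (∀ j → P (toℕ j) (T j)) → ∀ {i} → i < k → P i (nth T i)
      by-index P h {i} i<k = subst (λ t → P t (nth T t)) (FP.toℕ-fromℕ< i<k)
        (subst (P (toℕ (fromℕ< i<k))) (sym (nth-toℕ T (fromℕ< i<k))) (h (fromℕ< i<k)))
      tree : ∀ j → IsMinSpanningTree G (uses (nth T) (toℕ j)) (T j)
      tree j = proj₁ (greedy j) , λ X Xtree → subst₂ _≤_
        (weight-cong G (T j) (packWeight-uses G T j)) (weight-cong G X (packWeight-uses G T j))
        (proj₂ (greedy j) X Xtree)

-- For m ≥ 2 the rounded binary logarithm is at most 2/log 2 times the natural one, so only the
-- constant changes. For m = 1 both logarithms vanish, and `1 ≤ k` guarantees that there is a tree.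
theorem1 : Σ ℕ λ C → (1 ≤ C) ×
    ((G : Multigraph) → Connected G → (l : ℕ) → IsEdgeConnectivity G l →
    (k : ℕ) → 1 ≤ k → C * l ^ 5 * ⌈log₂ m G ⌉ ≤ k →
    (T : Fin k → EdgeSet G) → IsGreedyTreePacking G T →
    ∃ λ i → ∃ λ S → Nontrivial G S × cutSize G S ≡ l × crossCount G (T i) S ≡ 1)
theorem1 = 2097152 , s≤s z≤n , main
  where
  main : (G : Multigraph) → Connected G → (l : ℕ) → IsEdgeConnectivity G l →
    (k : ℕ) → 1 ≤ k → 2097152 * l ^ 5 * ⌈log₂ m G ⌉ ≤ k →
    (T : Fin k → EdgeSet G) → IsGreedyTreePacking G T →
    ∃ λ i → ∃ λ S → Nontrivial G S × cutSize G S ≡ l × crossCount G (T i) S ≡ 1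
  main G connected zero ((S , nontrivial , size) , _) k 1≤k _ T greedy =
    ⊥-elim (<⇒≱ (Cuts.crossCount-≥1 G connected nontrivial) (≤-reflexive size))
  -- A minimum cut is a single bridge here, which every spanning tree contains; the first tree
  -- serves.
  main G connected (suc zero) ((S , nontrivial , size) , _) k 1≤k _ T greedy =
    i , S , nontrivial , size , ≤-antisym
      (≤-trans (count-mono (λ e h → proj₂ (∧-true {T i e} h))) (≤-reflexive size))
      (Cuts.crossCount-≥1 G (proj₂ (proj₁ (greedy i))) nontrivial)
    where i = fromℕ< 1≤k
  main G connected (suc (suc p)) (cut , connectivity) k 1≤k C≤k T greedy =
    large-connectivity G p cut connectivity k T greedy (error 1024 128 (2 + p) ⌈log₂ m G ⌉) refl
      (≤-trans (error-bound 1024 128 2097152 refl (2 + p) ⌈log₂ m G ⌉) C≤k)
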